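{- Let $u\in S_\infty$, let $k$ be a positive integer, and let $p$ be an integer with $p\le k$. Then $$\mathfrak{S}_u(x;y)\,E_{p,k}(x;z)=\sum_{w\in S_\infty:\ u\xrightarrow{k}w}E_{p-\ell(u,w),\,k-\ell(u,w)}\bigl(y_{P_k(u,w)};z\bigr)\,\mathfrak{S}_w(x;y).$$
   Context: **Permutations.** $\mathbb{N}=\{1,2,3,\dots\}$. $S_\infty$ is the group of bijections $\mathbb{N}\to\mathbb{N}$ fixing all but finitely many elements, with product $(uv)(i)=u(v(i))$ and identity $1$; $S_n\subset S_\infty$ is the subgroup of $u$ with $u(i)=i$ for $i>n$. $s_i$ ($i\ge 1$) is the transposition of $i$ and $i+1$; $t_{ab}=t_{ba}$ ($a\ne b$) is the transposition of $a$ and $b$. $\ell(u)$ is the number of pairs $i<j$ with $u(i)>u(j)$, and $\ell(u,w)=\ell(w)-\ell(u)$. **Double Schubert polynomials.** Work in the polynomial ring $\mathbb{Z}[x,y,z]$ in the variables $x_i,y_i,z_i$ ($i\in\mathbb{N}$). $s_i$ acts by the ring automorphism exchanging $x_i$ and $x_{i+1}$ and fixing all other variables. Put $\partial^{s_i}(P)=\frac{P-s_i(P)}{x_i-x_{i+1}}$, and $\partial^u=\partial^{s_{i_1}}\cdots\partial^{s_{i_m}}$ for any reduced word $u=s_{i_1}\cdots s_{i_m}$, $m=\ell(u)$ (independent of the choice). Let $w_0(n)\in S_{n+1}$ be given by $w_0(n)(i)=n+2-i$ for $i\le n+1$, and $\mathfrak{S}_{w_0(n)}(x;y)=\prod_{i,j\ge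 1,\ i+j\le n+1}(x_i-y_j)$. For $u\in S_{n+1}$, $\mathfrak{S}_u(x;y)=\partial^{u^{ -1}w_0(n)}(\mathfrak{S}_{w_0(n)}(x;y))$ (independent of $n$). $\mathfrak{S}_v(x;z)$ is obtained by replacing each $y_j$ by $z_j$. **Factorial elementary symmetric polynomials.** For $0\le p\le k$ let $c_{p,k}=s_{k+1-p}s_{k+2-p}\cdots s_k$ (the identity if $p=0$) and $E_{p,k}(x;z)=\mathfrak{S}_{c_{p,k}}(x;z)$; among the $x$ variables only $x_1,\dots,x_k$ occur in it. If $p<0$ or $p>k$, $E_{p,k}(x;z)=0$. If $A$ is a finite set of positive integers with elements $a_1<\dots<a_m$, then $E_{q,m}(y_A;z)$ denotes $E_{q,m}(x;z)$ with $x_i$ replaced by $y_{a_i}$ for $1\le i\le m$. **The relation $\xrightarrow{k}$.** For $u,u'\in S_\infty$ and a positive integer $k$, write $u\xrightarrow{k}u'$ if there exist $r$ with $0\le r\le k$ and transpositions $t_{a_1b_1},\dots,t_{a_rb_r}$ such that (1) $a_i\le k<b_i$ for all $i$; (2) $a_i\ne a_j$ for $i\neq j$; (3) $\ell(ut_{a_1b_1}\cdots t_{a_ib_i})=\ell(u)+i$ for all $i$; (4) $u'=ut_{a_1b_1}\cdots t_{a_rb_r}$. If $u\xrightarrow{k}w$, let $P_k(u,w)=\{u(i)\mid i\le k,\ u(i)=w(i)\}$; this set has exactly $k-\ell(u,w)$ elements. -}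

module Defs where

open import Algebra.Bundles using (CommutativeRing)
open import Algebra.Solver.Ring.AlmostCommutativeRing
  using (AlmostCommutativeRing; fromCommutativeRing; _-Raw-AlmostCommutative⟶_)
import Algebra.Solver.Ring as RingSolver
import Algebra.Properties.AbelianGroup as AbelianGroupProperties
import Algebra.Properties.Semiring.Divisibility as Divisibility
open import Data.Bool.Base using (true; false; if_then_else_)
open import Data.Integer as ℤ using (ℤ; +_; -[1+_])
import Data.Integer.Properties as ℤₚ
open import Data.List.Base
  using (List; []; _∷_; _∷ʳ_; _++_; map; foldr; filter; length; upTo; take; drop; head)
import Data.List.Membership.Setoid as Membership
open import Data.List.Properties using (upTo-∷ʳ; filter-++; map-++; length-++)
open import Data.List.Relation.Unary.All using (All)
open import Data.List.Relation.Unary.Unique.Propositional using (Unique)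
import Data.List.Relation.Unary.Unique.Setoid as UniqueSetoid
import Data.List.Sort as Sort
open import Data.Maybe.Base using (Maybe; maybe′; just; nothing)
open import Data.Nat as ℕ using (ℕ; zero; suc; _≤_; _<_; _∸_; _⊔_; s≤s; z≤n)
open import Data.Nat.ListAction using (sum)
open import Data.Nat.ListAction.Properties using (sum-++)
import Data.Nat.Properties as ℕₚ
open import Data.Product.Base using (_×_; _,_; proj₁)
open import Data.Sum.Base using (inj₁; inj₂)
open import Function.Base using (_∘_)
open import Function.Bundles using (_↔_; Inverse; mk↔ₛ′)
open import Function.Construct.Composition using (_↔-∘_)
open import Function.Construct.Identity using (↔-id)
open import Function.Construct.Symmetry using (↔-sym)
open import Level using (0ℓ)
open import Relation.Binary.Bundles using (Setoid)
open import Relation.Binary.Core using (Rel)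
import Relation.Binary.Reasoning.Setoid as ≈-Reasoning
open import Relation.Binary.Structures using (IsEquivalence)
open import Relation.Binary.PropositionalEquality as ≡ using (_≡_; _≢_)
open import Relation.Nullary.Decidable using (yes; no; does; dec-true; dec-false)
open import Relation.Nullary.Negation.Core using (¬_; contradiction)
open import Relation.Unary using (Pred)

-- Indices are shifted by one throughout: the natural number i stands for the
-- positive integer i + 1, both as an argument or value of a permutation and as
-- the index of a variable or of a simple transposition.  A bound 1 ≤ a ≤ k on
-- a positive integer thus becomes a < k, and k < b becomes k ≤ b.
-- Cardinalities, lengths and the numbers k, p, n are not shifted.

------------------------------------------------------------------------
-- Permutations

record S∞ : Set where
  field
    bijection : ℕ ↔ ℕ
    bound     : ℕ
    fixed     : ∀ i → bound ≤ i → Inverse.to bijection i ≡ i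

open S∞ public

infixl 8 _⟨$⟩_
infixl 7 _·_
infix  8 _⁻¹
infix  4 _≋_

_⟨$⟩_ : S∞ → ℕ → ℕ
u ⟨$⟩ i = Inverse.to (bijection u) i

-- The field bound is only a witness of finite support, so permutations are
-- compared as functions.
_≋_ : Rel S∞ 0ℓ
u ≋ v = ∀ i → u ⟨$⟩ i ≡ v ⟨$⟩ i

S∞-setoid : Setoid 0ℓ 0ℓ
S∞-setoid = record
  { Carrier       = S∞
  ; _≈_           = _≋_
  ; isEquivalence = record
    { refl  = λ _ → ≡.refl
    ; sym   = λ p i → ≡.sym (p i)
    ; trans = λ p q i → ≡.trans (p i) (q i)
    }
  }

ι : S∞
ι = record { bijection = ↔-id ℕ ; bound = 0 ; fixed = λ _ _ → ≡.refl }

_·_ : S∞ → S∞ → S∞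
u · v = record
  { bijection = bijection u ↔-∘ bijection v
  ; bound     = bound u ⊔ bound v
  ; fixed     = λ i b → ≡.trans
      (≡.cong (u ⟨$⟩_) (fixed v i (ℕₚ.≤-trans (ℕₚ.m≤n⊔m (bound u) (bound v)) b)))
      (fixed u i (ℕₚ.≤-trans (ℕₚ.m≤m⊔n (bound u) (bound v)) b))
  }

_⁻¹ : S∞ → S∞
u ⁻¹ = record
  { bijection = ↔-sym (bijection u)
  ; bound     = bound u
  ; fixed     = λ i b → Inverse.inverseʳ (bijection u) (≡.sym (fixed u i b))
  }

∏ₛ : List S∞ → S∞
∏ₛ = foldr _·_ ι

involution : (f : ℕ → ℕ) → (∀ i → f (f i) ≡ i) →
             (n : ℕ) → (∀ i → n ≤ i → f i ≡ i) → S∞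
involution f f∘f n fix = record
  { bijection = mk↔ₛ′ f f f∘f f∘f ; bound = n ; fixed = fix }

swap : ℕ → ℕ → ℕ → ℕ
swap a b c with c ℕ.≟ a
... | yes _ = b
... | no  _ with c ℕ.≟ b
...   | yes _ = a
...   | no  _ = c

swapˡ : ∀ a b → swap a b a ≡ b
swapˡ a b with a ℕ.≟ a
... | yes _   = ≡.refl
... | no  a≢a = contradiction ≡.refl a≢a

swapʳ : ∀ a b → swap a b b ≡ a
swapʳ a b with b ℕ.≟ a
... | yes b≡a = b≡a
... | no  _ with b ℕ.≟ b
...   | yes _   = ≡.refl
...   | no  b≢b = contradiction ≡.refl b≢b

swap-other : ∀ a b {c} → c ≢ a → c ≢ b → swap a b c ≡ c
swap-other a b {c} c≢a c≢b with c ℕ.≟ a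
... | yes c≡a = contradiction c≡a c≢a
... | no  _ with c ℕ.≟ b
...   | yes c≡b = contradiction c≡b c≢b
...   | no  _   = ≡.refl

swap-involutive : ∀ a b c → swap a b (swap a b c) ≡ c
swap-involutive a b c with c ℕ.≟ a
... | yes c≡a = ≡.trans (swapʳ a b) (≡.sym c≡a)
... | no  c≢a with c ℕ.≟ b
...   | yes c≡b = ≡.trans (swapˡ a b) (≡.sym c≡b)
...   | no  c≢b = swap-other a b c≢a c≢b

t : ℕ → ℕ → S∞
t a b = involution (swap a b) (swap-involutive a b) (suc (a ⊔ b)) λ i a⊔b<i →
  swap-other a b
    (λ i≡a → ℕₚ.<⇒≢ (ℕₚ.≤-trans (s≤s (ℕₚ.m≤m⊔n a b)) a⊔b<i) (≡.sym i≡a))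
    (λ i≡b → ℕₚ.<⇒≢ (ℕₚ.≤-trans (s≤s (ℕₚ.m≤n⊔m a b)) a⊔b<i) (≡.sym i≡b))

s : ℕ → S∞
s i = t i (suc i)

reversal : ℕ → ℕ → ℕ
reversal n i with i ℕ.≤? n
... | yes _ = n ∸ i
... | no  _ = i

reversal-involutive : ∀ n i → reversal n (reversal n i) ≡ i
reversal-involutive n i with i ℕ.≤? n
reversal-involutive n i | yes i≤n with (n ∸ i) ℕ.≤? n
... | yes _     = ℕₚ.m∸[m∸n]≡n i≤n
... | no  n∸i≰n = contradiction (ℕₚ.m∸n≤m n i) n∸i≰n
reversal-involutive n i | no i≰n with i ℕ.≤? n
... | yes i≤n = contradiction i≤n i≰n
... | no  _   = ≡.refl

reversal-fixed : ∀ n i → suc n ≤ i → reversal n i ≡ i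
reversal-fixed n i n<i with i ℕ.≤? n
... | yes i≤n = contradiction n<i (ℕₚ.≤⇒≯ i≤n)
... | no  _   = ≡.refl

w₀ : ℕ → S∞
w₀ n = involution (reversal n) (reversal-involutive n) (suc n) (reversal-fixed n)

------------------------------------------------------------------------
-- Length and reduced words

-- The number of i < j with v < f i.
countAbove : (ℕ → ℕ) → ℕ → ℕ → ℕ
countAbove f j v = length (filter (λ i → v ℕ.<? f i) (upTo j))

inversionsBelow : (ℕ → ℕ) → ℕ → ℕ
inversionsBelow f n = sum (map (λ j → countAbove f j (f j)) (upTo n))

-- By ℓ-stable below, no inversion of u involves a position j ≥ bound u, so
-- this counts all of them.
ℓ : S∞ → ℕ
ℓ u = inversionsBelow (u ⟨$⟩_) (bound u)

ℓ[_,_] : S∞ → S∞ → ℤ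
ℓ[ u , w ] = + ℓ w ℤ.- + ℓ u

record ReducedWord (u : S∞) : Set where
  field
    word    : List ℕ
    product : ∏ₛ (map s word) ≋ u
    minimal : length word ≡ ℓ u

open ReducedWord public

private
  χ : ℕ → ℕ → ℕ
  χ v w = if does (v ℕ.<? w) then 1 else 0

  χ-yes : ∀ {v w} → v < w → χ v w ≡ 1
  χ-yes {v} {w} v<w = ≡.cong (if_then 1 else 0) (dec-true (v ℕ.<? w) v<w)

  χ-no : ∀ {v w} → ¬ v < w → χ v w ≡ 0
  χ-no {v} {w} v≮w = ≡.cong (if_then 1 else 0) (dec-false (v ℕ.<? w) v≮w)

countAbove-suc : ∀ f j v → countAbove f (suc j) v ≡
  countAbove f j v ℕ.+ (if does (v ℕ.<? f j) then 1 else 0)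
countAbove-suc f j v = begin
  length (filter P? (upTo (suc j)))
    ≡⟨ ≡.cong (length ∘ filter P?) (upTo-∷ʳ j) ⟨
  length (filter P? (upTo j ∷ʳ j))
    ≡⟨ ≡.cong length (filter-++ P? (upTo j) (j ∷ [])) ⟩
  length (filter P? (upTo j) ++ filter P? (j ∷ []))
    ≡⟨ length-++ (filter P? (upTo j)) ⟩
  countAbove f j v ℕ.+ length (filter P? (j ∷ []))
    ≡⟨ ≡.cong (countAbove f j v ℕ.+_) last ⟩
  countAbove f j v ℕ.+ χ v (f j) ∎
  where
  open ≡.≡-Reasoning
  P? = λ i → v ℕ.<? f i
  last : length (filter P? (j ∷ [])) ≡ χ v (f j)
  last with does (v ℕ.<? f j)
  ... | true  = ≡.refl
  ... | false = ≡.refl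

inversionsBelow-suc : ∀ f n →
  inversionsBelow f (suc n) ≡ inversionsBelow f n ℕ.+ countAbove f n (f n)
inversionsBelow-suc f n = begin
  sum (map h (upTo (suc n)))
    ≡⟨ ≡.cong (sum ∘ map h) (upTo-∷ʳ n) ⟨
  sum (map h (upTo n ∷ʳ n))
    ≡⟨ ≡.cong sum (map-++ h (upTo n) (n ∷ [])) ⟩
  sum (map h (upTo n) ∷ʳ h n)
    ≡⟨ sum-++ (map h (upTo n)) (h n ∷ []) ⟩
  inversionsBelow f n ℕ.+ (h n ℕ.+ 0)
    ≡⟨ ≡.cong (inversionsBelow f n ℕ.+_) (ℕₚ.+-identityʳ (h n)) ⟩
  inversionsBelow f n ℕ.+ h n ∎
  where
  open ≡.≡-Reasoning
  h = λ j → countAbove f j (f j)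

private
  countAbove-zero : ∀ f j v → (∀ i → i < j → ¬ v < f i) → countAbove f j v ≡ 0
  countAbove-zero f zero    v none = ≡.refl
  countAbove-zero f (suc j) v none = ≡.trans (countAbove-suc f j v)
    (≡.cong₂ ℕ._+_ (countAbove-zero f j v λ i i<j → none i (ℕₚ.m<n⇒m<1+n i<j))
                   (χ-no (none j (ℕₚ.n<1+n j))))

  -- A function g obtained from f by exchanging the values f i > f (suc i).
  module Descent (f g : ℕ → ℕ) (i : ℕ)
    (gᵢ    : g i ≡ f (suc i))
    (gᵢ₊₁  : g (suc i) ≡ f i)
    (other : ∀ j → j ≢ i → j ≢ suc i → g j ≡ f j)
    (fi>fi+1 : f (suc i) < f i)
    where

    open ≡.≡-Reasoning

    gⱼ-below : ∀ {j} → j < i → g j ≡ f j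
    gⱼ-below {j} j<i = other j (ℕₚ.<⇒≢ j<i) (ℕₚ.<⇒≢ (ℕₚ.m<n⇒m<1+n j<i))

    gⱼ-above : ∀ d → g (suc (suc i) ℕ.+ d) ≡ f (suc (suc i) ℕ.+ d)
    gⱼ-above d = other _
      (λ e → ℕₚ.<⇒≢ (s≤s (ℕₚ.≤-trans (ℕₚ.m≤m+n i d) (ℕₚ.n≤1+n _))) (≡.sym e))
      (λ e → ℕₚ.<⇒≢ (s≤s (s≤s (ℕₚ.m≤m+n i d))) (≡.sym e))

    count-below : ∀ v j → j ≤ i → countAbove g j v ≡ countAbove f j v
    count-below v zero    _   = ≡.refl
    count-below v (suc j) j<i = begin
      countAbove g (suc j) v             ≡⟨ countAbove-suc g j v ⟩
      countAbove g j v ℕ.+ χ v (g j)     ≡⟨ ≡.cong₂ ℕ._+_ (count-below v j (ℕₚ.<⇒≤ j<i))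
                                                         (≡.cong (χ v) (gⱼ-below j<i)) ⟩
      countAbove f j v ℕ.+ χ v (f j)     ≡⟨ countAbove-suc f j v ⟨
      countAbove f (suc j) v             ∎

    count-above : ∀ v d → countAbove g (suc (suc i) ℕ.+ d) v ≡ countAbove f (suc (suc i) ℕ.+ d) v
    count-above v zero rewrite ℕₚ.+-identityʳ i = begin
      countAbove g (suc (suc i)) v
        ≡⟨ countAbove-suc g (suc i) v ⟩
      countAbove g (suc i) v ℕ.+ χ v (g (suc i))
        ≡⟨ ≡.cong (ℕ._+ χ v (g (suc i))) (countAbove-suc g i v) ⟩
      countAbove g i v ℕ.+ χ v (g i) ℕ.+ χ v (g (suc i))
        ≡⟨ ≡.cong₂ ℕ._+_ (≡.cong₂ ℕ._+_ (count-below v i ℕₚ.≤-refl) (≡.cong (χ v) gᵢ))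
                         (≡.cong (χ v) gᵢ₊₁) ⟩
      countAbove f i v ℕ.+ χ v (f (suc i)) ℕ.+ χ v (f i)
        ≡⟨ ℕₚ.+-assoc (countAbove f i v) _ _ ⟩
      countAbove f i v ℕ.+ (χ v (f (suc i)) ℕ.+ χ v (f i))
        ≡⟨ ≡.cong (countAbove f i v ℕ.+_) (ℕₚ.+-comm (χ v (f (suc i))) _) ⟩
      countAbove f i v ℕ.+ (χ v (f i) ℕ.+ χ v (f (suc i)))
        ≡⟨ ℕₚ.+-assoc (countAbove f i v) _ _ ⟨
      countAbove f i v ℕ.+ χ v (f i) ℕ.+ χ v (f (suc i))
        ≡⟨ ≡.cong (ℕ._+ χ v (f (suc i))) (countAbove-suc f i v) ⟨
      countAbove f (suc i) v ℕ.+ χ v (f (suc i))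
        ≡⟨ countAbove-suc f (suc i) v ⟨
      countAbove f (suc (suc i)) v ∎
    count-above v (suc d) rewrite ℕₚ.+-suc i d = begin
      countAbove g (suc j) v          ≡⟨ countAbove-suc g j v ⟩
      countAbove g j v ℕ.+ χ v (g j)  ≡⟨ ≡.cong₂ ℕ._+_ (count-above v d)
                                                      (≡.cong (χ v) (gⱼ-above d)) ⟩
      countAbove f j v ℕ.+ χ v (f j)  ≡⟨ countAbove-suc f j v ⟨
      countAbove f (suc j) v          ∎
      where j = suc (suc i) ℕ.+ d

    inv-below : ∀ j → j ≤ i → inversionsBelow g j ≡ inversionsBelow f j
    inv-below zero    _   = ≡.refl
    inv-below (suc j) j<i = begin
      inversionsBelow g (suc j)                       ≡⟨ inversionsBelow-suc g j ⟩
      inversionsBelow g j ℕ.+ countAbove g j (g j)    ≡⟨ ≡.cong₂ ℕ._+_ (inv-below j (ℕₚ.<⇒≤ j<i)) count ⟩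
      inversionsBelow f j ℕ.+ countAbove f j (f j)    ≡⟨ inversionsBelow-suc f j ⟨
      inversionsBelow f (suc j)                       ∎
      where
      count : countAbove g j (g j) ≡ countAbove f j (f j)
      count = ≡.trans (count-below (g j) j (ℕₚ.<⇒≤ j<i))
                      (≡.cong (countAbove f j) (gⱼ-below j<i))

    inv-above : ∀ d → inversionsBelow f (suc (suc i) ℕ.+ d) ≡
                      suc (inversionsBelow g (suc (suc i) ℕ.+ d))
    inv-above zero rewrite ℕₚ.+-identityʳ i = begin
      inversionsBelow f (suc (suc i))
        ≡⟨ inversionsBelow-suc f (suc i) ⟩
      inversionsBelow f (suc i) ℕ.+ countAbove f (suc i) (f (suc i))
        ≡⟨ ≡.cong₂ ℕ._+_ (inversionsBelow-suc f i) (countAbove-suc f i (f (suc i))) ⟩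
      a ℕ.+ b ℕ.+ (c ℕ.+ χ (f (suc i)) (f i))
        ≡⟨ ≡.cong (λ e → a ℕ.+ b ℕ.+ (c ℕ.+ e)) (χ-yes fi>fi+1) ⟩
      a ℕ.+ b ℕ.+ (c ℕ.+ 1)
        ≡⟨ ≡.cong (a ℕ.+ b ℕ.+_) (ℕₚ.+-comm c 1) ⟩
      a ℕ.+ b ℕ.+ suc c
        ≡⟨ ℕₚ.+-suc (a ℕ.+ b) c ⟩
      suc (a ℕ.+ b ℕ.+ c)
        ≡⟨ ≡.cong suc (ℕₚ.+-assoc a b c) ⟩
      suc (a ℕ.+ (b ℕ.+ c))
        ≡⟨ ≡.cong (λ e → suc (a ℕ.+ e)) (ℕₚ.+-comm b c) ⟩
      suc (a ℕ.+ (c ℕ.+ b))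
        ≡⟨ ≡.cong suc (ℕₚ.+-assoc a c b) ⟨
      suc (a ℕ.+ c ℕ.+ b)
        ≡⟨ ≡.cong suc (≡.cong₂ ℕ._+_ eq₁ eq₂) ⟨
      suc (inversionsBelow g (suc i) ℕ.+ countAbove g (suc i) (g (suc i)))
        ≡⟨ ≡.cong suc (inversionsBelow-suc g (suc i)) ⟨
      suc (inversionsBelow g (suc (suc i))) ∎
      where
      a = inversionsBelow f i
      b = countAbove f i (f i)
      c = countAbove f i (f (suc i))
      eq₁ : inversionsBelow g (suc i) ≡ a ℕ.+ c
      eq₁ = begin
        inversionsBelow g (suc i)                     ≡⟨ inversionsBelow-suc g i ⟩
        inversionsBelow g i ℕ.+ countAbove g i (g i)  ≡⟨ ≡.cong₂ ℕ._+_ (inv-below i ℕₚ.≤-refl)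
                                                          (count-below (g i) i ℕₚ.≤-refl) ⟩
        a ℕ.+ countAbove f i (g i)                    ≡⟨ ≡.cong (λ v → a ℕ.+ countAbove f i v) gᵢ ⟩
        a ℕ.+ c                                       ∎
      eq₂ : countAbove g (suc i) (g (suc i)) ≡ b
      eq₂ = begin
        countAbove g (suc i) (g (suc i))              ≡⟨ ≡.cong (countAbove g (suc i)) gᵢ₊₁ ⟩
        countAbove g (suc i) (f i)                    ≡⟨ countAbove-suc g i (f i) ⟩
        countAbove g i (f i) ℕ.+ χ (f i) (g i)        ≡⟨ ≡.cong₂ ℕ._+_ (count-below (f i) i ℕₚ.≤-refl)
                                                          (≡.cong (χ (f i)) gᵢ) ⟩
        b ℕ.+ χ (f i) (f (suc i))                     ≡⟨ ≡.cong (b ℕ.+_) (χ-no (ℕₚ.<-asym fi>fi+1)) ⟩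
        b ℕ.+ 0                                       ≡⟨ ℕₚ.+-identityʳ b ⟩
        b                                             ∎
    inv-above (suc d) rewrite ℕₚ.+-suc i d = begin
      inversionsBelow f (suc j)                           ≡⟨ inversionsBelow-suc f j ⟩
      inversionsBelow f j ℕ.+ countAbove f j (f j)        ≡⟨ ≡.cong₂ ℕ._+_ (inv-above d) count ⟩
      suc (inversionsBelow g j ℕ.+ countAbove g j (g j))  ≡⟨ ≡.cong suc (inversionsBelow-suc g j) ⟨
      suc (inversionsBelow g (suc j))                     ∎
      where
      j = suc (suc i) ℕ.+ d
      count : countAbove f j (f j) ≡ countAbove g j (g j)
      count = ≡.trans (≡.cong (countAbove f j) (≡.sym (gⱼ-above d)))
                      (≡.sym (count-above (g j) d))

⟨$⟩-injective : ∀ u {i j} → u ⟨$⟩ i ≡ u ⟨$⟩ j → i ≡ j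
⟨$⟩-injective u {i} {j} eq = ≡.trans (≡.sym (Inverse.strictlyInverseʳ (bijection u) i))
  (≡.trans (≡.cong (Inverse.from (bijection u)) eq) (Inverse.strictlyInverseʳ (bijection u) j))

⟨$⟩-below : ∀ u {i j} → bound u ≤ j → i < j → u ⟨$⟩ i < j
⟨$⟩-below u {i} {j} b≤j i<j with ℕₚ.<-≤-connex (u ⟨$⟩ i) j
... | inj₁ ui<j = ui<j
... | inj₂ j≤ui = contradiction j≤i (ℕₚ.<⇒≱ i<j)
  where
  ui≡i : u ⟨$⟩ i ≡ i
  ui≡i = ⟨$⟩-injective u (fixed u (u ⟨$⟩ i) (ℕₚ.≤-trans b≤j j≤ui))
  j≤i : j ≤ i
  j≤i = ≡.subst (j ≤_) ui≡i j≤ui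

ℓ-stable : ∀ u n → bound u ≤ n → inversionsBelow (u ⟨$⟩_) n ≡ ℓ u
ℓ-stable u n b≤n = ≡.subst (λ m → inversionsBelow (u ⟨$⟩_) m ≡ ℓ u)
                           (ℕₚ.m+[n∸m]≡n b≤n) (go (n ∸ bound u))
  where
  open ≡.≡-Reasoning
  f = u ⟨$⟩_
  go : ∀ d → inversionsBelow f (bound u ℕ.+ d) ≡ ℓ u
  go zero    = ≡.cong (inversionsBelow f) (ℕₚ.+-identityʳ (bound u))
  go (suc d) rewrite ℕₚ.+-suc (bound u) d = begin
    inversionsBelow f (suc j)                     ≡⟨ inversionsBelow-suc f j ⟩
    inversionsBelow f j ℕ.+ countAbove f j (f j)  ≡⟨ ≡.cong₂ ℕ._+_ (go d) (countAbove-zero f j (f j) none) ⟩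
    ℓ u ℕ.+ 0                                     ≡⟨ ℕₚ.+-identityʳ (ℓ u) ⟩
    ℓ u                                           ∎
    where
    j = bound u ℕ.+ d
    b≤j = ℕₚ.m≤m+n (bound u) d
    none : ∀ i → i < j → ¬ f j < f i
    none i i<j fj<fi = ℕₚ.<-asym (⟨$⟩-below u b≤j i<j)
                                 (≡.subst (_< f i) (fixed u j b≤j) fj<fi)

ℓ-descent : ∀ u i → u ⟨$⟩ suc i < u ⟨$⟩ i → ℓ u ≡ suc (ℓ (u · s i))
ℓ-descent u i desc = ≡.trans (≡.sym (ℓ-stable u n (ℕₚ.m≤m⊔n (bound u) _))) at-n
  where
  n = bound (u · s i)
  open Descent (u ⟨$⟩_) ((u · s i) ⟨$⟩_) i
    (≡.cong (u ⟨$⟩_) (swapˡ i (suc i)))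
    (≡.cong (u ⟨$⟩_) (swapʳ i (suc i)))
    (λ j j≢i j≢i+1 → ≡.cong (u ⟨$⟩_) (swap-other i (suc i) j≢i j≢i+1))
    desc
    using (inv-above)
  i+2≤n : suc (suc i) ≤ n
  i+2≤n = ℕₚ.≤-trans (s≤s (ℕₚ.m≤n⊔m i (suc i))) (ℕₚ.m≤n⊔m (bound u) _)
  at-n : inversionsBelow (u ⟨$⟩_) n ≡ suc (ℓ (u · s i))
  at-n = ≡.subst
    (λ m → inversionsBelow (u ⟨$⟩_) m ≡ suc (inversionsBelow ((u · s i) ⟨$⟩_) m))
    (ℕₚ.m+[n∸m]≡n i+2≤n) (inv-above (n ∸ suc (suc i)))

private
  no-descent⇒ι : ∀ u → (∀ i → i < bound u → ¬ u ⟨$⟩ suc i < u ⟨$⟩ i) → ι ≋ u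
  no-descent⇒ι u none i with ℕₚ.≤-total (bound u) i
  ... | inj₁ b≤i = ≡.sym (fixed u i b≤i)
  ... | inj₂ i≤b = ℕₚ.≤-antisym (lower i) upper
    where
    increasing : ∀ j → u ⟨$⟩ j < u ⟨$⟩ suc j
    increasing j with ℕₚ.<-≤-connex j (bound u)
    ... | inj₁ j<b = ℕₚ.≤∧≢⇒< (ℕₚ.≮⇒≥ (none j j<b))
                           (λ e → ℕₚ.<⇒≢ (ℕₚ.n<1+n j) (⟨$⟩-injective u e))
    ... | inj₂ b≤j = ≡.subst₂ _<_ (≡.sym (fixed u j b≤j))
                           (≡.sym (fixed u (suc j) (ℕₚ.m≤n⇒m≤1+n b≤j))) (ℕₚ.n<1+n j)
    lower : ∀ j → j ≤ u ⟨$⟩ j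
    lower zero    = z≤n
    lower (suc j) = ℕₚ.≤-<-trans (lower j) (increasing j)
    spread : ∀ d → u ⟨$⟩ i ℕ.+ d ≤ u ⟨$⟩ (i ℕ.+ d)
    spread zero    rewrite ℕₚ.+-identityʳ i | ℕₚ.+-identityʳ (u ⟨$⟩ i) = ℕₚ.≤-refl
    spread (suc d) rewrite ℕₚ.+-suc i d | ℕₚ.+-suc (u ⟨$⟩ i) d =
      ℕₚ.≤-<-trans (spread d) (increasing (i ℕ.+ d))
    upper : u ⟨$⟩ i ≤ i
    upper = ℕₚ.+-cancelʳ-≤ (bound u ∸ i) (u ⟨$⟩ i) i (begin
      u ⟨$⟩ i ℕ.+ (bound u ∸ i)      ≤⟨ spread (bound u ∸ i) ⟩
      u ⟨$⟩ (i ℕ.+ (bound u ∸ i))    ≡⟨ ≡.cong (u ⟨$⟩_) (ℕₚ.m+[n∸m]≡n i≤b) ⟩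
      u ⟨$⟩ bound u                  ≡⟨ fixed u (bound u) ℕₚ.≤-refl ⟩
      bound u                        ≡⟨ ℕₚ.m+[n∸m]≡n i≤b ⟨
      i ℕ.+ (bound u ∸ i)            ∎)
      where open ℕₚ.≤-Reasoning

  ℓ-ι : ∀ u → ι ≋ u → 0 ≡ ℓ u
  ℓ-ι u ι≋u = ≡.sym (go (bound u))
    where
    go : ∀ n → inversionsBelow (u ⟨$⟩_) n ≡ 0
    go zero    = ≡.refl
    go (suc n) = ≡.trans (inversionsBelow-suc (u ⟨$⟩_) n) (≡.cong₂ ℕ._+_ (go n)
      (countAbove-zero (u ⟨$⟩_) n (u ⟨$⟩ n) λ i i<n un<ui →
        ℕₚ.<-asym i<n (≡.subst₂ _<_ (≡.sym (ι≋u n)) (≡.sym (ι≋u i)) un<ui)))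

  ∏ₛ-∷ʳ : ∀ is i → ∏ₛ (map s (is ∷ʳ i)) ≋ ∏ₛ (map s is) · s i
  ∏ₛ-∷ʳ []       i j = ≡.refl
  ∏ₛ-∷ʳ (i′ ∷ is) i j = ≡.cong (s i′ ⟨$⟩_) (∏ₛ-∷ʳ is i j)

reducedWord : ∀ u → ReducedWord u
reducedWord u = go (ℓ u) u ≡.refl
  where
  go : ∀ m v → ℓ v ≡ m → ReducedWord v
  go m v ℓv≡m with ℕₚ.anyUpTo? (λ i → v ⟨$⟩ suc i ℕ.<? v ⟨$⟩ i) (bound v)
  go m v ℓv≡m | no none = record
    { word    = []
    ; product = ι≋v
    ; minimal = ℓ-ι v ι≋v
    }
    where ι≋v = no-descent⇒ι v λ i i<b d → none (i , i<b , d)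
  go zero v ℓv≡m | yes (i , _ , d) =
    contradiction (≡.trans (≡.sym (ℓ-descent v i d)) ℓv≡m) λ ()
  go (suc m) v ℓv≡m | yes (i , _ , d) = record
    { word    = word r ∷ʳ i
    ; product = λ j → ≡.trans (∏ₛ-∷ʳ (word r) i j)
        (≡.trans (product r (s i ⟨$⟩ j)) (≡.cong (v ⟨$⟩_) (swap-involutive i (suc i) j)))
    ; minimal = ≡.trans (length-++ (word r)) (≡.trans (ℕₚ.+-comm (length (word r)) 1)
        (≡.trans (≡.cong suc (minimal r)) (≡.sym (ℓ-descent v i d))))
    }
    where
    r : ReducedWord (v · s i)
    r = go m (v · s i) (ℕₚ.suc-injective (≡.trans (≡.sym (ℓ-descent v i d)) ℓv≡m))

------------------------------------------------------------------------
-- The polynomial ring ℤ[x,y,z]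

data Var : Set where
  x[_] y[_] z[_] : ℕ → Var

infixl 6 _+_ _-_
infixl 7 _*_
infix  8 -_
infix  4 _≈_

-- Polynomials are ring expressions with integer constants, and _≈_ is the
-- congruence generated by the laws of commutative rings together with the
-- arithmetic of ℤ: the free commutative ℤ-algebra on Var.
data Poly : Set where
  con     : ℤ → Poly
  var     : Var → Poly
  _+_ _*_ : Poly → Poly → Poly
  -_      : Poly → Poly

data _≈_ : Rel Poly 0ℓ where
  ≈-refl      : ∀ {P} → P ≈ P
  ≈-sym       : ∀ {P Q} → P ≈ Q → Q ≈ P
  ≈-trans     : ∀ {P Q R} → P ≈ Q → Q ≈ R → P ≈ R
  +-cong      : ∀ {P P′ Q Q′} → P ≈ P′ → Q ≈ Q′ → P + Q ≈ P′ + Q′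
  *-cong      : ∀ {P P′ Q Q′} → P ≈ P′ → Q ≈ Q′ → P * Q ≈ P′ * Q′
  -‿cong      : ∀ {P P′} → P ≈ P′ → - P ≈ - P′
  +-assoc     : ∀ P Q R → (P + Q) + R ≈ P + (Q + R)
  +-comm      : ∀ P Q → P + Q ≈ Q + P
  +-identityˡ : ∀ P → con (+ 0) + P ≈ P
  -‿inverseˡ  : ∀ P → - P + P ≈ con (+ 0)
  *-assoc     : ∀ P Q R → (P * Q) * R ≈ P * (Q * R)
  *-comm      : ∀ P Q → P * Q ≈ Q * P
  *-identityˡ : ∀ P → con (+ 1) * P ≈ P
  distribˡ    : ∀ P Q R → P * (Q + R) ≈ P * Q + P * R
  con-+       : ∀ a b → con (a ℤ.+ b) ≈ con a + con b
  con-*       : ∀ a b → con (a ℤ.* b) ≈ con a * con b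

_-_ : Poly → Poly → Poly
P - Q = P + - Q

ℤ[x,y,z] : CommutativeRing 0ℓ 0ℓ
ℤ[x,y,z] = record
  { Carrier = Poly
  ; _≈_ = _≈_
  ; _+_ = _+_
  ; _*_ = _*_
  ; -_  = -_
  ; 0#  = con (+ 0)
  ; 1#  = con (+ 1)
  ; isCommutativeRing = record
    { isRing = record
      { +-isAbelianGroup = record
        { isGroup = record
          { isMonoid = record
            { isSemigroup = record
              { isMagma = record { isEquivalence = isEquivalence ; ∙-cong = +-cong }
              ; assoc   = +-assoc
              }
            ; identity = +-identityˡ , λ P → ≈-trans (+-comm P _) (+-identityˡ P)
            }
          ; inverse = -‿inverseˡ , λ P → ≈-trans (+-comm P _) (-‿inverseˡ P)
          ; ⁻¹-cong = -‿cong
          }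
        ; comm = +-comm
        }
      ; *-cong     = *-cong
      ; *-assoc    = *-assoc
      ; *-identity = *-identityˡ , λ P → ≈-trans (*-comm P _) (*-identityˡ P)
      ; distrib    = distribˡ , λ P Q R → ≈-trans (*-comm (Q + R) P)
          (≈-trans (distribˡ P Q R) (+-cong (*-comm P Q) (*-comm P R)))
      }
    ; *-comm = *-comm
    }
  }
  where
  isEquivalence : IsEquivalence _≈_
  isEquivalence = record { refl = ≈-refl ; sym = ≈-sym ; trans = ≈-trans }

open CommutativeRing ℤ[x,y,z] public using () renaming (setoid to Poly-setoid)
open Divisibility (CommutativeRing.semiring ℤ[x,y,z]) public using (_∣_)
open Divisibility (CommutativeRing.semiring ℤ[x,y,z]) using (_,_)

private
  ℤ[x,y,z]-acr : AlmostCommutativeRing 0ℓ 0ℓ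
  ℤ[x,y,z]-acr = fromCommutativeRing ℤ[x,y,z]

  con-neg : ∀ a → con (ℤ.- a) ≈ - con a
  con-neg a = inverseˡ-unique (con (ℤ.- a)) (con a)
    (≈-trans (≈-sym (con-+ (ℤ.- a) a)) (≈-reflexive (≡.cong con (ℤₚ.+-inverseˡ a))))
    where
    open CommutativeRing ℤ[x,y,z] using () renaming (+-abelianGroup to G; reflexive to ≈-reflexive)
    open AbelianGroupProperties G using (inverseˡ-unique)

  con-morphism : CommutativeRing.rawRing ℤₚ.+-*-commutativeRing
                 -Raw-AlmostCommutative⟶ ℤ[x,y,z]-acr
  con-morphism = record
    { ⟦_⟧    = con
    ; +-homo = con-+
    ; *-homo = con-*
    ; -‿homo = con-neg
    ; 0-homo = ≈-refl
    ; 1-homo = ≈-refl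
    }

  con≟ : ∀ a b → Maybe (con a ≈ con b)
  con≟ a b with a ℤ.≟ b
  ... | yes ≡.refl = just ≈-refl
  ... | no  _      = nothing

module PolySolver = RingSolver (CommutativeRing.rawRing ℤₚ.+-*-commutativeRing)
  ℤ[x,y,z]-acr con-morphism con≟
open PolySolver using (solve; _:=_; _:+_; _:*_; :-_; _:-_) renaming (con to :con)

infix 9 _[_]

-- Substitution of θ v for each variable v.
_[_] : Poly → (Var → Poly) → Poly
con a   [ θ ] = con a
var v   [ θ ] = θ v
(P + Q) [ θ ] = P [ θ ] + Q [ θ ]
(P * Q) [ θ ] = P [ θ ] * Q [ θ ]
(- P)   [ θ ] = - P [ θ ]

[]-cong : ∀ θ {P Q} → P ≈ Q → P [ θ ] ≈ Q [ θ ]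
[]-cong θ ≈-refl            = ≈-refl
[]-cong θ (≈-sym e)         = ≈-sym ([]-cong θ e)
[]-cong θ (≈-trans e f)     = ≈-trans ([]-cong θ e) ([]-cong θ f)
[]-cong θ (+-cong e f)      = +-cong ([]-cong θ e) ([]-cong θ f)
[]-cong θ (*-cong e f)      = *-cong ([]-cong θ e) ([]-cong θ f)
[]-cong θ (-‿cong e)        = -‿cong ([]-cong θ e)
[]-cong θ (+-assoc P Q R)   = +-assoc _ _ _
[]-cong θ (+-comm P Q)      = +-comm _ _
[]-cong θ (+-identityˡ P)   = +-identityˡ _
[]-cong θ (-‿inverseˡ P)    = -‿inverseˡ _
[]-cong θ (*-assoc P Q R)   = *-assoc _ _ _
[]-cong θ (*-comm P Q)      = *-comm _ _
[]-cong θ (*-identityˡ P)   = *-identityˡ _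
[]-cong θ (distribˡ P Q R)  = distribˡ _ _ _
[]-cong θ (con-+ a b)       = con-+ a b
[]-cong θ (con-* a b)       = con-* a b

∑ ∏ : List Poly → Poly
∑ = foldr _+_ (con (+ 0))
∏ = foldr _*_ (con (+ 1))

------------------------------------------------------------------------
-- Divided differences

-- ∂ i P below is the quotient of P - s_i(P) by x_i - x_{i+1}, for which it has
-- to be shown that the division is exact; ∂-unique shows that the quotient is
-- unique.
--
-- If d divides v - θ v for every variable v, then d divides P - P [ θ ] for
-- every P, by the Leibniz rule
--   PQ - θ(P)θ(Q) = (P - θ(P)) Q + θ(P) (Q - θ(Q)).
module Quotient (d : Poly) (θ : Var → Poly) (d∣ : ∀ v → d ∣ var v - θ v) where

  D : Poly → Poly
  D (con a) = con (+ 0)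
  D (var v) = let q , _ = d∣ v in q
  D (P + Q) = D P + D Q
  D (P * Q) = D P * Q + P [ θ ] * D Q
  D (- P)   = - D P

  D-spec : ∀ P → D P * d ≈ P - P [ θ ]
  D-spec (con a) = solve 2 (λ c d → :con (+ 0) :* d := c :- c) ≈-refl (con a) d
  D-spec (var v) = let _ , eq = d∣ v in eq
  D-spec (P + Q) = begin
    (D P + D Q) * d                  ≈⟨ solve 3 (λ a b d → (a :+ b) :* d := a :* d :+ b :* d) ≈-refl (D P) (D Q) d ⟩
    D P * d + D Q * d                ≈⟨ +-cong (D-spec P) (D-spec Q) ⟩
    P - P [ θ ] + (Q - Q [ θ ])      ≈⟨ solve 4 (λ p p′ q q′ → p :- p′ :+ (q :- q′) := p :+ q :- (p′ :+ q′))
                                          ≈-refl P (P [ θ ]) Q (Q [ θ ]) ⟩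
    P + Q - (P [ θ ] + Q [ θ ])      ∎
    where open ≈-Reasoning Poly-setoid
  D-spec (P * Q) = begin
    (D P * Q + P [ θ ] * D Q) * d                ≈⟨ solve 5 (λ a q p′ b d → (a :* q :+ p′ :* b) :* d := a :* d :* q :+ p′ :* (b :* d))
                                                      ≈-refl (D P) Q (P [ θ ]) (D Q) d ⟩
    D P * d * Q + P [ θ ] * (D Q * d)            ≈⟨ +-cong (*-cong (D-spec P) ≈-refl) (*-cong ≈-refl (D-spec Q)) ⟩
    (P - P [ θ ]) * Q + P [ θ ] * (Q - Q [ θ ])  ≈⟨ solve 4 (λ p p′ q q′ → (p :- p′) :* q :+ p′ :* (q :- q′) := p :* q :- p′ :* q′)
                                                      ≈-refl P (P [ θ ]) Q (Q [ θ ]) ⟩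
    P * Q - P [ θ ] * Q [ θ ]                    ∎
    where open ≈-Reasoning Poly-setoid
  D-spec (- P) = begin
    - D P * d          ≈⟨ solve 2 (λ a d → :- a :* d := :- (a :* d)) ≈-refl (D P) d ⟩
    - (D P * d)        ≈⟨ -‿cong (D-spec P) ⟩
    - (P - P [ θ ])    ≈⟨ solve 2 (λ p p′ → :- (p :- p′) := :- p :- (:- p′)) ≈-refl P (P [ θ ]) ⟩
    - P - (- P [ θ ])  ∎
    where open ≈-Reasoning Poly-setoid

  D-cong : ∀ {P Q} → P ≈ Q → D P ≈ D Q
  D-cong ≈-refl        = ≈-refl
  D-cong (≈-sym e)     = ≈-sym (D-cong e)
  D-cong (≈-trans e f) = ≈-trans (D-cong e) (D-cong f)
  D-cong (+-cong e f)  = +-cong (D-cong e) (D-cong f)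
  D-cong (*-cong e f)  = +-cong (*-cong (D-cong e) f) (*-cong ([]-cong θ e) (D-cong f))
  D-cong (-‿cong e)    = -‿cong (D-cong e)
  D-cong (+-assoc P Q R)  = +-assoc _ _ _
  D-cong (+-comm P Q)     = +-comm _ _
  D-cong (+-identityˡ P)  = +-identityˡ _
  D-cong (-‿inverseˡ P)   = -‿inverseˡ _
  D-cong (*-assoc P Q R)  =
    solve 7 (λ a q r p′ b q′ c → (a :* q :+ p′ :* b) :* r :+ p′ :* q′ :* c := a :* (q :* r) :+ p′ :* (b :* r :+ q′ :* c))
      ≈-refl (D P) Q R (P [ θ ]) (D Q) (Q [ θ ]) (D R)
  D-cong (*-comm P Q)     = begin
    D P * Q + P [ θ ] * D Q
      ≈⟨ solve 5 (λ a b p′ q q′ → a :* q :+ p′ :* b := a :* (q :- q′) :+ a :* q′ :+ p′ :* b)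
           ≈-refl (D P) (D Q) (P [ θ ]) Q (Q [ θ ]) ⟩
    D P * (Q - Q [ θ ]) + D P * Q [ θ ] + P [ θ ] * D Q
      ≈⟨ +-cong (+-cong (*-cong ≈-refl (≈-sym (D-spec Q))) ≈-refl) ≈-refl ⟩
    D P * (D Q * d) + D P * Q [ θ ] + P [ θ ] * D Q
      ≈⟨ solve 5 (λ a b d p′ q′ → a :* (b :* d) :+ a :* q′ :+ p′ :* b := b :* (a :* d) :+ b :* p′ :+ q′ :* a)
           ≈-refl (D P) (D Q) d (P [ θ ]) (Q [ θ ]) ⟩
    D Q * (D P * d) + D Q * P [ θ ] + Q [ θ ] * D P
      ≈⟨ +-cong (+-cong (*-cong ≈-refl (D-spec P)) ≈-refl) ≈-refl ⟩
    D Q * (P - P [ θ ]) + D Q * P [ θ ] + Q [ θ ] * D P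
      ≈⟨ solve 5 (λ a b p p′ q′ → b :* (p :- p′) :+ b :* p′ :+ q′ :* a := b :* p :+ q′ :* a)
           ≈-refl (D P) (D Q) P (P [ θ ]) (Q [ θ ]) ⟩
    D Q * P + Q [ θ ] * D P ∎
    where open ≈-Reasoning Poly-setoid
  D-cong (*-identityˡ P)  =
    solve 2 (λ p a → :con (+ 0) :* p :+ :con (+ 1) :* a := a) ≈-refl P (D P)
  D-cong (distribˡ P Q R) =
    solve 6 (λ a q r p′ b c → a :* (q :+ r) :+ p′ :* (b :+ c) := a :* q :+ p′ :* b :+ (a :* r :+ p′ :* c))
      ≈-refl (D P) Q R (P [ θ ]) (D Q) (D R)
  D-cong (con-+ a b) = ≈-sym (+-identityˡ _)
  D-cong (con-* a b) =
    solve 2 (λ a b → :con (+ 0) := :con (+ 0) :* b :+ a :* :con (+ 0)) ≈-refl (con a) (con b)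

  -- When D d = 1, multiplication by d is injective.
  D-retraction : D d ≈ con (+ 1) → ∀ Q → D (Q * d) ≈ Q
  D-retraction Dd≈1 Q = begin
    D Q * d + Q [ θ ] * D d            ≈⟨ +-cong (D-spec Q) (*-cong ≈-refl Dd≈1) ⟩
    Q - Q [ θ ] + Q [ θ ] * con (+ 1)  ≈⟨ solve 2 (λ q q′ → q :- q′ :+ q′ :* :con (+ 1) := q) ≈-refl Q (Q [ θ ]) ⟩
    Q                                  ∎
    where open ≈-Reasoning Poly-setoid

s-act : ℕ → Var → Poly
s-act i x[ j ] = var x[ s i ⟨$⟩ j ]
s-act i y[ j ] = var y[ j ]
s-act i z[ j ] = var z[ j ]

xᵢ-xᵢ₊₁ : ℕ → Poly
xᵢ-xᵢ₊₁ i = var x[ i ] - var x[ suc i ]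

private
  ∣v-v : ∀ d v → d ∣ v - v
  ∣v-v d v = con (+ 0) , solve 2 (λ d v → :con (+ 0) :* d := v :- v) ≈-refl d v

  s-act-divisible : ∀ i v → xᵢ-xᵢ₊₁ i ∣ var v - s-act i v
  s-act-divisible i x[ j ] with j ℕ.≟ i
  ... | yes ≡.refl = con (+ 1) , *-identityˡ _
  ... | no _ with j ℕ.≟ suc i
  ...   | yes ≡.refl = - con (+ 1) ,
          solve 2 (λ a b → :- :con (+ 1) :* (a :- b) := b :- a) ≈-refl (var x[ i ]) (var x[ suc i ])
  ...   | no _ = ∣v-v (xᵢ-xᵢ₊₁ i) (var x[ j ])
  s-act-divisible i y[ j ] = ∣v-v (xᵢ-xᵢ₊₁ i) (var y[ j ])
  s-act-divisible i z[ j ] = ∣v-v (xᵢ-xᵢ₊₁ i) (var z[ j ])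

∂-divisible : ∀ i P → xᵢ-xᵢ₊₁ i ∣ P - P [ s-act i ]
∂-divisible i P = D P , D-spec P
  where open Quotient (xᵢ-xᵢ₊₁ i) (s-act i) (s-act-divisible i)

∂ : ℕ → Poly → Poly
∂ i P = let q , _ = ∂-divisible i P in q

∂-cong : ∀ i {P Q} → P ≈ Q → ∂ i P ≈ ∂ i Q
∂-cong i = D-cong
  where open Quotient (xᵢ-xᵢ₊₁ i) (s-act i) (s-act-divisible i)

private
  identify : ℕ → Var → Poly
  identify i x[ j ] with j ℕ.≟ i
  ... | yes _ = var x[ suc i ]
  ... | no  _ = var x[ j ]
  identify i y[ j ] = var y[ j ]
  identify i z[ j ] = var z[ j ]

  identify-divisible : ∀ i v → xᵢ-xᵢ₊₁ i ∣ var v - identify i v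
  identify-divisible i x[ j ] with j ℕ.≟ i
  ... | yes ≡.refl = con (+ 1) , *-identityˡ _
  ... | no _       = ∣v-v (xᵢ-xᵢ₊₁ i) (var x[ j ])
  identify-divisible i y[ j ] = ∣v-v (xᵢ-xᵢ₊₁ i) (var y[ j ])
  identify-divisible i z[ j ] = ∣v-v (xᵢ-xᵢ₊₁ i) (var z[ j ])

*-cancelʳ-xᵢ-xᵢ₊₁ : ∀ i P Q → P * xᵢ-xᵢ₊₁ i ≈ Q * xᵢ-xᵢ₊₁ i → P ≈ Q
*-cancelʳ-xᵢ-xᵢ₊₁ i P Q eq =
  ≈-trans (≈-sym (D-retraction Dd≈1 P)) (≈-trans (D-cong eq) (D-retraction Dd≈1 Q))
  where
  open Quotient (xᵢ-xᵢ₊₁ i) (identify i) (identify-divisible i)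
  Dd≈1 : D (xᵢ-xᵢ₊₁ i) ≈ con (+ 1)
  Dd≈1 with i ℕ.≟ i | suc i ℕ.≟ i
  ... | yes ≡.refl | no _     = solve 0 (:con (+ 1) :- :con (+ 0) := :con (+ 1)) ≈-refl
  ... | no i≢i     | _        = contradiction ≡.refl i≢i
  ... | yes _      | yes 1+i≡i = contradiction (≡.sym 1+i≡i) (ℕₚ.<⇒≢ (ℕₚ.n<1+n i))

∂-unique : ∀ i P Q → Q * xᵢ-xᵢ₊₁ i ≈ P - P [ s-act i ] → Q ≈ ∂ i P
∂-unique i P Q eq = let _ , ∂-eq = ∂-divisible i P in
  *-cancelʳ-xᵢ-xᵢ₊₁ i Q (∂ i P) (≈-trans eq (≈-sym ∂-eq))

∂^ : S∞ → Poly → Poly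
∂^ u P = foldr ∂ P (word (reducedWord u))

------------------------------------------------------------------------
-- Double Schubert polynomials

-- The product over i + j < n, which is i + j ≤ n + 1 in positive indices.
𝔖w₀ : ℕ → Poly
𝔖w₀ n = ∏ (map (λ i → ∏ (map (λ j → var x[ i ] - var y[ j ]) (upTo (n ∸ i)))) (upTo n))

-- The n used here is bound u; note S_{bound u} ⊂ S_{bound u + 1}.
𝔖 : S∞ → Poly
𝔖 u = ∂^ (u ⁻¹ · w₀ n) (𝔖w₀ n)
  where n = bound u

y↦z : Var → Poly
y↦z x[ i ] = var x[ i ]
y↦z y[ i ] = var z[ i ]
y↦z z[ i ] = var z[ i ]

-- s_{k+1-p} ⋯ s_k in positive indices.
c : ℕ → ℕ → S∞
c p k = ∏ₛ (map (λ j → s (k ∸ p ℕ.+ j)) (upTo p))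

E : ℤ → ℤ → Poly
E (+ p)    (+ k)    = if does (p ℕ.≤? k) then 𝔖 (c p k) [ y↦z ] else con (+ 0)
E (+ _)    -[1+ _ ] = con (+ 0)
E -[1+ _ ] _        = con (+ 0)

-- x_i ↦ y_{a_i} for a₀ < a₁ < ⋯ the entries of the list; the x_i beyond the
-- end of the list stay.
x↦y : List ℕ → Var → Poly
x↦y as x[ i ] = maybe′ (λ a → var y[ a ]) (var x[ i ]) (head (drop i as))
x↦y as y[ i ] = var y[ i ]
x↦y as z[ i ] = var z[ i ]

------------------------------------------------------------------------
-- The relation u ⟶[ k ] w and the set P_k(u,w)

infix 4 _⟶[_]_

record _⟶[_]_ (u : S∞) (k : ℕ) (u′ : S∞) : Set where
  field
    transpositions : List (ℕ × ℕ)
  r : ℕ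
  r = length transpositions
  ∏t : ℕ → S∞
  ∏t i = ∏ₛ (map (λ (a , b) → t a b) (take i transpositions))
  field
    r≤k      : r ≤ k
    a≤k<b    : All (λ (a , b) → a < k × k ≤ b) transpositions
    distinct : Unique (map proj₁ transpositions)
    lengths  : ∀ i → 1 ≤ i → i ≤ r → ℓ (u · ∏t i) ≡ ℓ u ℕ.+ i
    end      : u′ ≋ u · ∏t r

-- The elements of the set P_k(u,w), in increasing order.
𝒫 : ℕ → S∞ → S∞ → List ℕ
𝒫 k u w = sort (map (u ⟨$⟩_) (filter (λ i → u ⟨$⟩ i ℕ.≟ w ⟨$⟩ i) (upTo k)))
  where open Sort ℕₚ.≤-decTotalOrder using (sort)

------------------------------------------------------------------------
-- Finite subsets of S∞

open Membership S∞-setoid using (_∈_)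

-- ws lists the elements of the subset A, each exactly once up to _≋_.
record _Enumerates_ (ws : List S∞) (A : Pred S∞ 0ℓ) : Set where
  field
    sound    : All A ws
    complete : ∀ w → A w → w ∈ ws
    distinct : UniqueSetoid.Unique S∞-setoid ws

{-# OPTIONS --safe #-}
module Submission where

-- Both sides are compared with their images under the exchange σ of y_i and
-- y_{i+1}.  As σ acts on double Schubert polynomials by
--   σ 𝔖_w = 𝔖_w + (y_i - y_{i+1}) 𝔖_{s_i w}  or  σ 𝔖_w = 𝔖_w,
-- according to whether s_i w < w or not, the formula for u implies the formula
-- for s_i u < u, provided that the coefficients c(u,w) satisfy a three-term
-- recursion.  The latter is a statement about two pairs of permutations, u and
-- s_i u, w and s_i w; it follows from the description of the k-Bruhat order by
-- inequalities between the values of u and w, and from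
--   E_{q,m}(a, A) - E_{q,m}(b, A) = (a - b) E_{q-1,m-1}(A).
-- The induction starts at w₀(n) with n ≥ k, where only products of
-- transpositions t_{a,n+1} with a < k occur.  They give dominant permutations,
-- whose Schubert polynomials are products, and the formula becomes the
-- expansion of E_{p,k} when each x_a is replaced by (x_a - y_{n-a}) + y_{n-a}.

open import Defs
open import Algebra.Bundles using (CommutativeRing)
import Algebra.Definitions.RawMagma as RawMagmaDefinitions
open import Data.Bool.Base using (if_then_else_)
open import Data.Integer as ℤ using (ℤ; +_) renaming (_≤_ to _≤ℤ_; _-_ to _-ℤ_)
import Data.Integer.Properties as ℤₚ
import Data.Integer.Solver as ℤSolver
open import Data.List using (List; []; _∷_; _∷ʳ_; _++_; map; foldr; filter; length; upTo; applyUpTo; take; drop; head; deduplicate)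
open import Data.List.Membership.Propositional using (_∈_; _∉_; find; lose)
open import Data.List.Membership.Propositional.Properties
  using (∈-upTo⁺; ∈-upTo⁻; ∈-filter⁺; ∈-filter⁻; ∈-∃++; ∈-map⁺; ∈-map⁻; ∈-++⁺ˡ; ∈-++⁺ʳ; ∈-++⁻)
open import Data.List.Membership.Setoid.Properties using (∈-deduplicate⁻)
open import Data.List.Properties
  using (++-assoc; ++-identityʳ; filter-++; filter-accept; filter-all; filter-reject; foldr-∷ʳ;
         length-++; length-map; length-upTo; map-++; map-∘; map-cong; upTo-∷ʳ)
open import Data.List.Relation.Binary.Permutation.Propositional as ↭
  using (_↭_; ↭-sym; ↭-trans; ↭-refl; ↭-reflexive; prep)
open import Data.List.Relation.Binary.Permutation.Propositional.Properties
  using (shift; ∈-resp-↭; ↭-length; ∷↭∷ʳ) renaming (map⁺ to ↭-map⁺)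
open import Data.List.Relation.Unary.All as All using (All; []; _∷_)
import Data.List.Relation.Unary.All.Properties as Allₚ
open import Data.List.Relation.Unary.AllPairs as AllPairs using (AllPairs; []; _∷_)
import Data.List.Relation.Unary.AllPairs.Properties as AllPairsₚ
open import Data.List.Relation.Unary.Any as Any using (Any; here; there)
import Data.List.Relation.Unary.Any.Properties as Anyₚ
import Data.List.Relation.Unary.Unique.DecSetoid.Properties as UniqueDec
open import Data.List.Relation.Unary.Unique.Propositional using (Unique)
open import Data.List.Relation.Unary.Unique.Propositional.Properties using (upTo⁺)
import Data.List.Sort as Sort
open import Data.Maybe.Base using (maybe′)
open import Data.Nat as ℕ using (ℕ; zero; suc; _≤_; _<_; _∸_; _⊔_; s≤s; z≤n)
import Data.Nat.Properties as ℕₚ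
open import Data.Nat.Properties
  using (+-cancelˡ-≤; +-identityʳ; +-mono-<-≤; +-mono-≤; +-mono-≤-<; +-monoʳ-<; +-monoʳ-≤; +-suc;
         +-∸-assoc; 1+n≢n; 1+n≰n; <-asym; <-cmp; <-irrefl; <-trans; <-≤-connex; <-≤-trans; <⇒≢;
         <⇒≤; <⇒≱; >⇒≢; allUpTo?; m+[n∸m]≡n; m+n∸m≡n; m+n≤o⇒m≤o∸n; m<m+n; m<n⇒0<n∸m; m<n⇒m<1+n;
         m∸[m∸n]≡n; m∸n+n≡m; m∸n≤m; m≤m+n; m≤m⊔n; m≤n+m; m≤n+o⇒m∸n≤o; m≤n⇒m<n∨m≡n; m≤n⇒m∸n≡0;
         m≤n⇒m≤1+n; m≤n⊔m; n<1+n; n∸n≡0; n≤1+n; pred[m∸n]≡m∸[1+n]; suc-injective; ∸-monoʳ-<;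
         ∸-monoʳ-≤; ≤-<-connex; ≤-<-trans; ≤-antisym; ≤-refl; ≤-reflexive; ≤-total; ≤-trans; ≤⇒≯;
         ≤∧≢⇒<; ≮⇒≥; ≰⇒>)
open import Data.Product using (∃-syntax; _×_; _,_; proj₁; proj₂)
open import Data.Sum using (_⊎_; inj₁; inj₂)
open import Function.Base using (_∘_)
open import Function.Bundles using (Inverse)
open import Relation.Binary.Definitions using (Tri; tri<; tri≈; tri>)
open import Relation.Binary.PropositionalEquality as ≡
  using (_≡_; _≢_; refl; sym; trans; cong; cong₂; subst; subst₂)
import Relation.Binary.Reasoning.Setoid as ≈-Reasoning
open import Relation.Nullary using (¬_; Dec; yes; no; contradiction)
open import Relation.Nullary.Decidable using (does; dec-true; map′; _×-dec_; _→-dec_; _⊎-dec_; ¬?)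
open import Relation.Unary using (Decidable)

open PolySolver using (solve; _:=_; _:+_; _:*_; :-_; _:-_) renaming (con to :con)
open CommutativeRing ℤ[x,y,z] using (zeroˡ; zeroʳ) renaming (reflexive to ≡⇒≈)
open ≈-Reasoning Poly-setoid

-- The relation `u ⟶[ k ] w` quantifies over chains of transpositions, and a chain from u says
-- little about chains from s_i u. It is therefore replaced by `_⇢_`: inequalities between values,
-- with an equation between ℓ(w) - ℓ(u) and the number of the first k positions that move. Left
-- multiplication by s_i changes this description only at the positions of i and i + 1, which leaves
-- a finite case analysis. The index p is traded for the codegree j = k - p. As p and k drop by the
-- same amount ℓ(u,w), all coefficients for given j are values of one symmetric function of lists of
-- varying length. No explicit formula for it is needed: it is known through its divided
-- differences, which preserve j. The factor E_{p,k}(x;z) contains no y, so σ fixes it, and y_i -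
-- y_{i+1} can be cancelled; this is how the formula for s_i u is read off. The sums run over lists
-- that may contain permutations of coefficient zero, so that a list can be enlarged until it is
-- closed under s_i; they are cut down only at the end.

invˡ : ∀ u i → u ⁻¹ ⟨$⟩ (u ⟨$⟩ i) ≡ i
invˡ u = Inverse.strictlyInverseʳ (bijection u)

invʳ : ∀ u i → u ⟨$⟩ (u ⁻¹ ⟨$⟩ i) ≡ i
invʳ u = Inverse.strictlyInverseˡ (bijection u)

⁻¹-≡ : ∀ u {i j} → u ⟨$⟩ i ≡ j → u ⁻¹ ⟨$⟩ j ≡ i
⁻¹-≡ u {i} refl = invˡ u i

≡-⁻¹ : ∀ u {i j} → u ⁻¹ ⟨$⟩ j ≡ i → u ⟨$⟩ i ≡ j
≡-⁻¹ u {j = j} refl = invʳ u j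

⁻¹-cong : ∀ u v → u ≋ v → u ⁻¹ ≋ v ⁻¹
⁻¹-cong u v p i = ⁻¹-≡ u (trans (p _) (invʳ v i))

t-involutive : ∀ u a b → u · t a b · t a b ≋ u
t-involutive u a b i = cong (u ⟨$⟩_) (swap-involutive a b i)

s-involutiveˡ : ∀ i u → s i · (s i · u) ≋ u
s-involutiveˡ i u j = swap-involutive i (suc i) (u ⟨$⟩ j)

≢⇒<⊎> : ∀ {m n} → m ≢ n → m < n ⊎ n < m
≢⇒<⊎> {m} {n} m≢n with <-cmp m n
... | tri< lt _ _ = inj₁ lt
... | tri≈ _ eq _ = contradiction eq m≢n
... | tri> _ _ gt = inj₂ gt

-- Length

countAbove-cong : ∀ {f g} j v → (∀ i → f i ≡ g i) → countAbove f j v ≡ countAbove g j v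
countAbove-cong zero v p = refl
countAbove-cong {f} {g} (suc j) v p = trans (countAbove-suc f j v)
  (trans (cong₂ ℕ._+_ (countAbove-cong j v p) (cong (λ e → if does (v ℕ.<? e) then 1 else 0) (p j)))
         (sym (countAbove-suc g j v)))

inversionsBelow-cong : ∀ {f g} n → (∀ i → f i ≡ g i) → inversionsBelow f n ≡ inversionsBelow g n
inversionsBelow-cong zero p = refl
inversionsBelow-cong {f} {g} (suc n) p = trans (inversionsBelow-suc f n)
  (trans (cong₂ ℕ._+_ (inversionsBelow-cong n p)
                      (trans (cong (countAbove f n) (p n)) (countAbove-cong n (g n) p)))
         (sym (inversionsBelow-suc g n)))

ℓ-cong : ∀ u v → u ≋ v → ℓ u ≡ ℓ v
ℓ-cong u v p =
  trans (sym (ℓ-stable u (bound u ⊔ bound v) (m≤m⊔n (bound u) (bound v))))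
  (trans (inversionsBelow-cong (bound u ⊔ bound v) p)
         (ℓ-stable v (bound u ⊔ bound v) (m≤n⊔m (bound u) (bound v))))

ℓ-ascent : ∀ u i → u ⟨$⟩ i < u ⟨$⟩ suc i → ℓ (u · s i) ≡ suc (ℓ u)
ℓ-ascent u i asc = trans
  (ℓ-descent (u · s i) i (subst₂ _<_ (cong (u ⟨$⟩_) (sym (swapʳ i (suc i))))
                                     (cong (u ⟨$⟩_) (sym (swapˡ i (suc i)))) asc))
  (cong suc (ℓ-cong (u · s i · s i) u (t-involutive u i (suc i))))

Between : S∞ → ℕ → ℕ → Set
Between u a b = ∃[ c ] a < c × c < b × u ⟨$⟩ a < u ⟨$⟩ c × u ⟨$⟩ c < u ⟨$⟩ b

-- The bound by two in `far` makes the length a test for covers: a gain of exactly one excludes a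
-- value in between. Both alternatives go through one induction, as most cases of the step merely
-- pass the alternative on.
data Rise (u : S∞) (a b : ℕ) : Set where
  cover : ¬ Between u a b → ℓ (u · t a b) ≡ suc (ℓ u) → Rise u a b
  far   : Between u a b → suc (suc (ℓ u)) ≤ ℓ (u · t a b) → Rise u a b

t-conj : ∀ u a b → suc a < b → u · s a · t (suc a) b · s a ≋ u · t a b
t-conj u a b 1+a<b i = cong (u ⟨$⟩_) (go i)
  where
  b≢a   = >⇒≢ (<-trans (n<1+n a) 1+a<b)
  b≢1+a = >⇒≢ 1+a<b
  go : ∀ i → swap a (suc a) (swap (suc a) b (swap a (suc a) i)) ≡ swap a b i
  go i with i ℕ.≟ a
  go i | yes refl = trans (cong (swap a (suc a)) (swapˡ (suc a) b)) (swap-other a (suc a) b≢a b≢1+a)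
  go i | no i≢a with i ℕ.≟ suc a
  go i | no i≢a | yes refl with suc a ℕ.≟ b
  ... | yes e = contradiction e (<⇒≢ 1+a<b)
  ... | no  _ = trans (cong (swap a (suc a)) (swap-other (suc a) b (<⇒≢ (n<1+n a)) (<⇒≢ (<-trans (n<1+n a) 1+a<b))))
                      (swapˡ a (suc a))
  go i | no i≢a | no i≢1+a with i ℕ.≟ b
  ... | yes refl = trans (cong (swap a (suc a)) (swapʳ (suc a) b)) (swapʳ a (suc a))
  ... | no  i≢b  = trans (cong (swap a (suc a)) (swap-other (suc a) b i≢1+a i≢b)) (swap-other a (suc a) i≢a i≢1+a)

private
  -- Induction on b - a through t_{ab} = s_a t_{a+1,b} s_a. If the value at a + 1 lies outside the
  -- interval from u a to u b, the two factors s_a change the length in opposite directions and a +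
  -- 1 is no witness, so the alternative is inherited. If it lies inside, both factors raise the
  -- length and a + 1 is a witness.
  rise′ : ∀ d u a b → a ℕ.+ suc d ≡ b → u ⟨$⟩ a < u ⟨$⟩ b → Rise u a b
  rise′ zero u a b refl ua<ub with a ℕ.+ 1 | ℕₚ.+-comm a 1
  ... | _ | refl = cover (λ (c , a<c , c<b , _) → <-irrefl refl (<-≤-trans a<c (ℕ.s≤s⁻¹ c<b))) (ℓ-ascent u a ua<ub)
  rise′ (suc d) u a b e ua<ub = go (≢⇒<⊎> v≢ua) (≢⇒<⊎> v≢ub)
    where
    1+a+1+d≡b : suc a ℕ.+ suc d ≡ b
    1+a+1+d≡b = trans (sym (+-suc a (suc d))) e
    1+a<b : suc a < b
    1+a<b = subst (suc a <_) 1+a+1+d≡b (m<m+n (suc a) (s≤s z≤n))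
    a<b = <-trans (n<1+n a) 1+a<b
    v = u ⟨$⟩ suc a
    v≢ua : v ≢ u ⟨$⟩ a
    v≢ua eq = 1+n≢n (⟨$⟩-injective u eq)
    v≢ub : v ≢ u ⟨$⟩ b
    v≢ub eq = <⇒≢ 1+a<b (⟨$⟩-injective u eq)
    u₁ = u · s a
    u₂ = u₁ · t (suc a) b
    u₁a : u₁ ⟨$⟩ a ≡ v
    u₁a = cong (u ⟨$⟩_) (swapˡ a (suc a))
    u₁1+a : u₁ ⟨$⟩ suc a ≡ u ⟨$⟩ a
    u₁1+a = cong (u ⟨$⟩_) (swapʳ a (suc a))
    u₁> : ∀ {c} → suc a < c → u₁ ⟨$⟩ c ≡ u ⟨$⟩ c
    u₁> 1+a<c = cong (u ⟨$⟩_) (swap-other a (suc a) (>⇒≢ (<-trans (n<1+n a) 1+a<c)) (>⇒≢ 1+a<c))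
    u₂a : u₂ ⟨$⟩ a ≡ v
    u₂a = trans (cong (u₁ ⟨$⟩_) (swap-other (suc a) b (<⇒≢ (n<1+n a)) (<⇒≢ a<b))) u₁a
    u₂1+a : u₂ ⟨$⟩ suc a ≡ u ⟨$⟩ b
    u₂1+a = trans (cong (u₁ ⟨$⟩_) (swapˡ (suc a) b)) (u₁> 1+a<b)
    IH : Rise u₁ (suc a) b
    IH = rise′ d u₁ (suc a) b 1+a+1+d≡b (subst₂ _<_ (sym u₁1+a) (sym (u₁> 1+a<b)) ua<ub)
    conj : ℓ (u₂ · s a) ≡ ℓ (u · t a b)
    conj = ℓ-cong (u₂ · s a) (u · t a b) (t-conj u a b 1+a<b)
    up : v < u ⟨$⟩ b → ℓ (u · t a b) ≡ suc (ℓ u₂)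
    up lt = trans (sym conj) (ℓ-ascent u₂ a (subst₂ _<_ (sym u₂a) (sym u₂1+a) lt))
    down : u ⟨$⟩ b < v → ℓ u₂ ≡ suc (ℓ (u · t a b))
    down gt = trans (ℓ-descent u₂ a (subst₂ _<_ (sym u₂1+a) (sym u₂a) gt)) (cong suc conj)
    push : Between u₁ (suc a) b → Between u a b
    push (c , 1+a<c , c<b , p , q) = c , <-trans (n<1+n a) 1+a<c , c<b
      , subst₂ _<_ u₁1+a (u₁> 1+a<c) p , subst₂ _<_ (u₁> 1+a<c) (u₁> 1+a<b) q
    pull : v < u ⟨$⟩ a ⊎ u ⟨$⟩ b < v → Between u a b → Between u₁ (suc a) b
    pull out (c , a<c , c<b , p , q) with m≤n⇒m<n∨m≡n a<c
    ... | inj₁ 1+a<c = c , 1+a<c , c<b , subst₂ _<_ (sym u₁1+a) (sym (u₁> 1+a<c)) p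
                         , subst₂ _<_ (sym (u₁> 1+a<c)) (sym (u₁> 1+a<b)) q
    ... | inj₂ refl with out
    ...   | inj₁ v<ua = contradiction p (<-asym v<ua)
    ...   | inj₂ ub<v = contradiction q (<-asym ub<v)
    go : v < u ⟨$⟩ a ⊎ u ⟨$⟩ a < v → v < u ⟨$⟩ b ⊎ u ⟨$⟩ b < v → Rise u a b
    go (inj₁ v<ua) _ with IH
    ... | cover nb eq = cover (λ x → nb (pull (inj₁ v<ua) x))
            (trans (up (<-trans v<ua ua<ub)) (cong suc (trans eq (sym (ℓ-descent u a v<ua)))))
    ... | far b lt = far (push b) (≤-trans (≤-trans (s≤s (s≤s (≤-reflexive (ℓ-descent u a v<ua)))) (s≤s lt))
                                            (≤-reflexive (sym (up (<-trans v<ua ua<ub)))))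
    go (inj₂ ua<v) (inj₁ v<ub) = far (suc a , n<1+n a , 1+a<b , ua<v , v<ub)
      (≤-trans (s≤s (≤-trans (≤-reflexive (sym (ℓ-ascent u a ua<v))) grow)) (≤-reflexive (sym (up v<ub))))
      where
      grow : ℓ u₁ ≤ ℓ u₂
      grow with IH
      ... | cover _ eq = ≤-trans (n≤1+n _) (≤-reflexive (sym eq))
      ... | far _ lt   = ≤-trans (m≤n+m _ 2) lt
    go (inj₂ ua<v) (inj₂ ub<v) with IH
    ... | cover nb eq = cover (λ x → nb (pull (inj₂ ub<v) x))
            (suc-injective (trans (sym (down ub<v)) (trans eq (cong suc (ℓ-ascent u a ua<v)))))
    ... | far b lt = far (push b) (ℕ.s≤s⁻¹ (≤-trans (s≤s (s≤s (≤-reflexive (sym (ℓ-ascent u a ua<v)))))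
                                              (≤-trans lt (≤-reflexive (down ub<v)))))

rise : ∀ u {a b} → a < b → u ⟨$⟩ a < u ⟨$⟩ b → Rise u a b
rise u {a} {b} a<b ua<ub = rise′ (b ℕ.∸ suc a) u a b
  (trans (+-suc a _) (m+[n∸m]≡n a<b)) ua<ub

ℓ-rise : ∀ u {a b} → a < b → u ⟨$⟩ a < u ⟨$⟩ b → ℓ u < ℓ (u · t a b)
ℓ-rise u a<b ua<ub with rise u a<b ua<ub
... | cover _ eq = ≤-reflexive (sym eq)
... | far _ lt   = ≤-trans (n≤1+n _) lt

record Cover (u : S∞) (a b : ℕ) : Set where
  field
    less    : u ⟨$⟩ a < u ⟨$⟩ b
    nothing : ¬ Between u a b

open Cover public

cover⇒ℓ : ∀ u {a b} → a < b → Cover u a b → ℓ (u · t a b) ≡ suc (ℓ u)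
cover⇒ℓ u a<b cov with rise u a<b (less cov)
... | cover _ eq = eq
... | far b _    = contradiction b (nothing cov)

ℓ⇒cover : ∀ u {a b} → a < b → ℓ (u · t a b) ≡ suc (ℓ u) → Cover u a b
ℓ⇒cover u {a} {b} a<b eq with <-cmp (u ⟨$⟩ a) (u ⟨$⟩ b)
... | tri≈ _ e _ = contradiction (⟨$⟩-injective u e) (<⇒≢ a<b)
... | tri> _ _ gt = contradiction
      (subst (ℓ (u · t a b) <_) (ℓ-cong (u · t a b · t a b) u (t-involutive u a b))
        (ℓ-rise (u · t a b) a<b (subst₂ _<_ (cong (u ⟨$⟩_) (sym (swapˡ a b))) (cong (u ⟨$⟩_) (sym (swapʳ a b))) gt)))
      (<-asym (≤-reflexive (sym eq)))
... | tri< lt _ _ with rise u a<b lt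
...   | cover nb _ = record { less = lt ; nothing = nb }
...   | far _ far′ = contradiction (≤-trans far′ (≤-reflexive eq)) 1+n≰n

s·-≋-·t : ∀ i u → s i · u ≋ u · t (u ⁻¹ ⟨$⟩ i) (u ⁻¹ ⟨$⟩ suc i)
s·-≋-·t i u j with j ℕ.≟ u ⁻¹ ⟨$⟩ i
... | yes refl = trans (cong (swap i (suc i)) (invʳ u i)) (trans (swapˡ i (suc i)) (sym (invʳ u (suc i))))
... | no j≢α with j ℕ.≟ u ⁻¹ ⟨$⟩ suc i
...   | yes refl = trans (cong (swap i (suc i)) (invʳ u (suc i))) (trans (swapʳ i (suc i)) (sym (invʳ u i)))
...   | no j≢β = swap-other i (suc i) (λ e → j≢α (sym (⁻¹-≡ u e))) (λ e → j≢β (sym (⁻¹-≡ u e)))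

-- No value lies strictly between i and i + 1, so exchanging these two values is a cover, at
-- whatever positions they stand.
ℓ-left-ascent : ∀ i u → u ⁻¹ ⟨$⟩ i < u ⁻¹ ⟨$⟩ suc i → ℓ (s i · u) ≡ suc (ℓ u)
ℓ-left-ascent i u α<β = trans (ℓ-cong (s i · u) (u · t (u ⁻¹ ⟨$⟩ i) (u ⁻¹ ⟨$⟩ suc i)) (s·-≋-·t i u)) (cover⇒ℓ u α<β (record
  { less    = subst₂ _<_ (sym (invʳ u i)) (sym (invʳ u (suc i))) (n<1+n i)
  ; nothing = λ (c , _ , _ , p , q) → <-irrefl refl
      (<-≤-trans (subst (_< u ⟨$⟩ c) (invʳ u i) p) (ℕ.s≤s⁻¹ (subst (u ⟨$⟩ c <_) (invʳ u (suc i)) q))) }))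

s·-⁻¹ : ∀ i u j → (s i · u) ⁻¹ ⟨$⟩ (swap i (suc i) j) ≡ u ⁻¹ ⟨$⟩ j
s·-⁻¹ i u j = ⁻¹-≡ (s i · u) (cong (swap i (suc i)) (invʳ u j))

s·-⁻¹-suc : ∀ i u → (s i · u) ⁻¹ ⟨$⟩ suc i ≡ u ⁻¹ ⟨$⟩ i
s·-⁻¹-suc i u = ⁻¹-≡ (s i · u) (trans (cong (swap i (suc i)) (invʳ u i)) (swapˡ i (suc i)))

s·-⁻¹-i : ∀ i u → (s i · u) ⁻¹ ⟨$⟩ i ≡ u ⁻¹ ⟨$⟩ suc i
s·-⁻¹-i i u = ⁻¹-≡ (s i · u) (trans (cong (swap i (suc i)) (invʳ u (suc i))) (swapʳ i (suc i)))

ℓ-left-descent : ∀ i u → u ⁻¹ ⟨$⟩ suc i < u ⁻¹ ⟨$⟩ i → ℓ u ≡ suc (ℓ (s i · u))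
ℓ-left-descent i u β<α = trans (sym (ℓ-cong (s i · (s i · u)) u (s-involutiveˡ i u)))
  (ℓ-left-ascent i (s i · u) (subst₂ _<_ (sym (s·-⁻¹-i i u)) (sym (s·-⁻¹-suc i u)) β<α))

-- Auxiliary facts on filters, maxima and finite sums

module _ {P Q : ℕ → Set} (P? : Decidable P) (Q? : Decidable Q) where

  filter-ext : ∀ xs → (∀ {a} → a ∈ xs → P a → Q a) → (∀ {a} → a ∈ xs → Q a → P a) →
               filter P? xs ≡ filter Q? xs
  filter-ext []       _ _ = refl
  filter-ext (x ∷ xs) f g with filter-ext xs (f ∘ there) (g ∘ there)
  ... | eq with P? x
  ...   | yes p = trans (cong (x ∷_) eq) (sym (filter-accept Q? (f (here refl) p)))
  ...   | no ¬p = trans eq (sym (filter-reject Q? (¬p ∘ g (here refl))))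

  -- Only up to a permutation, with α brought to the front: the lists will be counted or serve as
  -- arguments of symmetric functions.
  filter-insert : ∀ {α} xs → Unique xs → α ∈ xs → P α → ¬ Q α →
                  (∀ {a} → a ∈ xs → a ≢ α → P a → Q a) →
                  (∀ {a} → a ∈ xs → a ≢ α → Q a → P a) →
                  filter P? xs ↭ α ∷ filter Q? xs
  filter-insert {α} (x ∷ xs) (x∉ ∷ un) (here refl) pα ¬qα f g =
    ↭.↭-reflexive (trans (filter-accept P? pα) (cong (α ∷_)
      (trans (filter-ext xs (λ a∈ → f (there a∈) (≢α a∈)) (λ a∈ → g (there a∈) (≢α a∈)))
             (sym (filter-reject Q? ¬qα)))))
    where
    ≢α : ∀ {a} → a ∈ xs → a ≢ α
    ≢α a∈ refl = All.lookup x∉ a∈ refl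
  filter-insert {α} (x ∷ xs) (x∉ ∷ un) (there α∈) pα ¬qα f g
    with filter-insert xs un α∈ pα ¬qα (f ∘ there) (g ∘ there) | All.lookup x∉ α∈ | P? x | Q? x
  ... | p | x≢α | yes _  | yes _  = ↭-trans (prep x p) (↭.swap x α ↭-refl)
  ... | p | x≢α | yes px | no ¬qx = contradiction (f (here refl) x≢α px) ¬qx
  ... | p | x≢α | no ¬px | yes qx = contradiction (g (here refl) x≢α qx) ¬px
  ... | p | x≢α | no _   | no _   = p

argmax : ∀ {P : ℕ → Set} (f : ℕ → ℕ) → Decidable P → ∀ n → (∀ {a} → a < n → ¬ P a) ⊎
         ∃[ a ] a < n × P a × (∀ {a′} → a′ < n → P a′ → f a′ ≤ f a)
argmax f P? zero = inj₁ λ ()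
argmax {P} f P? (suc n) with argmax f P? n | P? n
... | inj₁ none | no ¬pn = inj₁ λ { (s≤s a≤n) → none′ (m≤n⇒m<n∨m≡n a≤n) }
  where
  none′ : ∀ {a} → a < n ⊎ a ≡ n → ¬ P a
  none′ (inj₁ a<n)  = none a<n
  none′ (inj₂ refl) = ¬pn
... | inj₁ none | yes pn = inj₂ (n , n<1+n n , pn , λ { (s≤s a≤n) → best (m≤n⇒m<n∨m≡n a≤n) })
  where
  best : ∀ {a} → a < n ⊎ a ≡ n → P a → f a ≤ f n
  best (inj₁ a<n)  pa = contradiction pa (none a<n)
  best (inj₂ refl) _  = ≤-refl
... | inj₂ (a , a<n , pa , max) | no ¬pn =
  inj₂ (a , m<n⇒m<1+n a<n , pa , λ { (s≤s a≤n) → best (m≤n⇒m<n∨m≡n a≤n) })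
  where
  best : ∀ {a′} → a′ < n ⊎ a′ ≡ n → P a′ → f a′ ≤ f a
  best (inj₁ a<n)  pa = max a<n pa
  best (inj₂ refl) pn = contradiction pn ¬pn
... | inj₂ (a , a<n , pa , max) | yes pn with ≤-total (f a) (f n)
...   | inj₁ fa≤fn = inj₂ (n , n<1+n n , pn , λ { (s≤s a≤n) → best (m≤n⇒m<n∨m≡n a≤n) })
  where
  best : ∀ {a′} → a′ < n ⊎ a′ ≡ n → P a′ → f a′ ≤ f n
  best (inj₁ a<n)  pa = ≤-trans (max a<n pa) fa≤fn
  best (inj₂ refl) pn = ≤-refl
...   | inj₂ fn≤fa = inj₂ (a , m<n⇒m<1+n a<n , pa , λ { (s≤s a≤n) → best (m≤n⇒m<n∨m≡n a≤n) })
  where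
  best : ∀ {a′} → a′ < n ⊎ a′ ≡ n → P a′ → f a′ ≤ f a
  best (inj₁ a<n)  pa = max a<n pa
  best (inj₂ refl) pn = fn≤fa

least : ∀ {P : ℕ → Set} → Decidable P → ∀ n → P n → ∃[ m ] m ≤ n × P m × (∀ {j} → j < m → ¬ P j)
least P? zero    p = zero , z≤n , p , λ ()
least P? (suc n) p with P? 0
... | yes p₀ = 0 , z≤n , p₀ , λ ()
... | no ¬p₀ with least (P? ∘ suc) n p
...   | m , m≤n , pm , min = suc m , s≤s m≤n , pm , λ { {zero} _ → ¬p₀ ; {suc j} (s≤s j<m) → min j<m }

sumBelow : (ℕ → ℕ) → ℕ → ℕ
sumBelow f zero    = 0
sumBelow f (suc n) = sumBelow f n ℕ.+ f n

sumBelow-mono : ∀ {f g} n → (∀ {a} → a < n → f a ≤ g a) → sumBelow f n ≤ sumBelow g n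
sumBelow-mono zero    _ = z≤n
sumBelow-mono (suc n) p = +-mono-≤ (sumBelow-mono n (p ∘ m<n⇒m<1+n)) (p (n<1+n n))

sumBelow-strict : ∀ {f g} n → (∀ {a} → a < n → f a ≤ g a) → ∀ {a} → a < n → f a < g a →
                  sumBelow f n < sumBelow g n
sumBelow-strict (suc n) p {a} (s≤s a≤n) fa<ga with m≤n⇒m<n∨m≡n a≤n
... | inj₁ a<n  = +-mono-<-≤ (sumBelow-strict n (p ∘ m<n⇒m<1+n) a<n fa<ga) (p (n<1+n n))
... | inj₂ refl = +-mono-≤-< (sumBelow-mono n (p ∘ m<n⇒m<1+n)) fa<ga

-- Positions rather than the values in P_k(u,w): multiplying both permutations by s_i on the left
-- changes values but not positions, so two lists will serve for four pairs of permutations.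
fixedPositions : ℕ → S∞ → S∞ → List ℕ
fixedPositions k u w = filter (λ a → u ⟨$⟩ a ℕ.≟ w ⟨$⟩ a) (upTo k)

#fixed : ℕ → S∞ → S∞ → ℕ
#fixed k u w = length (fixedPositions k u w)

fixedPositions-ext : ∀ k u w u′ w′ →
  (∀ {a} → a < k → u ⟨$⟩ a ≡ w ⟨$⟩ a → u′ ⟨$⟩ a ≡ w′ ⟨$⟩ a) →
  (∀ {a} → a < k → u′ ⟨$⟩ a ≡ w′ ⟨$⟩ a → u ⟨$⟩ a ≡ w ⟨$⟩ a) →
  fixedPositions k u w ≡ fixedPositions k u′ w′
fixedPositions-ext k u w u′ w′ f g = filter-ext _ _ (upTo k) (f ∘ ∈-upTo⁻) (g ∘ ∈-upTo⁻)

fixedPositions-insert : ∀ k u w u′ w′ {α} → α < k → u ⟨$⟩ α ≡ w ⟨$⟩ α → u′ ⟨$⟩ α ≢ w′ ⟨$⟩ α →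
  (∀ {a} → a < k → a ≢ α → u ⟨$⟩ a ≡ w ⟨$⟩ a → u′ ⟨$⟩ a ≡ w′ ⟨$⟩ a) →
  (∀ {a} → a < k → a ≢ α → u′ ⟨$⟩ a ≡ w′ ⟨$⟩ a → u ⟨$⟩ a ≡ w ⟨$⟩ a) →
  fixedPositions k u w ↭ α ∷ fixedPositions k u′ w′
fixedPositions-insert k u w u′ w′ α<k p q f g =
  filter-insert _ _ (upTo k) (upTo⁺ k) (∈-upTo⁺ α<k) p q (f ∘ ∈-upTo⁻) (g ∘ ∈-upTo⁻)

#fixed-≋ : ∀ k u w → u ≋ w → #fixed k u w ≡ k
#fixed-≋ k u w p = trans (cong length (filter-all _ (All.tabulate {xs = upTo k} λ {a} _ → p a))) (length-upTo k)

-- The k-Bruhat order, by the criterion of Bergeron and Sottile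

module _ (k : ℕ) where

  SameSide : ℕ → ℕ → Set
  SameSide a b = (a < k × b < k) ⊎ (k ≤ a × k ≤ b)

  record _≤ₖ_ (u w : S∞) : Set where
    field
      low   : ∀ {a} → a < k → u ⟨$⟩ a ≤ w ⟨$⟩ a
      high  : ∀ {b} → k ≤ b → w ⟨$⟩ b ≤ u ⟨$⟩ b
      order : ∀ {a b} → SameSide a b → a < b → u ⟨$⟩ a < u ⟨$⟩ b → w ⟨$⟩ a < w ⟨$⟩ b

  open _≤ₖ_ public

  ≋⇒≤ₖ : ∀ u w → u ≋ w → u ≤ₖ w
  ≋⇒≤ₖ u w p = record
    { low   = λ {a} _ → ≤-reflexive (p a)
    ; high  = λ {b} _ → ≤-reflexive (sym (p b))
    ; order = λ {a} {b} _ _ → subst₂ _<_ (p a) (p b) }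

  ≤ₖ-trans : ∀ {u v w} → u ≤ₖ v → v ≤ₖ w → u ≤ₖ w
  ≤ₖ-trans p q = record
    { low   = λ a<k → ≤-trans (low p a<k) (low q a<k)
    ; high  = λ k≤b → ≤-trans (high q k≤b) (high p k≤b)
    ; order = λ ss a<b → order q ss a<b ∘ order p ss a<b }

  low≢high : ∀ {a b} → a < k → k ≤ b → a ≢ b
  low≢high a<k k≤b refl = <⇒≱ a<k k≤b

  t-at-a : ∀ u a b → (u · t a b) ⟨$⟩ a ≡ u ⟨$⟩ b
  t-at-a u a b = cong (u ⟨$⟩_) (swapˡ a b)

  t-at-b : ∀ u a b → (u · t a b) ⟨$⟩ b ≡ u ⟨$⟩ a
  t-at-b u a b = cong (u ⟨$⟩_) (swapʳ a b)

  t-low : ∀ u {a b} → a < k → k ≤ b → ∀ {x} → x < k → x ≢ a → (u · t a b) ⟨$⟩ x ≡ u ⟨$⟩ x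
  t-low u {a} {b} a<k k≤b x<k x≢a = cong (u ⟨$⟩_) (swap-other a b x≢a (low≢high x<k k≤b))

  t-high : ∀ u {a b} → a < k → k ≤ b → ∀ {x} → k ≤ x → x ≢ b → (u · t a b) ⟨$⟩ x ≡ u ⟨$⟩ x
  t-high u {a} {b} a<k k≤b k≤x x≢b = cong (u ⟨$⟩_) (swap-other a b (low≢high a<k k≤x ∘ sym) x≢b)

  -- The absence of a value in between is what saves the order condition: a low y after a with u y >
  -- u a has u y > u b, and dually for the high positions before b.
  cover⇒≤ₖ : ∀ u {a b} → a < k → k ≤ b → Cover u a b → u ≤ₖ (u · t a b)
  cover⇒≤ₖ u {a} {b} a<k k≤b cov = record { low = low′ ; high = high′ ; order = order′ }
    where
    u₁ = u · t a b
    low′ : ∀ {x} → x < k → u ⟨$⟩ x ≤ u₁ ⟨$⟩ x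
    low′ {x} x<k = go (x ℕ.≟ a)
      where
      go : Dec (x ≡ a) → u ⟨$⟩ x ≤ u₁ ⟨$⟩ x
      go (yes refl) = ≤-trans (<⇒≤ (less cov)) (≤-reflexive (sym (t-at-a u a b)))
      go (no x≢a)   = ≤-reflexive (sym (t-low u a<k k≤b x<k x≢a))
    high′ : ∀ {x} → k ≤ x → u₁ ⟨$⟩ x ≤ u ⟨$⟩ x
    high′ {x} k≤x = go (x ℕ.≟ b)
      where
      go : Dec (x ≡ b) → u₁ ⟨$⟩ x ≤ u ⟨$⟩ x
      go (yes refl) = ≤-trans (≤-reflexive (t-at-b u a b)) (<⇒≤ (less cov))
      go (no x≢b)   = ≤-reflexive (t-high u a<k k≤b k≤x x≢b)
    order′ : ∀ {x y} → SameSide x y → x < y → u ⟨$⟩ x < u ⟨$⟩ y → u₁ ⟨$⟩ x < u₁ ⟨$⟩ y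
    order′ {x} {y} (inj₁ (x<k , y<k)) x<y lt = go (x ℕ.≟ a) (y ℕ.≟ a)
      where
      go : Dec (x ≡ a) → Dec (y ≡ a) → u₁ ⟨$⟩ x < u₁ ⟨$⟩ y
      go (yes refl) (yes refl) = contradiction x<y (<-irrefl refl)
      go (yes refl) (no y≢a) = subst₂ _<_ (sym (t-at-a u a b)) (sym (t-low u a<k k≤b y<k y≢a))
        (≤∧≢⇒< (≮⇒≥ λ uy<ub → nothing cov (y , x<y , <-≤-trans y<k k≤b , lt , uy<ub))
                  (λ e → low≢high y<k k≤b (sym (⟨$⟩-injective u e))))
      go (no x≢a) (yes refl) = subst₂ _<_ (sym (t-low u a<k k≤b x<k x≢a)) (sym (t-at-a u a b)) (<-trans lt (less cov))
      go (no x≢a) (no y≢a) = subst₂ _<_ (sym (t-low u a<k k≤b x<k x≢a)) (sym (t-low u a<k k≤b y<k y≢a)) lt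
    order′ {x} {y} (inj₂ (k≤x , k≤y)) x<y lt = go (x ℕ.≟ b) (y ℕ.≟ b)
      where
      go : Dec (x ≡ b) → Dec (y ≡ b) → u₁ ⟨$⟩ x < u₁ ⟨$⟩ y
      go (yes refl) (yes refl) = contradiction x<y (<-irrefl refl)
      go (yes refl) (no y≢b) = subst₂ _<_ (sym (t-at-b u a b)) (sym (t-high u a<k k≤b k≤y y≢b)) (<-trans (less cov) lt)
      go (no x≢b) (yes refl) = subst₂ _<_ (sym (t-high u a<k k≤b k≤x x≢b)) (sym (t-at-b u a b))
        (≤∧≢⇒< (≮⇒≥ λ ua<ux → nothing cov (x , <-≤-trans a<k k≤x , x<y , ua<ux , lt))
                  (λ e → low≢high a<k k≤x (sym (⟨$⟩-injective u e))))
      go (no x≢b) (no y≢b) = subst₂ _<_ (sym (t-high u a<k k≤b k≤x x≢b)) (sym (t-high u a<k k≤b k≤y y≢b)) lt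

  module _ {u w : S∞} (u≤w : u ≤ₖ w) where

    -- Induction on the value u b at a high b. If w b < u b, the position b′ at which u takes the
    -- value w b is high, as low positions are fixed; by induction it is fixed too, whence b′ = b.
    low-fixed⇒≋ : (∀ {a} → a < k → u ⟨$⟩ a ≡ w ⟨$⟩ a) → u ≋ w
    low-fixed⇒≋ fix b with <-≤-connex b k
    ... | inj₁ b<k = fix b<k
    ... | inj₂ k≤b = sym (go (suc (u ⟨$⟩ b)) k≤b ≤-refl)
      where
      go : ∀ n {b} → k ≤ b → u ⟨$⟩ b < n → w ⟨$⟩ b ≡ u ⟨$⟩ b
      go (suc n) {b} k≤b (s≤s ub≤n) with m≤n⇒m<n∨m≡n (high u≤w k≤b)
      ... | inj₂ e = e
      ... | inj₁ wb<ub with <-≤-connex (u ⁻¹ ⟨$⟩ (w ⟨$⟩ b)) k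
      ...   | inj₁ b′<k = contradiction (⟨$⟩-injective w (trans (sym (fix b′<k)) (invʳ u (w ⟨$⟩ b)))) (low≢high b′<k k≤b)
      ...   | inj₂ k≤b′ = trans (sym (invʳ u (w ⟨$⟩ b))) (cong (u ⟨$⟩_)
                (⟨$⟩-injective w (trans (go n k≤b′ (<-≤-trans (subst (_< u ⟨$⟩ b) (sym (invʳ u (w ⟨$⟩ b))) wb<ub) ub≤n)) (invʳ u (w ⟨$⟩ b)))))

    -- The position a moves next if u a is largest among the low positions not
    -- yet at their final value; it is exchanged with the high position b of
    -- smallest value u b subject to w b ≤ u a < u b ≤ w a.
    next-cover : u ≋ w ⊎ ∃[ a ] ∃[ b ] a < k × k ≤ b × Cover u a b × (u · t a b) ≤ₖ w
    next-cover with argmax (u ⟨$⟩_) (λ a → u ⟨$⟩ a ℕ.<? w ⟨$⟩ a) k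
    ... | inj₁ none = inj₁ (low-fixed⇒≋ λ a<k → ≤-antisym (low u≤w a<k) (≮⇒≥ (none a<k)))
    ... | inj₂ (a , a<k , ua<wa , max) =
      inj₂ (a , b , a<k , k≤b , record { less = ua<ub ; nothing = nothing′ } , record { low = low′ ; high = high′ ; order = order′ })
      where
      fixed-above : ∀ {c} → c < k → u ⟨$⟩ a < u ⟨$⟩ c → u ⟨$⟩ c ≡ w ⟨$⟩ c
      fixed-above c<k ua<uc = ≤-antisym (low u≤w c<k) (≮⇒≥ λ uc<wc → <⇒≱ ua<uc (max c<k uc<wc))
      Good : ℕ → Set
      Good v = k ≤ u ⁻¹ ⟨$⟩ v × u ⟨$⟩ a < v × v ≤ w ⟨$⟩ a × w ⟨$⟩ (u ⁻¹ ⟨$⟩ v) ≤ u ⟨$⟩ a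
      Good? : Decidable Good
      Good? v = k ℕ.≤? _ ×-dec (_ ℕ.<? v) ×-dec (v ℕ.≤? _) ×-dec (_ ℕ.≤? _)
      -- From v one passes to the value of w at the position where u has v. The values decrease
      -- strictly and stay at high positions, because a low position with value above u a is already
      -- final. The walk starts at w a and stops at the first value that w replaces by one not above
      -- u a.
      walk : ∀ n v → v < n → k ≤ u ⁻¹ ⟨$⟩ v → u ⟨$⟩ a < v → v ≤ w ⟨$⟩ a → w ⟨$⟩ (u ⁻¹ ⟨$⟩ v) < v → ∃[ v ] Good v
      walk (suc n) v (s≤s v≤n) k≤c ua<v v≤wa wc<v with ≤-<-connex (w ⟨$⟩ (u ⁻¹ ⟨$⟩ v)) (u ⟨$⟩ a)
      ... | inj₁ wc≤ua = v , k≤c , ua<v , v≤wa , wc≤ua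
      ... | inj₂ ua<wc with <-≤-connex (u ⁻¹ ⟨$⟩ (w ⟨$⟩ (u ⁻¹ ⟨$⟩ v))) k
      ...   | inj₁ c′<k = contradiction (⟨$⟩-injective w (trans (sym (fixed-above c′<k (subst (u ⟨$⟩ a <_) (sym (invʳ u _)) ua<wc))) (invʳ u _)))
                                        (low≢high c′<k k≤c)
      ...   | inj₂ k≤c′ = walk n (w ⟨$⟩ (u ⁻¹ ⟨$⟩ v)) (<-≤-trans wc<v v≤n) k≤c′ ua<wc (≤-trans (<⇒≤ wc<v) v≤wa)
                (≤∧≢⇒< (subst (w ⟨$⟩ _ ≤_) (invʳ u _) (high u≤w k≤c′))
                   (λ e → <-irrefl (trans (sym (invʳ u _)) (trans (cong (u ⟨$⟩_) (⟨$⟩-injective w e)) (invʳ u v))) wc<v))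
      b₁ = u ⁻¹ ⟨$⟩ (w ⟨$⟩ a)
      b₁≢a : b₁ ≢ a
      b₁≢a e = <⇒≢ ua<wa (≡-⁻¹ u e)
      k≤b₁ : k ≤ b₁
      k≤b₁ = ≮⇒≥ λ b₁<k → b₁≢a (⟨$⟩-injective w
        (trans (sym (fixed-above b₁<k (subst (u ⟨$⟩ a <_) (sym (invʳ u _)) ua<wa))) (invʳ u _)))
      good : ∃[ v ] Good v
      good = walk (suc (w ⟨$⟩ a)) (w ⟨$⟩ a) ≤-refl k≤b₁ ua<wa ≤-refl
        (≤∧≢⇒< (subst (w ⟨$⟩ b₁ ≤_) (invʳ u _) (high u≤w k≤b₁)) (λ e → b₁≢a (⟨$⟩-injective w e)))
      smallest = least Good? (proj₁ good) (proj₂ good)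
      v = proj₁ smallest
      b = u ⁻¹ ⟨$⟩ v
      ub≡v : u ⟨$⟩ b ≡ v
      ub≡v = invʳ u v
      k≤b : k ≤ b
      k≤b = proj₁ (proj₁ (proj₂ (proj₂ smallest)))
      ua<ub : u ⟨$⟩ a < u ⟨$⟩ b
      ua<ub = subst (u ⟨$⟩ a <_) (sym ub≡v) (proj₁ (proj₂ (proj₁ (proj₂ (proj₂ smallest)))))
      ub≤wa : u ⟨$⟩ b ≤ w ⟨$⟩ a
      ub≤wa = subst (_≤ w ⟨$⟩ a) (sym ub≡v) (proj₁ (proj₂ (proj₂ (proj₁ (proj₂ (proj₂ smallest))))))
      wb≤ua : w ⟨$⟩ b ≤ u ⟨$⟩ a
      wb≤ua = proj₂ (proj₂ (proj₂ (proj₁ (proj₂ (proj₂ smallest)))))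
      minimal′ : ∀ {c} → k ≤ c → u ⟨$⟩ a < u ⟨$⟩ c → u ⟨$⟩ c < u ⟨$⟩ b → u ⟨$⟩ a < w ⟨$⟩ c
      minimal′ {c} k≤c ua<uc uc<ub = ≰⇒> λ wc≤ua →
        proj₂ (proj₂ (proj₂ smallest)) (subst (u ⟨$⟩ c <_) ub≡v uc<ub)
          (subst (k ≤_) (sym (invˡ u c)) k≤c , ua<uc , ≤-trans (<⇒≤ uc<ub) ub≤wa
          , subst (λ x → w ⟨$⟩ x ≤ u ⟨$⟩ a) (sym (invˡ u c)) wc≤ua)
      -- A low c in between is already final, and `order` puts w a below its value, against u b ≤ w
      -- a. For a high c the choice of b gives u a < w c, while `order` gives w c < w b ≤ u a.
      nothing′ : ¬ Between u a b
      nothing′ (c , a<c , c<b , ua<uc , uc<ub) with <-≤-connex c k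
      ... | inj₁ c<k = <⇒≱ uc<ub (≤-trans ub≤wa (<⇒≤ (subst (w ⟨$⟩ a <_) (sym (fixed-above c<k ua<uc))
                         (order u≤w (inj₁ (a<k , c<k)) a<c ua<uc))))
      ... | inj₂ k≤c = <-asym (minimal′ k≤c ua<uc uc<ub)
                         (<-≤-trans (order u≤w (inj₂ (k≤c , k≤b)) c<b uc<ub) wb≤ua)
      u₁ = u · t a b
      low′ : ∀ {x} → x < k → u₁ ⟨$⟩ x ≤ w ⟨$⟩ x
      low′ {x} x<k = go (x ℕ.≟ a)
        where
        go : Dec (x ≡ a) → u₁ ⟨$⟩ x ≤ w ⟨$⟩ x
        go (yes refl) = subst (_≤ w ⟨$⟩ a) (sym (t-at-a u a b)) ub≤wa
        go (no x≢a)   = subst (_≤ w ⟨$⟩ x) (sym (t-low u a<k k≤b x<k x≢a)) (low u≤w x<k)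
      high′ : ∀ {x} → k ≤ x → w ⟨$⟩ x ≤ u₁ ⟨$⟩ x
      high′ {x} k≤x = go (x ℕ.≟ b)
        where
        go : Dec (x ≡ b) → w ⟨$⟩ x ≤ u₁ ⟨$⟩ x
        go (yes x≡b) = subst (λ x → w ⟨$⟩ x ≤ u₁ ⟨$⟩ x) (sym x≡b) (subst (w ⟨$⟩ b ≤_) (sym (t-at-b u a b)) wb≤ua)
        go (no x≢b)  = subst (w ⟨$⟩ x ≤_) (sym (t-high u a<k k≤b k≤x x≢b)) (high u≤w k≤x)
      order′ : ∀ {x y} → SameSide x y → x < y → u₁ ⟨$⟩ x < u₁ ⟨$⟩ y → w ⟨$⟩ x < w ⟨$⟩ y
      order′ {x} {y} (inj₁ (x<k , y<k)) x<y lt = go (x ℕ.≟ a) (y ℕ.≟ a)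
        where
        go : Dec (x ≡ a) → Dec (y ≡ a) → w ⟨$⟩ x < w ⟨$⟩ y
        go (yes refl) (yes refl) = contradiction x<y (<-irrefl refl)
        go (yes refl) (no y≢a) = order u≤w (inj₁ (x<k , y<k)) x<y
          (<-trans ua<ub (subst₂ _<_ (t-at-a u a b) (t-low u a<k k≤b y<k y≢a) lt))
        go (no x≢a) (no y≢a) = order u≤w (inj₁ (x<k , y<k)) x<y
          (subst₂ _<_ (t-low u a<k k≤b x<k x≢a) (t-low u a<k k≤b y<k y≢a) lt)
        go (no x≢a) (yes refl) with <-≤-connex (u ⟨$⟩ x) (u ⟨$⟩ a)
        ... | inj₁ ux<ua = order u≤w (inj₁ (x<k , y<k)) x<y ux<ua
        ... | inj₂ ua≤ux = <-≤-trans
          (subst (_< u ⟨$⟩ b) (fixed-above x<k (≤∧≢⇒< ua≤ux λ e → x≢a (sym (⟨$⟩-injective u e))))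
            (subst₂ _<_ (t-low u a<k k≤b x<k x≢a) (t-at-a u a b) lt)) ub≤wa
      order′ {x} {y} (inj₂ (k≤x , k≤y)) x<y lt = go (x ℕ.≟ b) (y ℕ.≟ b)
        where
        go : Dec (x ≡ b) → Dec (y ≡ b) → w ⟨$⟩ x < w ⟨$⟩ y
        go (yes x≡b) (yes y≡b) = contradiction (subst (x <_) (trans y≡b (sym x≡b)) x<y) (<-irrefl refl)
        go (no x≢b) (yes y≡b) = order u≤w (inj₂ (k≤x , k≤y)) x<y
          (<-trans (subst₂ _<_ (t-high u a<k k≤b k≤x x≢b) (trans (cong (u₁ ⟨$⟩_) y≡b) (t-at-b u a b)) lt)
                      (subst (λ y → u ⟨$⟩ a < u ⟨$⟩ y) (sym y≡b) ua<ub))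
        go (no x≢b) (no y≢b) = order u≤w (inj₂ (k≤x , k≤y)) x<y
          (subst₂ _<_ (t-high u a<k k≤b k≤x x≢b) (t-high u a<k k≤b k≤y y≢b) lt)
        go (yes x≡b) (no y≢b) with <-≤-connex (u ⟨$⟩ b) (u ⟨$⟩ y)
        ... | inj₁ ub<uy = order u≤w (inj₂ (k≤x , k≤y)) x<y (subst (λ x → u ⟨$⟩ x < u ⟨$⟩ y) (sym x≡b) ub<uy)
        ... | inj₂ uy≤ub = subst (λ x → w ⟨$⟩ x < w ⟨$⟩ y) (sym x≡b) (≤-<-trans wb≤ua (minimal′ k≤y
                (subst₂ _<_ (trans (cong (u₁ ⟨$⟩_) x≡b) (t-at-b u a b)) (t-high u a<k k≤b k≤y y≢b) lt)
                (≤∧≢⇒< uy≤ub λ e → y≢b (⟨$⟩-injective u e))))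

  data Chain (w : S∞) : S∞ → List (ℕ × ℕ) → Set where
    done : ∀ {u} → u ≋ w → Chain w u []
    step : ∀ {u a b ts} → a < k → k ≤ b → Cover u a b → Chain w (u · t a b) ts → Chain w u ((a , b) ∷ ts)

  -- The sum of the values at the low positions grows with every cover and never exceeds that of w;
  -- n bounds the number of steps left.
  ≤ₖ⇒chain : ∀ {u w} → u ≤ₖ w → ∃[ ts ] Chain w u ts
  ≤ₖ⇒chain {u} {w} u≤w = go (sumBelow (w ⟨$⟩_) k) u u≤w (m≤m+n _ _)
    where
    go : ∀ n u → u ≤ₖ w → sumBelow (w ⟨$⟩_) k ≤ n ℕ.+ sumBelow (u ⟨$⟩_) k → ∃[ ts ] Chain w u ts
    go n u u≤w bnd with next-cover u≤w
    ... | inj₁ u≋w = [] , done u≋w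
    ... | inj₂ (a , b , a<k , k≤b , cov , u₁≤w) = rec n bnd
      where
      u₁ = u · t a b
      grow : sumBelow (u ⟨$⟩_) k < sumBelow (u₁ ⟨$⟩_) k
      grow = sumBelow-strict k (low (cover⇒≤ₖ u a<k k≤b cov)) a<k (subst (u ⟨$⟩ a <_) (sym (t-at-a u a b)) (less cov))
      rec : ∀ n → sumBelow (w ⟨$⟩_) k ≤ n ℕ.+ sumBelow (u ⟨$⟩_) k → ∃[ ts ] Chain w u ts
      rec zero bnd = contradiction (<-≤-trans grow (sumBelow-mono k (low u₁≤w))) (≤⇒≯ bnd)
      rec (suc n) bnd with go n u₁ u₁≤w (≤-trans bnd (≤-trans (≤-reflexive (sym (+-suc n _))) (+-monoʳ-≤ n grow)))
      ... | ts , ch = (a , b) ∷ ts , step a<k k≤b cov ch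

  chain⇒≤ₖ : ∀ {u w ts} → Chain w u ts → u ≤ₖ w
  chain⇒≤ₖ {u} {w} (done u≋w) = ≋⇒≤ₖ u w u≋w
  chain⇒≤ₖ {u} (step a<k k≤b cov ch) = ≤ₖ-trans (cover⇒≤ₖ u a<k k≤b cov) (chain⇒≤ₖ ch)

  module _ (u w : S∞) {a b : ℕ} (a<k : a < k) (k≤b : k ≤ b) (cov : Cover u a b) (u₁≤w : (u · t a b) ≤ₖ w) where

    private u₁ = u · t a b

    cover-moves : u ⟨$⟩ a ≢ w ⟨$⟩ a
    cover-moves = <⇒≢ (<-≤-trans (less cov) (≤-trans (≤-reflexive (sym (t-at-a u a b))) (low u₁≤w a<k)))

    #fixed-hit : u₁ ⟨$⟩ a ≡ w ⟨$⟩ a → #fixed k u₁ w ≡ suc (#fixed k u w)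
    #fixed-hit e = ↭-length (fixedPositions-insert k u₁ w u w a<k e cover-moves
      (λ x<k x≢a e → trans (sym (t-low u a<k k≤b x<k x≢a)) e)
      (λ x<k x≢a e → trans (t-low u a<k k≤b x<k x≢a) e))

    #fixed-miss : u₁ ⟨$⟩ a ≢ w ⟨$⟩ a → #fixed k u₁ w ≡ #fixed k u w
    #fixed-miss ne = cong length (fixedPositions-ext k u₁ w u w
      (λ {x} x<k e → trans (sym (t-low u a<k k≤b x<k (λ { refl → ne e }))) e)
      (λ {x} x<k e → trans (t-low u a<k k≤b x<k (λ { refl → cover-moves e })) e))

  -- Every step gains one unit of length and moves a single low position, so the number of low
  -- positions that differ between u and w is at most the length gained.
  chain-ℓ : ∀ {u w ts} → Chain w u ts → ℓ u ℕ.+ k ≤ ℓ w ℕ.+ #fixed k u w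
  chain-ℓ {u} {w} (done u≋w) = ≤-reflexive (cong₂ ℕ._+_ (ℓ-cong u w u≋w) (sym (#fixed-≋ k u w u≋w)))
  chain-ℓ {u} {w} (step {a = a} {b} a<k k≤b cov ch)
    with chain-ℓ ch | (u · t a b) ⟨$⟩ a ℕ.≟ w ⟨$⟩ a | cover⇒ℓ u (<-≤-trans a<k k≤b) cov
  ... | le | yes e | eq = ℕ.s≤s⁻¹ (subst₂ _≤_ (cong (ℕ._+ k) eq)
        (trans (cong (ℓ w ℕ.+_) (#fixed-hit u w a<k k≤b cov (chain⇒≤ₖ ch) e)) (+-suc (ℓ w) _)) le)
  ... | le | no ne | eq = ≤-trans (n≤1+n _) (subst₂ _≤_ (cong (ℕ._+ k) eq)
        (cong (ℓ w ℕ.+_) (#fixed-miss u w a<k k≤b cov (chain⇒≤ₖ ch) ne)) le)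

  ≤ₖ-ℓ : ∀ {u w} → u ≤ₖ w → ℓ u ℕ.+ k ≤ ℓ w ℕ.+ #fixed k u w
  ≤ₖ-ℓ u≤w = chain-ℓ (proj₂ (≤ₖ⇒chain u≤w))

  -- By ≤ₖ-ℓ each low position is moved at most once in a chain from u to w
  -- exactly when equality holds.
  record _⇢_ (u w : S∞) : Set where
    constructor _,_
    field
      below : u ≤ₖ w
      tight : ℓ w ℕ.+ #fixed k u w ≡ ℓ u ℕ.+ k

  open _⇢_ public

  -- Under equality each step must bring its a to the final value, for otherwise the rest of the
  -- chain would violate `≤ₖ-ℓ`. Positions used later still differ from their final values and hence
  -- are not a; the second component carries this through the induction.
  chain-distinct : ∀ {u w ts} → Chain w u ts → u ⇢ w →
    Unique (map proj₁ ts) × All (λ a → u ⟨$⟩ a ≢ w ⟨$⟩ a) (map proj₁ ts)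
  chain-distinct (done _) _ = [] , []
  chain-distinct {u} {w} (step {a = a} {b} {ts} a<k k≤b cov ch) (_ , tt) with (u · t a b) ⟨$⟩ a ℕ.≟ w ⟨$⟩ a
  ... | no ne = contradiction (≤ₖ-ℓ (chain⇒≤ₖ ch)) (<⇒≱ (≤-reflexive
        (trans (cong suc (trans (cong (ℓ w ℕ.+_) (#fixed-miss u w a<k k≤b cov (chain⇒≤ₖ ch) ne)) tt))
               (sym (cong (ℕ._+ k) (cover⇒ℓ u (<-≤-trans a<k k≤b) cov))))))
  ... | yes e with chain-distinct ch (chain⇒≤ₖ ch ,
        trans (cong (ℓ w ℕ.+_) (#fixed-hit u w a<k k≤b cov (chain⇒≤ₖ ch) e))
          (trans (+-suc (ℓ w) _) (trans (cong suc tt) (sym (cong (ℕ._+ k) (cover⇒ℓ u (<-≤-trans a<k k≤b) cov))))))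
  ...   | un , mv = All.map (λ ne a≡ → ne (subst (λ x → (u · t a b) ⟨$⟩ x ≡ w ⟨$⟩ x) a≡ e)) mv ∷ un
                  , cover-moves u w a<k k≤b cov (chain⇒≤ₖ ch) ∷ moved ch mv
    where
    moved : ∀ {v ts} → Chain w v ts → All (λ x → (u · t a b) ⟨$⟩ x ≢ w ⟨$⟩ x) (map proj₁ ts) → All (λ x → u ⟨$⟩ x ≢ w ⟨$⟩ x) (map proj₁ ts)
    moved (done _) [] = []
    moved (step x<k _ _ ch) (ne ∷ mv) = (λ e′ → ne (trans (t-low u a<k k≤b x<k (λ { refl → ne e })) e′)) ∷ moved ch mv

  chain-fixed : ∀ {u w ts} → Chain w u ts → ∀ {x} → x < k → x ∉ map proj₁ ts → u ⟨$⟩ x ≡ w ⟨$⟩ x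
  chain-fixed (done u≋w) {x} _ _ = u≋w x
  chain-fixed {u} (step a<k k≤b _ ch) x<k x∉ =
    trans (sym (t-low u a<k k≤b x<k (x∉ ∘ here))) (chain-fixed ch x<k (x∉ ∘ there))

  -- A position that does not occur again has its final value after the first step, so every step
  -- raises the length and the number of fixed positions by one each.
  distinct⇒⇢ : ∀ {u w ts} → Chain w u ts → Unique (map proj₁ ts) → u ⇢ w
  distinct⇒⇢ {u} {w} (done u≋w) _ =
    ≋⇒≤ₖ u w u≋w , cong₂ ℕ._+_ (sym (ℓ-cong u w u≋w)) (#fixed-≋ k u w u≋w)
  distinct⇒⇢ {u} {w} ch₀@(step {a = a} {b} {ts} a<k k≤b cov ch) (a∉ ∷ un) =
    chain⇒≤ₖ ch₀ , suc-injective (trans (sym (+-suc (ℓ w) _)) (trans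
      (sym (cong (ℓ w ℕ.+_) (#fixed-hit u w a<k k≤b cov (chain⇒≤ₖ ch) (chain-fixed ch a<k λ a∈ → All.lookup a∉ a∈ refl))))
      (trans (tight (distinct⇒⇢ ch un)) (cong (ℕ._+ k) (cover⇒ℓ u (<-≤-trans a<k k≤b) cov)))))

  ⟶⇒chain : ∀ {u w} (p : u ⟶[ k ] w) → Chain w u (_⟶[_]_.transpositions p)
  ⟶⇒chain {u} {w} p = go (transpositions) u a≤k<b lengths end
    where
    open _⟶[_]_ p
    go : ∀ ts u → All (λ (a , b) → a < k × k ≤ b) ts →
      (∀ i → 1 ≤ i → i ≤ length ts → ℓ (u · ∏ₛ (map (λ (a , b) → t a b) (take i ts))) ≡ ℓ u ℕ.+ i) →
      w ≋ u · ∏ₛ (map (λ (a , b) → t a b) (take (length ts) ts)) → Chain w u ts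
    go [] u _ _ end = done (λ i → sym (end i))
    go ((a , b) ∷ ts) u ((a<k , k≤b) ∷ abs) len end = step a<k k≤b cov (go ts (u · t a b) abs len′ end)
      where
      eq : ℓ (u · t a b) ≡ suc (ℓ u)
      eq = trans (ℓ-cong (u · t a b) (u · (t a b · ι)) λ _ → refl) (trans (len 1 (s≤s z≤n) (s≤s z≤n)) (ℕₚ.+-comm (ℓ u) 1))
      cov = ℓ⇒cover u (<-≤-trans a<k k≤b) eq
      len′ : ∀ i → 1 ≤ i → i ≤ length ts → ℓ (u · t a b · ∏ₛ (map (λ (a , b) → t a b) (take i ts))) ≡ ℓ (u · t a b) ℕ.+ i
      len′ i 1≤i i≤ = trans (ℓ-cong (u · t a b · ∏ₛ (map (λ (a , b) → t a b) (take i ts))) (u · (t a b · ∏ₛ (map (λ (a , b) → t a b) (take i ts)))) λ _ → refl)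
        (trans (len (suc i) (s≤s z≤n) (s≤s i≤)) (trans (+-suc (ℓ u) i) (sym (cong (ℕ._+ i) eq))))

  ⟶⇒⇢ : ∀ {u w} → u ⟶[ k ] w → u ⇢ w
  ⟶⇒⇢ p = distinct⇒⇢ (⟶⇒chain p) (_⟶[_]_.distinct p)

  ⇢⇒⟶ : ∀ {u w} → u ⇢ w → u ⟶[ k ] w
  ⇢⇒⟶ {u} {w} p with ≤ₖ⇒chain (below p)
  ... | ts , ch = record
    { transpositions = ts
    -- The chain has ℓ w - ℓ u steps, which `tight` bounds by k.
    ; r≤k      = +-cancelˡ-≤ (ℓ u) _ _ (≤-trans (≤-reflexive (sym (chain-length ch)))
                   (≤-trans (m≤m+n (ℓ w) _) (≤-reflexive (tight p))))
    ; a≤k<b    = sides ch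
    ; distinct = proj₁ (chain-distinct ch p)
    ; lengths  = λ i _ → lens ch i
    ; end      = ends ch
    }
    where
    sides : ∀ {u ts} → Chain w u ts → All (λ (a , b) → a < k × k ≤ b) ts
    sides (done _) = []
    sides (step a<k k≤b _ ch) = (a<k , k≤b) ∷ sides ch
    ends : ∀ {u ts} → Chain w u ts → w ≋ u · ∏ₛ (map (λ (a , b) → t a b) (take (length ts) ts))
    ends (done p) i = sym (p i)
    ends (step _ _ _ ch) i = ends ch i
    lens : ∀ {u ts} → Chain w u ts → ∀ i → i ≤ length ts → ℓ (u · ∏ₛ (map (λ (a , b) → t a b) (take i ts))) ≡ ℓ u ℕ.+ i
    lens {u} _ zero _ = trans (ℓ-cong (u · ι) u λ _ → refl) (sym (+-identityʳ _))
    lens {u} (step {a = a} {b} {ts} a<k k≤b cov ch) (suc i) (s≤s i≤) = trans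
      (ℓ-cong (u · (t a b · ∏ₛ (map (λ (a , b) → t a b) (take i ts)))) (u · t a b · ∏ₛ (map (λ (a , b) → t a b) (take i ts))) λ _ → refl)
      (trans (lens ch i i≤) (trans (cong (ℕ._+ i) (cover⇒ℓ u (<-≤-trans a<k k≤b) cov)) (sym (+-suc (ℓ u) i))))
    chain-length : ∀ {u ts} → Chain w u ts → ℓ w ≡ ℓ u ℕ.+ length ts
    chain-length {u} (done p) = trans (sym (ℓ-cong u w p)) (sym (+-identityʳ _))
    chain-length {u} (step {ts = ts} a<k k≤b cov ch) = trans (chain-length ch)
      (trans (cong (ℕ._+ length ts) (cover⇒ℓ u (<-≤-trans a<k k≤b) cov)) (sym (+-suc (ℓ u) _)))

-- The exchange of the values i and i + 1

module Exchange (i : ℕ) where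

  sw : ℕ → ℕ
  sw = swap i (suc i)

  sw-i : ∀ {v} → v ≡ i → sw v ≡ suc i
  sw-i refl = swapˡ i (suc i)

  sw-1+i : ∀ {v} → v ≡ suc i → sw v ≡ i
  sw-1+i refl = swapʳ i (suc i)

  sw≡i : ∀ {v} → sw v ≡ i → v ≡ suc i
  sw≡i {v} e = trans (sym (swap-involutive i (suc i) v)) (sw-i e)

  sw≡1+i : ∀ {v} → sw v ≡ suc i → v ≡ i
  sw≡1+i {v} e = trans (sym (swap-involutive i (suc i) v)) (sw-1+i e)

  sw-other : ∀ {v} → v ≢ i → v ≢ suc i → sw v ≡ v
  sw-other = swap-other i (suc i)

  -- The exchange lowers v only from i + 1 to i, which harms the inequality only when p = i + 1. The
  -- two facts below likewise assume away their one bad configuration, and these assumptions become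
  -- the side conditions of all later comparisons.
  ≤-sw : ∀ {p v} → p ≤ v → (v ≡ suc i → p ≢ suc i) → p ≤ sw v
  ≤-sw {p} {v} p≤v bad = go (v ℕ.≟ i) (v ℕ.≟ suc i)
    where
    go : Dec (v ≡ i) → Dec (v ≡ suc i) → p ≤ sw v
    go (yes v≡i) _         = subst (p ≤_) (sym (sw-i v≡i)) (m≤n⇒m≤1+n (subst (p ≤_) v≡i p≤v))
    go (no _)    (yes e)   = subst (p ≤_) (sym (sw-1+i e)) (ℕ.s≤s⁻¹ (≤∧≢⇒< (subst (p ≤_) e p≤v) (bad e)))
    go (no v≢i)  (no v≢1+i) = subst (p ≤_) (sym (sw-other v≢i v≢1+i)) p≤v

  sw-≤ : ∀ {p v} → v ≤ p → (v ≡ i → p ≢ i) → sw v ≤ p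
  sw-≤ {p} {v} v≤p bad = go (v ℕ.≟ i) (v ℕ.≟ suc i)
    where
    go : Dec (v ≡ i) → Dec (v ≡ suc i) → sw v ≤ p
    go (yes e)  _          = subst (_≤ p) (sym (sw-i e)) (≤∧≢⇒< (subst (_≤ p) e v≤p) (bad e ∘ sym))
    go (no _)   (yes e)    = subst (_≤ p) (sym (sw-1+i e)) (≤-trans (n≤1+n i) (subst (_≤ p) e v≤p))
    go (no v≢i) (no v≢1+i) = subst (_≤ p) (sym (sw-other v≢i v≢1+i)) v≤p

  sw-mono-< : ∀ {p q} → p < q → (p ≡ i → q ≢ suc i) → sw p < sw q
  sw-mono-< {p} {q} p<q bad = ≤∧≢⇒< (≤-sw (sw-≤ (<⇒≤ p<q) (λ { refl refl → <-irrefl refl p<q })) bad′)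
    (λ e → <⇒≢ p<q (trans (sym (swap-involutive i (suc i) p)) (trans (cong sw e) (swap-involutive i (suc i) q))))
    where
    bad′ : q ≡ suc i → sw p ≢ suc i
    bad′ q≡ e = bad (sw≡1+i e) q≡

  <i : ∀ {v} → v ≤ suc i → v ≢ i → v ≢ suc i → v < i
  <i v≤ v≢i v≢1+i = ≤∧≢⇒< (ℕ.s≤s⁻¹ (≤∧≢⇒< v≤ v≢1+i)) v≢i

  >1+i : ∀ {v} → i ≤ v → v ≢ i → v ≢ suc i → suc i < v
  >1+i i≤ v≢i v≢1+i = ≤∧≢⇒< (≤∧≢⇒< i≤ (v≢i ∘ sym)) (v≢1+i ∘ sym)

  i≢1+i : i ≢ suc i
  i≢1+i = 1+n≢n ∘ sym

-- The relation between f and g before and after multiplication by s_i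

module _ (k i : ℕ) where

  open Exchange i

  -- i occurs before i + 1, so that s i · g covers g in the left weak order.
  Ascending : S∞ → Set
  Ascending g = ∀ {x y} → g ⟨$⟩ x ≡ i → g ⟨$⟩ y ≡ suc i → x < y

  module _ {v g : S∞} (asc : Ascending g) where

    -- The side conditions of this and the next three facts exclude the values at which the exchange
    -- breaks an inequality. In `≤ₖ-lowerʳ` and `≤ₖ-raiseˡ` the order condition survives because g
    -- is ascending; the other two have to assume it.
    ≤ₖ-raiseʳ : _≤ₖ_ k v g →
      (∀ {x} → k ≤ x → g ⟨$⟩ x ≡ i → v ⟨$⟩ x ≢ i) →
      (∀ {x} → x < k → g ⟨$⟩ x ≡ suc i → v ⟨$⟩ x ≢ suc i) →
      (∀ {x y} → SameSide k x y → g ⟨$⟩ x ≡ i → g ⟨$⟩ y ≡ suc i → ¬ v ⟨$⟩ x < v ⟨$⟩ y) →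
      _≤ₖ_ k v (s i · g)
    ≤ₖ-raiseʳ p h l o = record
      { low   = λ x<k → ≤-sw (low p x<k) (l x<k)
      ; high  = λ k≤x → sw-≤ (high p k≤x) (h k≤x)
      ; order = λ ss x<y lt → sw-mono-< (order p ss x<y lt) λ e e′ → o ss e e′ lt }

    ≤ₖ-lowerʳ : _≤ₖ_ k v (s i · g) →
      (∀ {x} → x < k → g ⟨$⟩ x ≡ i → v ⟨$⟩ x ≢ suc i) →
      (∀ {x} → k ≤ x → g ⟨$⟩ x ≡ suc i → v ⟨$⟩ x ≢ i) →
      _≤ₖ_ k v g
    ≤ₖ-lowerʳ p l h = record
      { low   = λ {x} x<k → subst (v ⟨$⟩ x ≤_) (swap-involutive i (suc i) _) (≤-sw (low p x<k) (l x<k ∘ sw≡1+i))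
      ; high  = λ {x} k≤x → subst (_≤ v ⟨$⟩ x) (swap-involutive i (suc i) _) (sw-≤ (high p k≤x) (h k≤x ∘ sw≡i))
      ; order = λ ss x<y lt → subst₂ _<_ (swap-involutive i (suc i) _) (swap-involutive i (suc i) _)
          (sw-mono-< (order p ss x<y lt) λ e e′ → <-asym x<y (asc (sw≡1+i e′) (sw≡i e))) }

    ≤ₖ-raiseˡ : _≤ₖ_ k g v →
      (∀ {x} → x < k → g ⟨$⟩ x ≡ i → v ⟨$⟩ x ≢ i) →
      (∀ {x} → k ≤ x → g ⟨$⟩ x ≡ suc i → v ⟨$⟩ x ≢ suc i) →
      _≤ₖ_ k (s i · g) v
    ≤ₖ-raiseˡ p l h = record
      { low   = λ x<k → sw-≤ (low p x<k) (l x<k)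
      ; high  = λ k≤x → ≤-sw (high p k≤x) (h k≤x)
      ; order = λ ss x<y lt → order p ss x<y (subst₂ _<_ (swap-involutive i (suc i) _) (swap-involutive i (suc i) _)
          (sw-mono-< lt λ e e′ → <-asym x<y (asc (sw≡1+i e′) (sw≡i e)))) }

    ≤ₖ-lowerˡ : _≤ₖ_ k (s i · g) v →
      (∀ {x} → k ≤ x → g ⟨$⟩ x ≡ i → v ⟨$⟩ x ≢ suc i) →
      (∀ {x} → x < k → g ⟨$⟩ x ≡ suc i → v ⟨$⟩ x ≢ i) →
      (∀ {x y} → SameSide k x y → g ⟨$⟩ x ≡ i → g ⟨$⟩ y ≡ suc i → v ⟨$⟩ x < v ⟨$⟩ y) →
      _≤ₖ_ k g v
    ≤ₖ-lowerˡ p h l o = record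
      { low   = λ {x} x<k → subst (_≤ v ⟨$⟩ x) (swap-involutive i (suc i) _) (sw-≤ (low p x<k) (l x<k ∘ sw≡i))
      ; high  = λ {x} k≤x → subst (v ⟨$⟩ x ≤_) (swap-involutive i (suc i) _) (≤-sw (high p k≤x) (h k≤x ∘ sw≡1+i))
      ; order = order′ }
      where
      order′ : ∀ {x y} → SameSide k x y → x < y → g ⟨$⟩ x < g ⟨$⟩ y → v ⟨$⟩ x < v ⟨$⟩ y
      order′ {x} {y} ss x<y lt with g ⟨$⟩ x ℕ.≟ i | g ⟨$⟩ y ℕ.≟ suc i
      ... | yes e | yes e′ = o ss e e′
      ... | no ne | _      = order p ss x<y (sw-mono-< lt λ e _ → ne e)
      ... | yes _ | no ne  = order p ss x<y (sw-mono-< lt λ _ → ne)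

  module _ (f g : S∞) (α β : ℕ) (fα : f ⟨$⟩ α ≡ i) (fβ : f ⟨$⟩ β ≡ suc i)
           (ascf : Ascending f) (ascg : Ascending g)
           (ℓf₊ : ℓ (s i · f) ≡ suc (ℓ f)) (ℓg₊ : ℓ (s i · g) ≡ suc (ℓ g)) where

    private
      f₊ = s i · f
      g₊ = s i · g
      infix 4 _⊑_ _→ₖ_
      _⊑_ = _≤ₖ_ k
      _→ₖ_ = _⇢_ k
      α<β : α < β
      α<β = ascf fα fβ

    =α : ∀ {x} → f ⟨$⟩ x ≡ i → x ≡ α
    =α e = ⟨$⟩-injective f (trans e (sym fα))

    =β : ∀ {x} → f ⟨$⟩ x ≡ suc i → x ≡ β
    =β e = ⟨$⟩-injective f (trans e (sym fβ))

    f₊α : f₊ ⟨$⟩ α ≡ suc i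
    f₊α = sw-i fα

    f₊β : f₊ ⟨$⟩ β ≡ i
    f₊β = sw-1+i fβ

    m₁ m₂ : ℕ
    m₁ = #fixed k f g
    m₂ = #fixed k f₊ g

    fixed-both : fixedPositions k f₊ g₊ ≡ fixedPositions k f g
    fixed-both = fixedPositions-ext k f₊ g₊ f g
      (λ _ e → trans (sym (swap-involutive i (suc i) _)) (trans (cong sw e) (swap-involutive i (suc i) _)))
      (λ _ → cong sw)

    fixed-one : fixedPositions k f g₊ ≡ fixedPositions k f₊ g
    fixed-one = fixedPositions-ext k f g₊ f₊ g
      (λ _ e → trans (cong sw e) (swap-involutive i (suc i) _))
      (λ _ e → trans (sym (swap-involutive i (suc i) _)) (cong sw e))

    -- In the names below, a, b, c, e stand for the relations from f₊ to g, from f₊ to g₊, from f to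
    -- g and from f to g₊. Once the units of length are cancelled, b and c ask for the same equation
    -- in m₁, whereas a and e ask for equations in m₂ that differ by two.
    tight-b : f₊ →ₖ g₊ → ℓ g ℕ.+ m₁ ≡ ℓ f ℕ.+ k
    tight-b p = suc-injective (trans (sym (cong₂ ℕ._+_ ℓg₊ (cong length fixed-both)))
                                        (trans (tight p) (cong (ℕ._+ k) ℓf₊)))

    to-b : f₊ ⊑ g₊ → ℓ g ℕ.+ m₁ ≡ ℓ f ℕ.+ k → f₊ →ₖ g₊
    to-b le e = le , trans (cong₂ ℕ._+_ ℓg₊ (cong length fixed-both)) (trans (cong suc e) (cong (ℕ._+ k) (sym ℓf₊)))

    tight-a : f₊ →ₖ g → ℓ g ℕ.+ m₂ ≡ suc (ℓ f ℕ.+ k)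
    tight-a p = trans (tight p) (cong (ℕ._+ k) ℓf₊)

    to-a : f₊ ⊑ g → ℓ g ℕ.+ m₂ ≡ suc (ℓ f ℕ.+ k) → f₊ →ₖ g
    to-a le e = le , trans e (cong (ℕ._+ k) (sym ℓf₊))

    tight-e : f →ₖ g₊ → suc (ℓ g ℕ.+ m₂) ≡ ℓ f ℕ.+ k
    tight-e p = trans (sym (cong₂ ℕ._+_ ℓg₊ (cong length fixed-one))) (tight p)

    to-e : f ⊑ g₊ → suc (ℓ g ℕ.+ m₂) ≡ ℓ f ℕ.+ k → f →ₖ g₊
    to-e le e = le , trans (cong₂ ℕ._+_ ℓg₊ (cong length fixed-one)) e

    m₁≡m₂ : (α < k → g ⟨$⟩ α ≢ i) → (α < k → g ⟨$⟩ α ≢ suc i) →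
            (β < k → g ⟨$⟩ β ≢ i) → (β < k → g ⟨$⟩ β ≢ suc i) → m₁ ≡ m₂
    m₁≡m₂ h₁ h₂ h₃ h₄ = cong length (fixedPositions-ext k f g f₊ g forth back)
      where
      forth : ∀ {x} → x < k → f ⟨$⟩ x ≡ g ⟨$⟩ x → f₊ ⟨$⟩ x ≡ g ⟨$⟩ x
      forth {x} x<k e = trans (sw-other
        (λ fx → h₁ (subst (_< k) (=α fx) x<k) (trans (cong (g ⟨$⟩_) (sym (=α fx))) (trans (sym e) fx)))
        (λ fx → h₄ (subst (_< k) (=β fx) x<k) (trans (cong (g ⟨$⟩_) (sym (=β fx))) (trans (sym e) fx)))) e
      back : ∀ {x} → x < k → f₊ ⟨$⟩ x ≡ g ⟨$⟩ x → f ⟨$⟩ x ≡ g ⟨$⟩ x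
      back {x} x<k e = trans (sym (sw-other
        (λ fx → h₂ (subst (_< k) (=α fx) x<k) (trans (cong (g ⟨$⟩_) (sym (=α fx))) (trans (sym e) (sw-i fx))))
        (λ fx → h₃ (subst (_< k) (=β fx) x<k) (trans (cong (g ⟨$⟩_) (sym (=β fx))) (trans (sym e) (sw-1+i fx)))))) e

    -- The possible patterns among the four relations. Each constructor keeps what the recursion of
    -- the coefficients uses: the relations that fail, implications that make others equivalent, and
    -- how the lists of fixed positions differ or which positions they avoid.
    data Outcome : Set where
      only-lower : ¬ f₊ →ₖ g₊ → ¬ f →ₖ g → ¬ f →ₖ g₊ →
                   (α < k → g ⟨$⟩ α ≢ suc i) → (β < k → g ⟨$⟩ β ≢ i) → Outcome
      all-but-lower : ¬ f₊ →ₖ g → (f₊ →ₖ g₊ → f →ₖ g) → (f →ₖ g → f →ₖ g₊) → (f →ₖ g₊ → f₊ →ₖ g₊) →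
                      g ⟨$⟩ α ≡ i → fixedPositions k f g ↭ α ∷ fixedPositions k f₊ g → Outcome
      to-lower : ¬ f₊ →ₖ g₊ → ¬ f →ₖ g₊ → (f₊ →ₖ g → f →ₖ g) → (f →ₖ g → f₊ →ₖ g) →
                 g ⟨$⟩ α ≡ suc i → fixedPositions k f₊ g ↭ α ∷ fixedPositions k f g → Outcome
      from-upper : ¬ f →ₖ g → ¬ f →ₖ g₊ → (f₊ →ₖ g → f₊ →ₖ g₊) → (f₊ →ₖ g₊ → f₊ →ₖ g) →
                   g ⟨$⟩ β ≡ i → fixedPositions k f₊ g ↭ β ∷ fixedPositions k f g → Outcome
      parallel : ¬ f₊ →ₖ g → ¬ f →ₖ g₊ → (f₊ →ₖ g₊ → f →ₖ g) → (f →ₖ g → f₊ →ₖ g₊) →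
                 ((α < k → g ⟨$⟩ α ≢ i) × (β < k → g ⟨$⟩ β ≢ suc i)) ⊎
                 (α < k × β < k × g ⟨$⟩ α ≡ i × g ⟨$⟩ β ≡ suc i) → Outcome

    raise-f : ∀ {v} → f ⊑ v → (α < k → v ⟨$⟩ α ≢ i) → (k ≤ β → v ⟨$⟩ β ≢ suc i) → f₊ ⊑ v
    raise-f {v} p l h = ≤ₖ-raiseˡ ascf p
      (λ x<k e → subst (λ x → x < k → v ⟨$⟩ x ≢ i) (sym (=α e)) l x<k)
      (λ k≤x e → subst (λ x → k ≤ x → v ⟨$⟩ x ≢ suc i) (sym (=β e)) h k≤x)

    lower-f : ∀ {v} → f₊ ⊑ v → (k ≤ α → v ⟨$⟩ α ≢ suc i) → (β < k → v ⟨$⟩ β ≢ i) →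
              (SameSide k α β → v ⟨$⟩ α < v ⟨$⟩ β) → f ⊑ v
    lower-f {v} p h l o = ≤ₖ-lowerˡ ascf p
      (λ k≤x e → subst (λ x → k ≤ x → v ⟨$⟩ x ≢ suc i) (sym (=α e)) h k≤x)
      (λ x<k e → subst (λ x → x < k → v ⟨$⟩ x ≢ i) (sym (=β e)) l x<k)
      (λ ss e e′ → subst₂ (λ x y → SameSide k x y → v ⟨$⟩ x < v ⟨$⟩ y) (sym (=α e)) (sym (=β e′)) o ss)

    lower-g-f₊ : f₊ ⊑ g₊ → (α < k → g ⟨$⟩ α ≢ i) → (k ≤ β → g ⟨$⟩ β ≢ suc i) → f₊ ⊑ g
    lower-g-f₊ p l h = ≤ₖ-lowerʳ ascg p
      (λ x<k gx e → subst (λ x → x < k → g ⟨$⟩ x ≢ i) (sym (=α (sw≡1+i e))) l x<k gx)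
      (λ k≤x gx e → subst (λ x → k ≤ x → g ⟨$⟩ x ≢ suc i) (sym (=β (sw≡i e))) h k≤x gx)

    lower-g-f : f ⊑ g₊ → (β < k → g ⟨$⟩ β ≢ i) → (k ≤ α → g ⟨$⟩ α ≢ suc i) → f ⊑ g
    lower-g-f p l h = ≤ₖ-lowerʳ ascg p
      (λ x<k gx e → subst (λ x → x < k → g ⟨$⟩ x ≢ i) (sym (=β e)) l x<k gx)
      (λ k≤x gx e → subst (λ x → k ≤ x → g ⟨$⟩ x ≢ suc i) (sym (=α e)) h k≤x gx)

    module _ (gα : g ⟨$⟩ α ≡ i) (gβ : g ⟨$⟩ β ≡ suc i) where

      position : ∀ x → (f ⟨$⟩ x ≡ g ⟨$⟩ x × f₊ ⟨$⟩ x ≡ g₊ ⟨$⟩ x) ⊎ (f₊ ⟨$⟩ x ≡ f ⟨$⟩ x × g₊ ⟨$⟩ x ≡ g ⟨$⟩ x)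
      position x = go (f ⟨$⟩ x ℕ.≟ i) (f ⟨$⟩ x ℕ.≟ suc i)
        where
        go : Dec (f ⟨$⟩ x ≡ i) → Dec (f ⟨$⟩ x ≡ suc i) → (f ⟨$⟩ x ≡ g ⟨$⟩ x × f₊ ⟨$⟩ x ≡ g₊ ⟨$⟩ x) ⊎ (f₊ ⟨$⟩ x ≡ f ⟨$⟩ x × g₊ ⟨$⟩ x ≡ g ⟨$⟩ x)
        go (yes e) _ = inj₁ (fx≡gx , cong sw fx≡gx)
          where fx≡gx = trans e (trans (sym gα) (cong (g ⟨$⟩_) (sym (=α e))))
        go (no _) (yes e) = inj₁ (fx≡gx , cong sw fx≡gx)
          where fx≡gx = trans e (trans (sym gβ) (cong (g ⟨$⟩_) (sym (=β e))))
        go (no n) (no n′) = inj₂ (sw-other n n′ , sw-other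
          (λ e → n (trans (cong (f ⟨$⟩_) (⟨$⟩-injective g (trans e (sym gα)))) fα))
          (λ e → n′ (trans (cong (f ⟨$⟩_) (⟨$⟩-injective g (trans e (sym gβ)))) fβ)))

      raise-at-position : ∀ x (R : ℕ → ℕ → Set) → (∀ {m} → R m m) → R (f ⟨$⟩ x) (g ⟨$⟩ x) → R (f₊ ⟨$⟩ x) (g₊ ⟨$⟩ x)
      raise-at-position x R rfl r with position x
      ... | inj₁ (_ , e)  = subst (R (f₊ ⟨$⟩ x)) e rfl
      ... | inj₂ (e , e′) = subst₂ R (sym e) (sym e′) r

      lower-at-position : ∀ x (R : ℕ → ℕ → Set) → (∀ {m} → R m m) → R (f₊ ⟨$⟩ x) (g₊ ⟨$⟩ x) → R (f ⟨$⟩ x) (g ⟨$⟩ x)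
      lower-at-position x R rfl r with position x
      ... | inj₁ (e , _)  = subst (R (f ⟨$⟩ x)) e rfl
      ... | inj₂ (e , e′) = subst₂ R e e′ r

      -- When α and β lie on the same side, the mixed relations from f₊ to g and from f to g₊ both
      -- fail, so the exchange cannot be made in f and g one after the other. It is made in both at
      -- once: f and g agree at α and β, and elsewhere their values stay.
      raise-both : f ⊑ g → f₊ ⊑ g₊
      raise-both p = record
        { low   = λ {x} x<k → raise-at-position x _≤_ ≤-refl (low p x<k)
        ; high  = λ {x} k≤x → raise-at-position x (λ m n → n ≤ m) ≤-refl (high p k≤x)
        ; order = order′ }
        where
        order′ : ∀ {x y} → SameSide k x y → x < y → f₊ ⟨$⟩ x < f₊ ⟨$⟩ y → g₊ ⟨$⟩ x < g₊ ⟨$⟩ y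
        order′ {x} {y} ss x<y lt = sw-mono-< (order p ss x<y (subst₂ _<_ (swap-involutive i (suc i) _) (swap-involutive i (suc i) _)
          (sw-mono-< lt λ e e′ → <-asym x<y (ascf (sw≡1+i e′) (sw≡i e)))))
          (λ e e′ → <-asym lt (subst₂ _<_
            (sym (trans (cong (f₊ ⟨$⟩_) (⟨$⟩-injective g (trans e′ (sym gβ)))) f₊β))
            (sym (trans (cong (f₊ ⟨$⟩_) (⟨$⟩-injective g (trans e (sym gα)))) f₊α)) (n<1+n i)))

      lower-both : f₊ ⊑ g₊ → f ⊑ g
      lower-both p = record
        { low   = λ {x} x<k → lower-at-position x _≤_ ≤-refl (low p x<k)
        ; high  = λ {x} k≤x → lower-at-position x (λ m n → n ≤ m) ≤-refl (high p k≤x)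
        ; order = order′ }
        where
        order′ : ∀ {x y} → SameSide k x y → x < y → f ⟨$⟩ x < f ⟨$⟩ y → g ⟨$⟩ x < g ⟨$⟩ y
        order′ {x} {y} ss x<y lt with f ⟨$⟩ x ℕ.≟ i | f ⟨$⟩ y ℕ.≟ suc i
        ... | yes e | yes e′ = subst₂ _<_ (sym (trans (cong (g ⟨$⟩_) (=α e)) gα)) (sym (trans (cong (g ⟨$⟩_) (=β e′)) gβ)) (n<1+n i)
        ... | no n | _ = unsw (sw-mono-< lt λ e _ → n e)
          where
          unsw : f₊ ⟨$⟩ x < f₊ ⟨$⟩ y → g ⟨$⟩ x < g ⟨$⟩ y
          unsw lt = subst₂ _<_ (swap-involutive i (suc i) _) (swap-involutive i (suc i) _)
            (sw-mono-< (order p ss x<y lt) λ e e′ → <-asym x<y (ascg (sw≡1+i e′) (sw≡i e)))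
        ... | yes _ | no n = unsw (sw-mono-< lt λ _ → n)
          where
          unsw : f₊ ⟨$⟩ x < f₊ ⟨$⟩ y → g ⟨$⟩ x < g ⟨$⟩ y
          unsw lt = subst₂ _<_ (swap-involutive i (suc i) _) (swap-involutive i (suc i) _)
            (sw-mono-< (order p ss x<y lt) λ e e′ → <-asym x<y (ascg (sw≡1+i e′) (sw≡i e)))

    -- Here f₊ ⊑ g follows from each of the other three relations, and then
    -- ≤ₖ-ℓ for f₊ ⊑ g excludes equality in those.
    disjoint : (α < k → g ⟨$⟩ α ≢ i) → (α < k → g ⟨$⟩ α ≢ suc i) →
               (β < k → g ⟨$⟩ β ≢ i) → (β < k → g ⟨$⟩ β ≢ suc i) → (k ≤ β → g ⟨$⟩ β ≢ suc i) →
               (k ≤ β → g ⟨$⟩ β ≢ i) ⊎ (k ≤ α → g ⟨$⟩ α ≢ suc i) → Outcome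
    disjoint h₁ h₂ h₃ h₄ h₅ h₆ = only-lower
      (λ p → no-tight (lower-g-f₊ (below p) h₁ h₅) (≤-reflexive (tight-b p)))
      (λ p → no-tight (raise-f (below p) h₁ h₅) (≤-reflexive (tight p)))
      (λ p → no-tight (diagonal h₆ (below p)) (<⇒≤ (≤-reflexive (trans (cong (λ m → suc (ℓ g ℕ.+ m)) (m₁≡m₂ h₁ h₂ h₃ h₄)) (tight-e p)))))
      h₂ h₃
      where
      no-tight : f₊ ⊑ g → ¬ ℓ g ℕ.+ m₁ ≤ ℓ f ℕ.+ k
      no-tight le n₁≤K = <⇒≱ (subst₂ _≤_ (cong (ℕ._+ k) ℓf₊) (cong (ℓ g ℕ.+_) (sym (m₁≡m₂ h₁ h₂ h₃ h₄))) (≤ₖ-ℓ k le)) n₁≤K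
      diagonal : (k ≤ β → g ⟨$⟩ β ≢ i) ⊎ (k ≤ α → g ⟨$⟩ α ≢ suc i) → f ⊑ g₊ → f₊ ⊑ g
      diagonal (inj₁ h) p = lower-g-f₊ (raise-f p (λ α<k e → h₂ α<k (sw≡i e)) (λ k≤β e → h k≤β (sw≡1+i e))) h₁ h₅
      diagonal (inj₂ h) p = raise-f (lower-g-f p h₃ h) h₁ h₅

    -- The position α is fixed from f to g and from f₊ to g₊ but moves from f to g₊, so m₁ = m₂ + 1
    -- and the length equations of these three relations coincide. The relation from f₊ to g fails
    -- at α, where i + 1 would have to be at most i.
    case-A : α < k → g ⟨$⟩ α ≡ i → (β < k → g ⟨$⟩ β ≢ suc i) → Outcome
    case-A α<k gα h = all-but-lower
      (λ p → 1+n≰n (subst₂ _≤_ f₊α gα (low (below p) α<k)))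
      (λ p → e→c (b→e (below p)) , tight-b p)
      (λ p → to-e (c→e (below p)) (trans (trans (sym (+-suc (ℓ g) m₂)) (cong (ℓ g ℕ.+_) (sym m₁≡1+m₂))) (tight p)))
      (λ p → to-b (e→b (below p)) (trans (cong (ℓ g ℕ.+_) m₁≡1+m₂) (trans (+-suc (ℓ g) m₂) (tight-e p))))
      gα extra
      where
      g₊α : g₊ ⟨$⟩ α ≡ suc i
      g₊α = sw-i gα
      g≡i⇒α : ∀ {x} → g ⟨$⟩ x ≡ i → x ≡ α
      g≡i⇒α e = ⟨$⟩-injective g (trans e (sym gα))
      β≢α : β ≢ α
      β≢α = >⇒≢ α<β
      extra : fixedPositions k f g ↭ α ∷ fixedPositions k f₊ g
      extra = fixedPositions-insert k f g f₊ g α<k (trans fα (sym gα)) (λ e → i≢1+i (trans (sym gα) (trans (sym e) f₊α)))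
        (λ {x} x<k x≢α e → trans (sw-other (x≢α ∘ =α) (λ fx → h (subst (_< k) (=β fx) x<k) (trans (cong (g ⟨$⟩_) (sym (=β fx))) (trans (sym e) fx)))) e)
        (λ {x} x<k x≢α e → trans (sym (sw-other (x≢α ∘ =α) (λ fx → x≢α (g≡i⇒α (trans (sym e) (sw-1+i fx)))))) e)
      m₁≡1+m₂ : m₁ ≡ suc m₂
      m₁≡1+m₂ = ↭-length extra
      b→e : f₊ ⊑ g₊ → f ⊑ g₊
      b→e p = lower-f p (λ k≤α → contradiction α<k (≤⇒≯ k≤α)) (λ β<k e → h β<k (sw≡i e))
        λ { (inj₁ (_ , β<k)) → subst (_< g₊ ⟨$⟩ β) (sym g₊α)
              (>1+i (subst (_≤ g₊ ⟨$⟩ β) f₊β (low p β<k)) (λ e → h β<k (sw≡i e)) (λ e → β≢α (g≡i⇒α (sw≡1+i e))))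
          ; (inj₂ (k≤α , _)) → contradiction α<k (≤⇒≯ k≤α) }
      e→b : f ⊑ g₊ → f₊ ⊑ g₊
      e→b p = raise-f p (λ _ e → 1+n≢n (trans (sym g₊α) e)) (λ _ e → β≢α (g≡i⇒α (sw≡1+i e)))
      e→c : f ⊑ g₊ → f ⊑ g
      e→c p = lower-g-f p (λ _ e → β≢α (g≡i⇒α e)) (λ k≤α → contradiction α<k (≤⇒≯ k≤α))
      c→e : f ⊑ g → f ⊑ g₊
      c→e p = ≤ₖ-raiseʳ ascg p
        (λ k≤x gx _ → <⇒≱ (subst (_< k) (sym (g≡i⇒α gx)) α<k) k≤x)
        (λ x<k gx fx → h (subst (_< k) (=β fx) x<k) (trans (cong (g ⟨$⟩_) (sym (=β fx))) gx))
        clash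
        where
        clash : ∀ {x y} → SameSide k x y → g ⟨$⟩ x ≡ i → g ⟨$⟩ y ≡ suc i → ¬ f ⟨$⟩ x < f ⟨$⟩ y
        clash (inj₂ (k≤x , _)) gx _ _ = <⇒≱ (subst (_< k) (sym (g≡i⇒α gx)) α<k) k≤x
        clash {x} {y} (inj₁ (_ , y<k)) gx gy lt = h (subst (_< k) (=β fy) y<k) (trans (cong (g ⟨$⟩_) (sym (=β fy))) gy)
          where
          fy : f ⟨$⟩ y ≡ suc i
          fy = ≤-antisym (subst (f ⟨$⟩ y ≤_) gy (low p y<k)) (subst (_< f ⟨$⟩ y) (trans (cong (f ⟨$⟩_) (g≡i⇒α gx)) fα) lt)

    -- Otherwise the low positions of i and i + 1 in g have exchanged values in
    -- g₊, against the order of their values in v.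
    no-raise : ∀ {v x} → v ⊑ g₊ → x < k → g ⟨$⟩ x ≡ suc i → (i ≤ v ⟨$⟩ x) →
               v ⟨$⟩ (g ⁻¹ ⟨$⟩ i) ≢ i → ¬ v ⟨$⟩ (g ⁻¹ ⟨$⟩ i) ≢ suc i
    no-raise {v} {x} p x<k gx i≤vx ≢i ≢1+i = <-asym
      (order p (inj₁ (γ<k , x<k)) γ<x (<-≤-trans (<i (subst (v ⟨$⟩ γ ≤_) (sw-i (invʳ g i)) (low p γ<k)) ≢i ≢1+i) i≤vx))
      (subst₂ _<_ (sym (sw-1+i gx)) (sym (sw-i (invʳ g i))) (n<1+n i))
      where
      γ = g ⁻¹ ⟨$⟩ i
      γ<x : γ < x
      γ<x = ascg (invʳ g i) gx
      γ<k = <-trans γ<x x<k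

    -- Here α is fixed from f₊ to g and moves from f to g, which compensates the difference between
    -- the lengths of f₊ and f.
    case-B : α < k → g ⟨$⟩ α ≡ suc i → Outcome
    case-B α<k gα = to-lower
      (λ p → 1+n≰n (subst₂ _≤_ f₊α (sw-1+i gα) (low (below p) α<k)))
      (λ p → no-raise (below p) α<k gα (≤-reflexive (sym fα))
        (λ e → i≢1+i (trans (sym (invʳ g i)) (trans (cong (g ⟨$⟩_) (=α e)) gα)))
        (λ e → <-asym α<β (subst (_< α) (=β e) (ascg (invʳ g i) gα))))
      (λ p → a→c (below p) , suc-injective (trans (sym (+-suc (ℓ g) m₁)) (trans (cong (ℓ g ℕ.+_) (sym m₂≡1+m₁)) (tight-a p))))
      (λ p → to-a (c→a (below p)) (trans (cong (ℓ g ℕ.+_) m₂≡1+m₁) (trans (+-suc (ℓ g) m₁) (cong suc (tight p)))))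
      gα extra
      where
      g≡1+i⇒α : ∀ {x} → g ⟨$⟩ x ≡ suc i → x ≡ α
      g≡1+i⇒α e = ⟨$⟩-injective g (trans e (sym gα))
      gβ≢i : g ⟨$⟩ β ≢ i
      gβ≢i e = <-asym α<β (ascg e gα)
      gβ≢1+i : g ⟨$⟩ β ≢ suc i
      gβ≢1+i e = >⇒≢ α<β (g≡1+i⇒α e)
      extra : fixedPositions k f₊ g ↭ α ∷ fixedPositions k f g
      extra = fixedPositions-insert k f₊ g f g α<k (trans f₊α (sym gα)) (λ e → i≢1+i (trans (sym fα) (trans e gα)))
        (λ {x} x<k x≢α e → trans (sym (sw-other (x≢α ∘ =α) (λ fx → gβ≢i (trans (cong (g ⟨$⟩_) (sym (=β fx))) (trans (sym e) (sw-1+i fx)))))) e)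
        (λ {x} x<k x≢α e → trans (sw-other (x≢α ∘ =α) (λ fx → x≢α (g≡1+i⇒α (trans (sym e) fx)))) e)
      m₂≡1+m₁ : m₂ ≡ suc m₁
      m₂≡1+m₁ = ↭-length extra
      a→c : f₊ ⊑ g → f ⊑ g
      a→c p = lower-f p (λ k≤α → contradiction α<k (≤⇒≯ k≤α)) (λ _ → gβ≢i)
        λ { (inj₁ (_ , β<k)) → subst (_< g ⟨$⟩ β) (sym gα) (>1+i (subst (_≤ g ⟨$⟩ β) f₊β (low p β<k)) gβ≢i gβ≢1+i)
          ; (inj₂ (k≤α , _)) → contradiction α<k (≤⇒≯ k≤α) }
      c→a : f ⊑ g → f₊ ⊑ g
      c→a p = raise-f p (λ _ e → i≢1+i (trans (sym e) gα)) (λ _ → gβ≢1+i)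

    -- Here β is fixed from f₊ to g and moves from f₊ to g₊, which compensates the difference
    -- between the lengths of g and g₊. A relation from f to g₊ would squeeze the value of g₊ at α
    -- to i, that is g α = i + 1, although i + 1 comes after i in g.
    case-C : β < k → g ⟨$⟩ β ≡ i → Outcome
    case-C β<k gβ = from-upper
      (λ p → 1+n≰n (subst₂ _≤_ fβ gβ (low (below p) β<k)))
      (λ p → gα≢1+i (sw≡i (≤-antisym
        (ℕ.s≤s⁻¹ (subst (g₊ ⟨$⟩ α <_) (sw-i gβ) (order (below p) (inj₁ (α<k , β<k)) α<β (subst₂ _<_ (sym fα) (sym fβ) (n<1+n i)))))
        (subst (_≤ g₊ ⟨$⟩ α) fα (low (below p) α<k)))))
      (λ p → to-b (a→b (below p)) (suc-injective (trans (sym (+-suc (ℓ g) m₁)) (trans (cong (ℓ g ℕ.+_) (sym m₂≡1+m₁)) (tight-a p)))))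
      (λ p → to-a (b→a (below p)) (trans (cong (ℓ g ℕ.+_) m₂≡1+m₁) (trans (+-suc (ℓ g) m₁) (cong suc (tight-b p)))))
      gβ extra
      where
      α<k = <-trans α<β β<k
      g≡i⇒β : ∀ {x} → g ⟨$⟩ x ≡ i → x ≡ β
      g≡i⇒β e = ⟨$⟩-injective g (trans e (sym gβ))
      gα≢1+i : g ⟨$⟩ α ≢ suc i
      gα≢1+i e = <-asym α<β (ascg gβ e)
      extra : fixedPositions k f₊ g ↭ β ∷ fixedPositions k f g
      extra = fixedPositions-insert k f₊ g f g β<k (trans f₊β (sym gβ)) (λ e → i≢1+i (trans (sym gβ) (trans (sym e) fβ)))
        (λ {x} x<k x≢β e → trans (sym (sw-other (λ fx → gα≢1+i (trans (cong (g ⟨$⟩_) (sym (=α fx))) (trans (sym e) (sw-i fx)))) (x≢β ∘ =β))) e)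
        (λ {x} x<k x≢β e → trans (sw-other (λ fx → x≢β (g≡i⇒β (trans (sym e) fx))) (x≢β ∘ =β)) e)
      m₂≡1+m₁ : m₂ ≡ suc m₁
      m₂≡1+m₁ = ↭-length extra
      a→b : f₊ ⊑ g → f₊ ⊑ g₊
      a→b p = ≤ₖ-raiseʳ ascg p
        (λ k≤x gx _ → <⇒≱ (subst (_< k) (sym (g≡i⇒β gx)) β<k) k≤x)
        (λ x<k gx fx → gα≢1+i (trans (cong (g ⟨$⟩_) (sym (=α (sw≡1+i fx)))) gx))
        clash
        where
        clash : ∀ {x y} → SameSide k x y → g ⟨$⟩ x ≡ i → g ⟨$⟩ y ≡ suc i → ¬ f₊ ⟨$⟩ x < f₊ ⟨$⟩ y
        clash (inj₂ (k≤x , _)) gx _ _ = <⇒≱ (subst (_< k) (sym (g≡i⇒β gx)) β<k) k≤x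
        clash {x} {y} (inj₁ (_ , y<k)) gx gy lt = gα≢1+i (trans (cong (g ⟨$⟩_) (sym (=α (sw≡1+i f₊y)))) gy)
          where
          f₊y : f₊ ⟨$⟩ y ≡ suc i
          f₊y = ≤-antisym (subst (f₊ ⟨$⟩ y ≤_) gy (low p y<k)) (subst (_< f₊ ⟨$⟩ y) (trans (cong (f₊ ⟨$⟩_) (g≡i⇒β gx)) f₊β) lt)
      b→a : f₊ ⊑ g₊ → f₊ ⊑ g
      b→a p = lower-g-f₊ p (λ _ e → <⇒≢ α<β (g≡i⇒β e)) (λ k≤β → contradiction β<k (≤⇒≯ k≤β))

    case-4L : β < k → g ⟨$⟩ β ≡ suc i → g ⟨$⟩ α ≢ i → g ⟨$⟩ α ≢ suc i → Outcome
    case-4L β<k gβ gα≢i gα≢1+i = only-lower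
      (λ p → no-raise (below p) β<k gβ (≤-reflexive (sym f₊β))
        (λ e → i≢1+i (trans (sym (invʳ g i)) (trans (cong (g ⟨$⟩_) (=β (sw≡i e))) gβ)))
        (λ e → gα≢i (trans (cong (g ⟨$⟩_) (sym (=α (sw≡1+i e)))) (invʳ g i))))
      (λ p → gα≢i (≤-antisym
        (ℕ.s≤s⁻¹ (subst (g ⟨$⟩ α <_) gβ (order (below p) (inj₁ (α<k , β<k)) α<β (subst₂ _<_ (sym fα) (sym fβ) (n<1+n i)))))
        (subst (_≤ g ⟨$⟩ α) fα (low (below p) α<k))))
      (λ p → 1+n≰n (subst₂ _≤_ fβ (sw-1+i gβ) (low (below p) β<k)))
      (λ _ → gα≢1+i) (λ _ e → i≢1+i (trans (sym e) gβ))
      where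
      α<k = <-trans α<β β<k

    case-4H : k ≤ β → g ⟨$⟩ β ≡ suc i → g ⟨$⟩ α ≢ i → g ⟨$⟩ α ≢ suc i → Outcome
    case-4H k≤β gβ gα≢i gα≢1+i = parallel
      (λ p → 1+n≰n (subst₂ _≤_ gβ f₊β (high (below p) k≤β)))
      -- From f ⊑ g₊ one can raise f, and then `≤ₖ-ℓ` for f₊ ⊑ g₊ contradicts the length equation of
      -- f →ₖ g₊, because m₁ = m₂.
      (λ p → <⇒≱ (≤-reflexive (trans (cong (λ m → suc (ℓ g ℕ.+ m)) m≡) (tight-e p)))
        (ℕ.s≤s⁻¹ (subst₂ _≤_ (cong (ℕ._+ k) ℓf₊) (cong₂ ℕ._+_ ℓg₊ (cong length fixed-both)) (≤ₖ-ℓ k (up (below p))))))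
      (λ p → b→c (below p) , tight-b p)
      (λ p → to-b (c→b (below p)) (tight p))
      (inj₁ ((λ _ → gα≢i) , λ β<k → contradiction β<k (≤⇒≯ k≤β)))
      where
      m≡ : m₁ ≡ m₂
      m≡ = m₁≡m₂ (λ _ → gα≢i) (λ _ → gα≢1+i) (λ β<k → contradiction β<k (≤⇒≯ k≤β)) (λ β<k → contradiction β<k (≤⇒≯ k≤β))
      g≡1+i⇒β : ∀ {x} → g ⟨$⟩ x ≡ suc i → x ≡ β
      g≡1+i⇒β e = ⟨$⟩-injective g (trans e (sym gβ))
      up : f ⊑ g₊ → f₊ ⊑ g₊
      up p = raise-f p (λ _ e → gα≢1+i (sw≡i e)) (λ _ e → i≢1+i (trans (sym (sw-1+i gβ)) e))
      b→c : f₊ ⊑ g₊ → f ⊑ g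
      b→c p = lower-g-f
        (lower-f p (λ _ e → gα≢i (sw≡1+i e)) (λ β<k → contradiction β<k (≤⇒≯ k≤β))
          λ { (inj₁ (_ , β<k)) → contradiction β<k (≤⇒≯ k≤β)
            ; (inj₂ (k≤α , _)) → subst (g₊ ⟨$⟩ α <_) (sym (sw-1+i gβ))
                (<i (subst (g₊ ⟨$⟩ α ≤_) f₊α (high p k≤α)) (λ e → gα≢1+i (sw≡i e)) (λ e → gα≢i (sw≡1+i e))) })
        (λ β<k → contradiction β<k (≤⇒≯ k≤β)) (λ _ → gα≢1+i)
      c→b : f ⊑ g → f₊ ⊑ g₊
      c→b p = up (≤ₖ-raiseʳ ascg p
        (λ _ gx fx → gα≢i (trans (cong (g ⟨$⟩_) (sym (=α fx))) gx))
        (λ x<k gx _ → <⇒≱ (subst (_< k) (g≡1+i⇒β gx) x<k) k≤β)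
        clash)
        where
        clash : ∀ {x y} → SameSide k x y → g ⟨$⟩ x ≡ i → g ⟨$⟩ y ≡ suc i → ¬ f ⟨$⟩ x < f ⟨$⟩ y
        clash (inj₁ (_ , y<k)) _ gy _ = <⇒≱ (subst (_< k) (g≡1+i⇒β gy) y<k) k≤β
        clash {x} {y} (inj₂ (k≤x , _)) gx gy lt = gα≢i (trans (cong (g ⟨$⟩_) (sym (=α fx))) gx)
          where
          fx : f ⟨$⟩ x ≡ i
          fx = ≤-antisym (ℕ.s≤s⁻¹ (subst (f ⟨$⟩ x <_) (trans (cong (f ⟨$⟩_) (g≡1+i⇒β gy)) fβ) lt)) (subst (_≤ f ⟨$⟩ x) gx (high p k≤x))

    case-5LL : α < k → β < k → g ⟨$⟩ α ≡ i → g ⟨$⟩ β ≡ suc i → Outcome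
    case-5LL α<k β<k gα gβ = parallel
      (λ p → 1+n≰n (subst₂ _≤_ f₊α gα (low (below p) α<k)))
      (λ p → 1+n≰n (subst₂ _≤_ fβ (sw-1+i gβ) (low (below p) β<k)))
      (λ p → lower-both gα gβ (below p) , tight-b p)
      (λ p → to-b (raise-both gα gβ (below p)) (tight p))
      (inj₂ (α<k , β<k , gα , gβ))

    case-5HH : k ≤ α → g ⟨$⟩ α ≡ i → g ⟨$⟩ β ≡ suc i → Outcome
    case-5HH k≤α gα gβ = parallel
      (λ p → 1+n≰n (subst₂ _≤_ gβ f₊β (high (below p) k≤β)))
      (λ p → 1+n≰n (subst₂ _≤_ (sw-i gα) fα (high (below p) k≤α)))
      (λ p → lower-both gα gβ (below p) , tight-b p)
      (λ p → to-b (raise-both gα gβ (below p)) (tight p))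
      (inj₁ ((λ α<k → contradiction α<k (≤⇒≯ k≤α)) , λ β<k → contradiction β<k (≤⇒≯ k≤β)))
      where k≤β = ≤-trans k≤α (<⇒≤ α<β)

    outcome : Outcome
    outcome with g ⟨$⟩ α ℕ.≟ i | g ⟨$⟩ α ℕ.≟ suc i | g ⟨$⟩ β ℕ.≟ i | g ⟨$⟩ β ℕ.≟ suc i | <-≤-connex α k | <-≤-connex β k
    ... | yes gα | _ | _ | yes gβ | inj₁ α<k | inj₁ β<k = case-5LL α<k β<k gα gβ
    ... | yes gα | _ | _ | yes gβ | inj₁ α<k | inj₂ k≤β = case-A α<k gα (λ β<k → contradiction β<k (≤⇒≯ k≤β))
    ... | yes gα | _ | _ | no ¬gβ | inj₁ α<k | _ = case-A α<k gα (λ _ → ¬gβ)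
    ... | yes gα | _ | _ | yes gβ | inj₂ k≤α | _ = case-5HH k≤α gα gβ
    ... | yes gα | _ | _ | no ¬gβ | inj₂ k≤α | _ = disjoint
          (λ α<k → contradiction α<k (≤⇒≯ k≤α)) (λ α<k → contradiction α<k (≤⇒≯ k≤α))
          (λ _ e → <⇒≢ α<β (⟨$⟩-injective g (trans gα (sym e)))) (λ _ → ¬gβ) (λ _ → ¬gβ)
          (inj₂ λ _ e → i≢1+i (trans (sym gα) e))
    ... | no _ | yes gα | _ | _ | inj₁ α<k | _ = case-B α<k gα
    ... | no _ | yes gα | _ | _ | inj₂ k≤α | _ = disjoint
          (λ α<k → contradiction α<k (≤⇒≯ k≤α)) (λ α<k → contradiction α<k (≤⇒≯ k≤α))
          (λ _ → gβ≢i) (λ _ → gβ≢1+i) (λ _ → gβ≢1+i) (inj₁ λ _ → gβ≢i)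
      where
      gβ≢i : g ⟨$⟩ β ≢ i
      gβ≢i e = <-asym α<β (ascg e gα)
      gβ≢1+i : g ⟨$⟩ β ≢ suc i
      gβ≢1+i e = <⇒≢ α<β (⟨$⟩-injective g (trans gα (sym e)))
    ... | no _ | no _ | yes gβ | _ | _ | inj₁ β<k = case-C β<k gβ
    ... | no n | no n′ | yes gβ | _ | _ | inj₂ k≤β = disjoint (λ _ → n) (λ _ → n′)
          (λ β<k → contradiction β<k (≤⇒≯ k≤β)) (λ β<k → contradiction β<k (≤⇒≯ k≤β))
          (λ _ e → i≢1+i (trans (sym gβ) e)) (inj₂ λ _ → n′)
    ... | no n | no n′ | no _ | yes gβ | _ | inj₁ β<k = case-4L β<k gβ n n′
    ... | no n | no n′ | no _ | yes gβ | _ | inj₂ k≤β = case-4H k≤β gβ n n′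
    ... | no n | no n′ | no m | no m′ | _ | _ = disjoint (λ _ → n) (λ _ → n′) (λ _ → m) (λ _ → m′) (λ _ → m′) (inj₂ λ _ → n′)

-- Substitutions and the action of s_i on polynomials

0ₚ 1ₚ : Poly
0ₚ = con (+ 0)
1ₚ = con (+ 1)

[]-[]-ext : ∀ {σ τ σ′ τ′} → (∀ v → σ v [ τ ] ≡ σ′ v [ τ′ ]) → ∀ P → P [ σ ] [ τ ] ≡ P [ σ′ ] [ τ′ ]
[]-[]-ext h (con a) = refl
[]-[]-ext h (var v) = h v
[]-[]-ext h (P + Q) = cong₂ _+_ ([]-[]-ext h P) ([]-[]-ext h Q)
[]-[]-ext h (P * Q) = cong₂ _*_ ([]-[]-ext h P) ([]-[]-ext h Q)
[]-[]-ext h (- P)   = cong -_ ([]-[]-ext h P)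

[]-∘ : ∀ {σ τ ρ} → (∀ v → σ v [ τ ] ≡ ρ v) → ∀ P → P [ σ ] [ τ ] ≡ P [ ρ ]
[]-∘ h (con a) = refl
[]-∘ h (var v) = h v
[]-∘ h (P + Q) = cong₂ _+_ ([]-∘ h P) ([]-∘ h Q)
[]-∘ h (P * Q) = cong₂ _*_ ([]-∘ h P) ([]-∘ h Q)
[]-∘ h (- P)   = cong -_ ([]-∘ h P)

[]-ext : ∀ {σ τ} → (∀ v → σ v ≈ τ v) → ∀ P → P [ σ ] ≈ P [ τ ]
[]-ext h (con a) = ≈-refl
[]-ext h (var v) = h v
[]-ext h (P + Q) = +-cong ([]-ext h P) ([]-ext h Q)
[]-ext h (P * Q) = *-cong ([]-ext h P) ([]-ext h Q)
[]-ext h (- P)   = -‿cong ([]-ext h P)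

[]-var : ∀ P → P [ var ] ≡ P
[]-var (con a) = refl
[]-var (var v) = refl
[]-var (P + Q) = cong₂ _+_ ([]-var P) ([]-var Q)
[]-var (P * Q) = cong₂ _*_ ([]-var P) ([]-var Q)
[]-var (- P)   = cong -_ ([]-var P)

⟨$⟩-swap : ∀ u a b e → u ⟨$⟩ swap a b e ≡ swap (u ⟨$⟩ a) (u ⟨$⟩ b) (u ⟨$⟩ e)
⟨$⟩-swap u a b e = go (e ℕ.≟ a) (e ℕ.≟ b)
  where
  go : Dec (e ≡ a) → Dec (e ≡ b) → u ⟨$⟩ swap a b e ≡ swap (u ⟨$⟩ a) (u ⟨$⟩ b) (u ⟨$⟩ e)
  go (yes refl) _ = trans (cong (u ⟨$⟩_) (swapˡ a b)) (sym (swapˡ (u ⟨$⟩ a) (u ⟨$⟩ b)))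
  go (no _) (yes refl) = trans (cong (u ⟨$⟩_) (swapʳ a b)) (sym (swapʳ (u ⟨$⟩ a) (u ⟨$⟩ b)))
  go (no ≢a) (no ≢b) = trans (cong (u ⟨$⟩_) (swap-other a b ≢a ≢b))
    (sym (swap-other (u ⟨$⟩ a) (u ⟨$⟩ b) (≢a ∘ ⟨$⟩-injective u) (≢b ∘ ⟨$⟩-injective u)))

s-comm : ∀ {i j} → suc i < j → ∀ e → s i ⟨$⟩ (s j ⟨$⟩ e) ≡ s j ⟨$⟩ (s i ⟨$⟩ e)
s-comm {i} {j} 1+i<j e = trans (⟨$⟩-swap (s i) j (suc j) e)
  (cong₂ (λ p q → swap p q (s i ⟨$⟩ e)) (swap-other i (suc i) (>⇒≢ i<j) (>⇒≢ 1+i<j))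
    (swap-other i (suc i) (>⇒≢ (m<n⇒m<1+n i<j)) (>⇒≢ (m<n⇒m<1+n 1+i<j))))
  where i<j = <-trans (n<1+n i) 1+i<j

s-braid : ∀ i e → s i ⟨$⟩ (s (suc i) ⟨$⟩ (s i ⟨$⟩ e)) ≡ s (suc i) ⟨$⟩ (s i ⟨$⟩ (s (suc i) ⟨$⟩ e))
s-braid i e = trans (⟨$⟩-swap (s i) (suc i) (suc (suc i)) (s i ⟨$⟩ e))
  (trans (cong₂ (λ p q → swap p q (s i ⟨$⟩ (s i ⟨$⟩ e))) (swapʳ i (suc i))
           (swap-other i (suc i) (>⇒≢ (m≤n⇒m≤1+n (n<1+n i))) 1+n≢n))
  (trans (cong (swap i (suc (suc i))) (trans (swap-involutive i (suc i) e) (sym (swap-involutive (suc i) (suc (suc i)) e))))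
  (sym (trans (⟨$⟩-swap (s (suc i)) i (suc i) (s (suc i) ⟨$⟩ e))
    (cong₂ (λ p q → swap p q (s (suc i) ⟨$⟩ (s (suc i) ⟨$⟩ e)))
       (swap-other (suc i) (suc (suc i)) (<⇒≢ (n<1+n i)) (<⇒≢ (m≤n⇒m≤1+n (n<1+n i)))) (swapˡ (suc i) (suc (suc i))))))))

s-act-involutive : ∀ i P → P [ s-act i ] [ s-act i ] ≡ P
s-act-involutive i P = trans ([]-∘ {ρ = var} (λ { x[ j ] → cong (var ∘ x[_]) (swap-involutive i (suc i) j) ; y[ j ] → refl ; z[ j ] → refl }) P) ([]-var P)

s-act-comm : ∀ {i j} → suc i < j → ∀ P → P [ s-act i ] [ s-act j ] ≡ P [ s-act j ] [ s-act i ]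
s-act-comm 1+i<j = []-[]-ext λ { x[ e ] → cong (var ∘ x[_]) (sym (s-comm 1+i<j e)) ; y[ j ] → refl ; z[ j ] → refl }

s-act-braid : ∀ i P → P [ s-act i ] [ s-act (suc i) ] [ s-act i ] ≡ P [ s-act (suc i) ] [ s-act i ] [ s-act (suc i) ]
s-act-braid i P = trans (cong (_[ s-act i ]) ([]-∘ {ρ = λ v → s-act i v [ s-act (suc i) ]} (λ _ → refl) P))
  (trans ([]-[]-ext {σ′ = λ v → s-act (suc i) v [ s-act i ]} (λ { x[ e ] → cong (var ∘ x[_]) (s-braid i e) ; y[ j ] → refl ; z[ j ] → refl }) P)
    (cong (_[ s-act (suc i) ]) (sym ([]-∘ {ρ = λ v → s-act (suc i) v [ s-act i ]} (λ _ → refl) P))))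

-- Divided differences

δ : ℕ → Poly
δ = xᵢ-xᵢ₊₁

∂-spec : ∀ i P → ∂ i P * δ i ≈ P - P [ s-act i ]
∂-spec i P = RawMagmaDefinitions._∣ʳ_.equality (∂-divisible i P)

-- Applying s_{i+1} turns this factor into x_i - x_{i+1}, which is known to cancel.
*-cancelʳ-xᵢ-xᵢ₊₂ : ∀ i P Q → P * (var x[ i ] - var x[ suc (suc i) ]) ≈ Q * (var x[ i ] - var x[ suc (suc i) ]) → P ≈ Q
*-cancelʳ-xᵢ-xᵢ₊₂ i P Q eq = begin
  P            ≡⟨ s-act-involutive j P ⟨
  P [ s-act j ] [ s-act j ] ≈⟨ []-cong (s-act j) (*-cancelʳ-xᵢ-xᵢ₊₁ i _ _ (≈-trans (*-cong ≈-refl (≡⇒≈ (sym e))) (≈-trans ([]-cong (s-act j) eq) (*-cong ≈-refl (≡⇒≈ e))))) ⟩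
  Q [ s-act j ] [ s-act j ] ≡⟨ s-act-involutive j Q ⟩
  Q            ∎
  where
  j = suc i
  e : (var x[ i ] - var x[ suc j ]) [ s-act j ] ≡ δ i
  e = cong₂ (λ p q → var x[ p ] - var x[ q ]) (swap-other j (suc j) (<⇒≢ (n<1+n i)) (<⇒≢ (m≤n⇒m≤1+n (n<1+n i)))) (swapʳ j (suc j))

δ-s : ∀ i → δ i [ s-act i ] ≡ var x[ suc i ] - var x[ i ]
δ-s i = cong₂ (λ p q → var x[ p ] - var x[ q ]) (swapˡ i (suc i)) (swapʳ i (suc i))

∂-0 : ∀ i {P} → P ≈ P [ s-act i ] → ∂ i P ≈ 0ₚ
∂-0 i {P} inv = ≈-sym (∂-unique i P 0ₚ (begin
  0ₚ * δ i          ≈⟨ solve 2 (λ d p → :con (+ 0) :* d := p :- p) ≈-refl (δ i) P ⟩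
  P - P             ≈⟨ +-cong ≈-refl (-‿cong inv) ⟩
  P - P [ s-act i ] ∎))

∂-0⁻ : ∀ i {P} → ∂ i P ≈ 0ₚ → P [ s-act i ] ≈ P
∂-0⁻ i {P} z = begin
  P [ s-act i ]                          ≈⟨ solve 2 (λ p q → q := p :- (p :- q)) ≈-refl P (P [ s-act i ]) ⟩
  P - (P - P [ s-act i ])                ≈⟨ +-cong ≈-refl (-‿cong (≈-sym (∂-spec i P))) ⟩
  P - ∂ i P * δ i                        ≈⟨ +-cong ≈-refl (-‿cong (*-cong z ≈-refl)) ⟩
  P - 0ₚ * δ i                           ≈⟨ solve 2 (λ p d → p :- :con (+ 0) :* d := p) ≈-refl P (δ i) ⟩
  P ∎

∂-invariant : ∀ i P → ∂ i P [ s-act i ] ≈ ∂ i P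
∂-invariant i P = *-cancelʳ-xᵢ-xᵢ₊₁ i _ _ (begin
  ∂ i P [ s-act i ] * δ i
    ≈⟨ solve 3 (λ a x y → a :* (x :- y) := :- (a :* (y :- x))) ≈-refl (∂ i P [ s-act i ]) (var x[ i ]) (var x[ suc i ]) ⟩
  - (∂ i P [ s-act i ] * (var x[ suc i ] - var x[ i ]))  ≡⟨ cong (λ e → - (∂ i P [ s-act i ] * e)) (δ-s i) ⟨
  - ((∂ i P * δ i) [ s-act i ])                          ≈⟨ -‿cong ([]-cong (s-act i) (∂-spec i P)) ⟩
  - (P [ s-act i ] - P [ s-act i ] [ s-act i ])          ≡⟨ cong (λ e → - (P [ s-act i ] - e)) (s-act-involutive i P) ⟩
  - (P [ s-act i ] - P)                                  ≈⟨ solve 2 (λ p q → :- (q :- p) := p :- q) ≈-refl P (P [ s-act i ]) ⟩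
  P - P [ s-act i ]                                      ≈⟨ ∂-spec i P ⟨
  ∂ i P * δ i                                            ∎)

∂∂ : ∀ i P → ∂ i (∂ i P) ≈ 0ₚ
∂∂ i P = ∂-0 i (≈-sym (∂-invariant i P))

∂-*-invariant : ∀ i {S} P → S [ s-act i ] ≈ S → ∂ i (S * P) ≈ S * ∂ i P
∂-*-invariant i {S} P inv = ≈-sym (∂-unique i (S * P) (S * ∂ i P) (begin
  S * ∂ i P * δ i                 ≈⟨ *-assoc S (∂ i P) (δ i) ⟩
  S * (∂ i P * δ i)               ≈⟨ *-cong ≈-refl (∂-spec i P) ⟩
  S * (P - P [ s-act i ])         ≈⟨ solve 3 (λ s p q → s :* (p :- q) := s :* p :- s :* q) ≈-refl S P (P [ s-act i ]) ⟩
  S * P - S * P [ s-act i ]       ≈⟨ +-cong ≈-refl (-‿cong (*-cong (≈-sym inv) ≈-refl)) ⟩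
  S * P - S [ s-act i ] * P [ s-act i ] ∎))

-- Multiplied by both roots, either side becomes the alternating sum of P over the group generated
-- by s_i and s_j, which commute; the roots are then cancelled.
∂-comm : ∀ {i j} → suc i < j → ∀ P → ∂ i (∂ j P) ≈ ∂ j (∂ i P)
∂-comm {i} {j} 1+i<j P = *-cancelʳ-xᵢ-xᵢ₊₁ i _ _ (*-cancelʳ-xᵢ-xᵢ₊₁ j _ _ (begin
  ∂ i (∂ j P) * δ i * δ j                             ≈⟨ expand i j δj P ⟩
  P - P [ s-act j ] - (P [ s-act i ] - P [ s-act j ] [ s-act i ])
    ≡⟨ cong (λ e → P - P [ s-act j ] - (P [ s-act i ] - e)) (s-act-comm 1+i<j P) ⟨
  P - P [ s-act j ] - (P [ s-act i ] - P [ s-act i ] [ s-act j ])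
    ≈⟨ solve 4 (λ p q r t → p :- q :- (r :- t) := p :- r :- (q :- t)) ≈-refl P (P [ s-act j ]) (P [ s-act i ]) _ ⟩
  P - P [ s-act i ] - (P [ s-act j ] - P [ s-act i ] [ s-act j ])  ≈⟨ expand j i δi P ⟨
  ∂ j (∂ i P) * δ j * δ i                             ≈⟨ solve 3 (λ a b d → a :* b :* d := a :* d :* b) ≈-refl (∂ j (∂ i P)) (δ j) (δ i) ⟩
  ∂ j (∂ i P) * δ i * δ j                             ∎))
  where
  i<j = <-trans (n<1+n i) 1+i<j
  δj : δ j [ s-act i ] ≡ δ j
  δj = cong₂ (λ p q → var x[ p ] - var x[ q ]) (swap-other i (suc i) (>⇒≢ i<j) (>⇒≢ 1+i<j))
    (swap-other i (suc i) (>⇒≢ (m<n⇒m<1+n i<j)) (>⇒≢ (m<n⇒m<1+n 1+i<j)))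
  δi : δ i [ s-act j ] ≡ δ i
  δi = cong₂ (λ p q → var x[ p ] - var x[ q ]) (swap-other j (suc j) (<⇒≢ i<j) (<⇒≢ (m<n⇒m<1+n i<j)))
    (swap-other j (suc j) (<⇒≢ 1+i<j) (<⇒≢ (m<n⇒m<1+n 1+i<j)))
  expand : ∀ i j → δ j [ s-act i ] ≡ δ j → ∀ P →
           ∂ i (∂ j P) * δ i * δ j ≈ P - P [ s-act j ] - (P [ s-act i ] - P [ s-act j ] [ s-act i ])
  expand i j e P = begin
    ∂ i (∂ j P) * δ i * δ j                  ≈⟨ *-cong (∂-spec i (∂ j P)) ≈-refl ⟩
    (∂ j P - ∂ j P [ s-act i ]) * δ j        ≈⟨ solve 3 (λ a b d → (a :- b) :* d := a :* d :- b :* d) ≈-refl (∂ j P) (∂ j P [ s-act i ]) (δ j) ⟩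
    ∂ j P * δ j - ∂ j P [ s-act i ] * δ j    ≡⟨ cong (λ e → ∂ j P * δ j - ∂ j P [ s-act i ] * e) e ⟨
    ∂ j P * δ j - (∂ j P * δ j) [ s-act i ]  ≈⟨ +-cong (∂-spec j P) (-‿cong ([]-cong (s-act i) (∂-spec j P))) ⟩
    P - P [ s-act j ] - (P [ s-act i ] - P [ s-act j ] [ s-act i ]) ∎

-- Both sides of the braid relation, multiplied by the three roots, are the
-- alternating sum of P over the symmetric group on three letters.
module _ (i j : ℕ) (γ : Poly) (δj-i : δ j [ s-act i ] ≡ γ) (δi-j : δ i [ s-act j ] ≡ γ)
         (γ-i : γ [ s-act i ] ≡ δ j) (γ≈ : γ ≈ δ i + δ j) where

  ∂-braid-expand : ∀ P → ∂ i (∂ j (∂ i P)) * δ i * δ j * γ ≈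
    P - P [ s-act i ] - (P [ s-act j ] - P [ s-act i ] [ s-act j ])
      + (P [ s-act j ] [ s-act i ] - P [ s-act i ] [ s-act j ] [ s-act i ])
  ∂-braid-expand P = begin
    ∂ i Q * δ i * δ j * γ
      ≈⟨ *-cong (*-cong (∂-spec i Q) ≈-refl) ≈-refl ⟩
    (Q - Q [ s-act i ]) * δ j * γ
      ≈⟨ solve 4 (λ q q′ b g → (q :- q′) :* b :* g := q :* b :* g :- q′ :* g :* b) ≈-refl Q (Q [ s-act i ]) (δ j) γ ⟩
    Q * δ j * γ - Q [ s-act i ] * γ * δ j
      ≡⟨ cong (λ e → Q * δ j * γ - Q [ s-act i ] * e * δ j) δj-i ⟨
    Q * δ j * γ - (Q * δ j) [ s-act i ] * δ j
      ≈⟨ +-cong (*-cong (∂-spec j R) ≈-refl) (-‿cong (*-cong ([]-cong (s-act i) (∂-spec j R)) ≈-refl)) ⟩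
    (R - R [ s-act j ]) * γ - (R [ s-act i ] - R [ s-act j ] [ s-act i ]) * δ j
      ≈⟨ +-cong ≈-refl (-‿cong (*-cong (+-cong (∂-invariant i P) ≈-refl) ≈-refl)) ⟩
    (R - R [ s-act j ]) * γ - (R - R [ s-act j ] [ s-act i ]) * δ j
      ≈⟨ solve 5 (λ r r₁ r₂ g b → (r :- r₁) :* g :- (r :- r₂) :* b := r :* (g :- b) :- r₁ :* g :+ r₂ :* b) ≈-refl R (R [ s-act j ]) (R [ s-act j ] [ s-act i ]) γ (δ j) ⟩
    R * (γ - δ j) - R [ s-act j ] * γ + R [ s-act j ] [ s-act i ] * δ j
      ≈⟨ +-cong (+-cong (*-cong ≈-refl (≈-trans (+-cong γ≈ ≈-refl) (solve 2 (λ a b → a :+ b :- b := a) ≈-refl (δ i) (δ j)))) ≈-refl) ≈-refl ⟩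
    R * δ i - R [ s-act j ] * γ + R [ s-act j ] [ s-act i ] * δ j
      ≡⟨ cong₂ (λ e e′ → R * δ i - R [ s-act j ] * e + R [ s-act j ] [ s-act i ] * e′) δi-j (trans (cong (_[ s-act i ]) δi-j) γ-i) ⟨
    R * δ i - (R * δ i) [ s-act j ] + (R * δ i) [ s-act j ] [ s-act i ]
      ≈⟨ +-cong (+-cong (∂-spec i P) (-‿cong ([]-cong (s-act j) (∂-spec i P)))) ([]-cong (s-act i) ([]-cong (s-act j) (∂-spec i P))) ⟩
    P - P [ s-act i ] - (P [ s-act j ] - P [ s-act i ] [ s-act j ])
      + (P [ s-act j ] [ s-act i ] - P [ s-act i ] [ s-act j ] [ s-act i ]) ∎
    where
    R = ∂ i P
    Q = ∂ j R

∂-braid : ∀ i P → ∂ i (∂ (suc i) (∂ i P)) ≈ ∂ (suc i) (∂ i (∂ (suc i) P))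
∂-braid i P = *-cancelʳ-xᵢ-xᵢ₊₁ i _ _ (*-cancelʳ-xᵢ-xᵢ₊₁ j _ _ (*-cancelʳ-xᵢ-xᵢ₊₂ i _ _ (begin
  ∂ i (∂ j (∂ i P)) * δ i * δ j * γ
    ≈⟨ ∂-braid-expand i j γ e₁ e₂ e₃ γ≈ P ⟩
  P - P [ s-act i ] - (P [ s-act j ] - P [ s-act i ] [ s-act j ])
    + (P [ s-act j ] [ s-act i ] - P [ s-act i ] [ s-act j ] [ s-act i ])
    ≡⟨ cong (λ e → P - P [ s-act i ] - (P [ s-act j ] - P [ s-act i ] [ s-act j ]) + (P [ s-act j ] [ s-act i ] - e)) (s-act-braid i P) ⟩
  P - P [ s-act i ] - (P [ s-act j ] - P [ s-act i ] [ s-act j ])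
    + (P [ s-act j ] [ s-act i ] - P [ s-act j ] [ s-act i ] [ s-act j ])
    ≈⟨ solve 6 (λ p a b ab ba aba → p :- a :- (b :- ab) :+ (ba :- aba) := p :- b :- (a :- ba) :+ (ab :- aba)) ≈-refl P (P [ s-act i ]) (P [ s-act j ]) _ _ _ ⟩
  P - P [ s-act j ] - (P [ s-act i ] - P [ s-act j ] [ s-act i ])
    + (P [ s-act i ] [ s-act j ] - P [ s-act j ] [ s-act i ] [ s-act j ])
    ≈⟨ ∂-braid-expand j i γ e₂ e₁ e₄ (≈-trans γ≈ (+-comm _ _)) P ⟨
  ∂ j (∂ i (∂ j P)) * δ j * δ i * γ
    ≈⟨ *-cong (solve 3 (λ a b d → a :* b :* d := a :* d :* b) ≈-refl (∂ j (∂ i (∂ j P))) (δ j) (δ i)) ≈-refl ⟩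
  ∂ j (∂ i (∂ j P)) * δ i * δ j * γ ∎)))
  where
  j = suc i
  γ = var x[ i ] - var x[ suc j ]
  i≢j = <⇒≢ (n<1+n i)
  i≢1+j = <⇒≢ (m≤n⇒m≤1+n (n<1+n i))
  e₁ : δ j [ s-act i ] ≡ γ
  e₁ = cong₂ (λ p q → var x[ p ] - var x[ q ]) (swapʳ i j) (swap-other i j (i≢1+j ∘ sym) 1+n≢n)
  e₂ : δ i [ s-act j ] ≡ γ
  e₂ = cong₂ (λ p q → var x[ p ] - var x[ q ]) (swap-other j (suc j) i≢j i≢1+j) (swapˡ j (suc j))
  e₃ : γ [ s-act i ] ≡ δ j
  e₃ = cong₂ (λ p q → var x[ p ] - var x[ q ]) (swapˡ i j) (swap-other i j (i≢1+j ∘ sym) 1+n≢n)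
  e₄ : γ [ s-act j ] ≡ δ i
  e₄ = cong₂ (λ p q → var x[ p ] - var x[ q ]) (swap-other j (suc j) i≢j i≢1+j) (swapʳ j (suc j))
  γ≈ : γ ≈ δ i + δ j
  γ≈ = solve 3 (λ a b d → a :- d := a :- b :+ (b :- d)) ≈-refl (var x[ i ]) (var x[ j ]) (var x[ suc j ])

∂-[] : ∀ i σ → (∀ v → s-act i v [ σ ] ≈ σ v [ s-act i ]) → σ x[ i ] ≈ var x[ i ] → σ x[ suc i ] ≈ var x[ suc i ] →
       ∀ P → ∂ i P [ σ ] ≈ ∂ i (P [ σ ])
∂-[] i σ comm xi x1+i P = ∂-unique i (P [ σ ]) (∂ i P [ σ ]) (begin
  ∂ i P [ σ ] * δ i                 ≈⟨ *-cong ≈-refl (+-cong (≈-sym xi) (-‿cong (≈-sym x1+i))) ⟩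
  (∂ i P * δ i) [ σ ]               ≈⟨ []-cong σ (∂-spec i P) ⟩
  P [ σ ] - P [ s-act i ] [ σ ]     ≈⟨ +-cong ≈-refl (-‿cong (swap-σ P)) ⟩
  P [ σ ] - P [ σ ] [ s-act i ]     ∎)
  where
  swap-σ : ∀ P → P [ s-act i ] [ σ ] ≈ P [ σ ] [ s-act i ]
  swap-σ P = ≈-trans (≡⇒≈ ([]-∘ {ρ = λ v → s-act i v [ σ ]} (λ _ → refl) P))
    (≈-trans ([]-ext comm P) (≡⇒≈ (sym ([]-∘ {ρ = λ v → σ v [ s-act i ]} (λ _ → refl) P))))

-- Independence of the reduced word

LeftDescent : ℕ → S∞ → Set
LeftDescent i v = v ⁻¹ ⟨$⟩ suc i < v ⁻¹ ⟨$⟩ i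

-- A letter can begin a reduced word of v exactly when it is a left descent of v. This form follows
-- the recursion of `foldr ∂`, whose outermost operator is the first letter.
data Reduced : S∞ → List ℕ → Set where
  nil  : ∀ {v} → v ≋ ι → Reduced v []
  cons : ∀ {v i w} → LeftDescent i v → Reduced (s i · v) w → Reduced v (i ∷ w)

left-descent-cong : ∀ i v v′ → v ≋ v′ → LeftDescent i v → LeftDescent i v′
left-descent-cong i v v′ p = subst₂ _<_ (⁻¹-cong v v′ p (suc i)) (⁻¹-cong v v′ p i)

reduced-cong : ∀ v v′ {w} → v ≋ v′ → Reduced v w → Reduced v′ w
reduced-cong v v′ p (nil e) = nil (λ i → trans (sym (p i)) (e i))
reduced-cong v v′ p (cons {i = i} d r) = cons (left-descent-cong i v v′ p d)
  (reduced-cong (s i · v) (s i · v′) (λ j → cong (swap i (suc i)) (p j)) r)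

⁻¹-other : ∀ i v {j} → j ≢ i → j ≢ suc i → (s i · v) ⁻¹ ⟨$⟩ j ≡ v ⁻¹ ⟨$⟩ j
⁻¹-other i v {j} ≢i ≢1+i = trans (cong ((s i · v) ⁻¹ ⟨$⟩_) (sym (swap-other i (suc i) ≢i ≢1+i))) (s·-⁻¹ i v j)

⁻¹-≢ : ∀ v {i j} → i ≢ j → v ⁻¹ ⟨$⟩ i ≢ v ⁻¹ ⟨$⟩ j
⁻¹-≢ v i≢j e = i≢j (⟨$⟩-injective (v ⁻¹) e)

ℓ-s·-≤ : ∀ i v → ℓ v ≤ suc (ℓ (s i · v))
ℓ-s·-≤ i v with <-cmp (v ⁻¹ ⟨$⟩ i) (v ⁻¹ ⟨$⟩ suc i)
... | tri< lt _ _ = ≤-trans (n≤1+n _) (≤-trans (≤-reflexive (sym (ℓ-left-ascent i v lt))) (n≤1+n _))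
... | tri≈ _ e _ = contradiction e (⁻¹-≢ v (1+n≢n ∘ sym))
... | tri> _ _ gt = ≤-reflexive (ℓ-left-descent i v gt)

ℓ-≋ι : ∀ v → v ≋ ι → ℓ v ≡ 0
ℓ-≋ι v e = ℓ-cong v ι e

-- If the first letter i were not a left descent, s_i v would be longer than v, yet the remaining
-- word, shorter than ℓ v, would express it.
word⇒reduced : ∀ w v → ∏ₛ (map s w) ≋ v → length w ≡ ℓ v → Reduced v w
word⇒reduced [] v p _ = nil λ i → sym (p i)
word⇒reduced (i ∷ w) v p len with <-cmp (v ⁻¹ ⟨$⟩ i) (v ⁻¹ ⟨$⟩ suc i)
... | tri≈ _ e _ = contradiction e (⁻¹-≢ v (1+n≢n ∘ sym))
... | tri> _ _ gt = cons gt (word⇒reduced w (s i · v) (λ j → tail j) (suc-injective (trans len (ℓ-left-descent i v gt))))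
  where
  tail : ∏ₛ (map s w) ≋ s i · v
  tail j = trans (sym (swap-involutive i (suc i) _)) (cong (swap i (suc i)) (p j))
... | tri< lt _ _ = contradiction (short w (s i · v) tail) (<⇒≱ (<-trans (≤-reflexive len) (≤-reflexive (sym (ℓ-left-ascent i v lt)))))
  where
  tail : ∏ₛ (map s w) ≋ s i · v
  tail j = trans (sym (swap-involutive i (suc i) _)) (cong (swap i (suc i)) (p j))
  short : ∀ w v → ∏ₛ (map s w) ≋ v → ℓ v ≤ length w
  short [] v p = ≤-reflexive (ℓ-≋ι v λ i → sym (p i))
  short (i ∷ w) v p = ≤-trans (ℓ-s·-≤ i v) (s≤s (short w (s i · v) λ j →
    trans (sym (swap-involutive i (suc i) _)) (cong (swap i (suc i)) (p j))))

reducedWord-reduced : ∀ v → Reduced v (word (reducedWord v))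
reducedWord-reduced v = word⇒reduced _ v (product (reducedWord v)) (minimal (reducedWord v))

foldr-∂-cong : ∀ w {P Q} → P ≈ Q → foldr ∂ P w ≈ foldr ∂ Q w
foldr-∂-cong [] e = e
foldr-∂-cong (i ∷ w) e = ∂-cong i (foldr-∂-cong w e)

-- Induction on the length, without moves between words. If the first letters i and j differ, both
-- are left descents of v, hence v has reduced words beginning with i j and j i, or with i j i and j
-- i j, and continuing alike. The induction hypothesis replaces each given word by the one with the
-- same first letter, and the relation between divided differences joins the two.
matsumoto : ∀ n {v w w′} → ℓ v ≡ n → Reduced v w → Reduced v w′ → ∀ P → foldr ∂ P w ≈ foldr ∂ P w′
matsumoto n ℓv (nil _) (nil _) P = ≈-refl
matsumoto n {v} ℓv (nil e) (cons {i = i} d _) P =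
  contradiction (left-descent-cong i v ι e d) (<-asym (n<1+n i))
matsumoto n {v} ℓv (cons {i = i} d _) (nil e) P =
  contradiction (left-descent-cong i v ι e d) (<-asym (n<1+n i))
matsumoto zero {v} ℓv (cons {i = i} d _) (cons _ _) P =
  contradiction (trans (sym (ℓ-left-descent i v d)) ℓv) λ ()
matsumoto (suc n) {v} ℓv (cons {i = i} {w} d r) (cons {i = j} {w′} d′ r′) P = go (<-cmp i j)
  where
  ℓ-at : ∀ i → LeftDescent i v → ℓ (s i · v) ≡ n
  ℓ-at i d = suc-injective (trans (sym (ℓ-left-descent i v d)) ℓv)
  distant : ∀ {i j w w′} → suc i < j → LeftDescent i v → LeftDescent j v →
        Reduced (s i · v) w → Reduced (s j · v) w′ → ∂ i (foldr ∂ P w) ≈ ∂ j (foldr ∂ P w′)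
  distant {i} {j} {w} {w′} 1+i<j d d′ r r′ = begin
    ∂ i (foldr ∂ P w)        ≈⟨ ∂-cong i (matsumoto n (ℓ-at i d) r (cons dj rt) P) ⟩
    ∂ i (∂ j (foldr ∂ P t′)) ≈⟨ ∂-comm 1+i<j (foldr ∂ P t′) ⟩
    ∂ j (∂ i (foldr ∂ P t′)) ≈⟨ ∂-cong j (matsumoto n (ℓ-at j d′) (cons di (reduced-cong (s j · (s i · v)) (s i · (s j · v)) (λ e → sym (s-comm 1+i<j (v ⟨$⟩ e))) rt)) r′ P) ⟩
    ∂ j (foldr ∂ P w′)       ∎
    where
    i<j = <-trans (n<1+n i) 1+i<j
    t′ = word (reducedWord (s j · (s i · v)))
    rt = reducedWord-reduced (s j · (s i · v))
    dj : LeftDescent j (s i · v)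
    dj = subst₂ _<_ (sym (⁻¹-other i v (>⇒≢ (m<n⇒m<1+n i<j)) (>⇒≢ (m<n⇒m<1+n 1+i<j)))) (sym (⁻¹-other i v (>⇒≢ i<j) (>⇒≢ 1+i<j))) d′
    di : LeftDescent i (s j · v)
    di = subst₂ _<_ (sym (⁻¹-other j v (<⇒≢ 1+i<j) (<⇒≢ (m<n⇒m<1+n 1+i<j)))) (sym (⁻¹-other j v (<⇒≢ i<j) (<⇒≢ (m<n⇒m<1+n i<j)))) d
  adjacent : ∀ {i w w′} → LeftDescent i v → LeftDescent (suc i) v →
         Reduced (s i · v) w → Reduced (s (suc i) · v) w′ → ∂ i (foldr ∂ P w) ≈ ∂ (suc i) (foldr ∂ P w′)
  adjacent {i} {w} {w′} d d′ r r′ = begin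
    ∂ i (foldr ∂ P w)              ≈⟨ ∂-cong i (matsumoto n (ℓ-at i d) r (cons d₁ (cons d₂ rt)) P) ⟩
    ∂ i (∂ j₁ (∂ i (foldr ∂ P t′))) ≈⟨ ∂-braid i (foldr ∂ P t′) ⟩
    ∂ j₁ (∂ i (∂ j₁ (foldr ∂ P t′))) ≈⟨ ∂-cong j₁ (matsumoto n (ℓ-at j₁ d′) (cons d₃ (cons d₄ (reduced-cong (s i · (s j₁ · (s i · v))) (s j₁ · (s i · (s j₁ · v))) (λ e → s-braid i (v ⟨$⟩ e)) rt))) r′ P) ⟩
    ∂ j₁ (foldr ∂ P w′)             ∎
    where
    j₁ = suc i
    k₁ = suc j₁
    t′ = word (reducedWord (s i · (s j₁ · (s i · v))))
    rt = reducedWord-reduced (s i · (s j₁ · (s i · v)))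
    i≢j = <⇒≢ (n<1+n i)
    i≢k = <⇒≢ (m<n⇒m<1+n (n<1+n i))
    at-k : (s i · v) ⁻¹ ⟨$⟩ k₁ ≡ v ⁻¹ ⟨$⟩ k₁
    at-k = ⁻¹-other i v (i≢k ∘ sym) 1+n≢n
    at-i : (s j₁ · v) ⁻¹ ⟨$⟩ i ≡ v ⁻¹ ⟨$⟩ i
    at-i = ⁻¹-other j₁ v i≢j i≢k
    d₁ : LeftDescent j₁ (s i · v)
    d₁ = subst₂ _<_ (sym at-k) (sym (s·-⁻¹-suc i v)) (<-trans d′ d)
    d₂ : LeftDescent i (s j₁ · (s i · v))
    d₂ = subst₂ _<_ (sym (trans (s·-⁻¹-i j₁ (s i · v)) at-k)) (sym (trans (⁻¹-other j₁ (s i · v) i≢j i≢k) (s·-⁻¹-i i v))) d′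
    d₃ : LeftDescent i (s j₁ · v)
    d₃ = subst₂ _<_ (sym (s·-⁻¹-i j₁ v)) (sym at-i) (<-trans d′ d)
    d₄ : LeftDescent j₁ (s i · (s j₁ · v))
    d₄ = subst₂ _<_ (sym (trans (⁻¹-other i (s j₁ · v) (i≢k ∘ sym) 1+n≢n) (s·-⁻¹-suc j₁ v))) (sym (trans (s·-⁻¹-suc i (s j₁ · v)) at-i)) d
  go : Tri (i < j) (i ≡ j) (j < i) → ∂ i (foldr ∂ P w) ≈ ∂ j (foldr ∂ P w′)
  go (tri≈ _ refl _) = ∂-cong i (matsumoto n (ℓ-at i d) r r′ P)
  go (tri< i<j _ _) with m≤n⇒m<n∨m≡n i<j
  ... | inj₁ 1+i<j = distant 1+i<j d d′ r r′
  ... | inj₂ refl  = adjacent d d′ r r′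
  go (tri> _ _ j<i) with m≤n⇒m<n∨m≡n j<i
  ... | inj₁ 1+j<i = ≈-sym (distant 1+j<i d′ d r′ r)
  ... | inj₂ refl  = ≈-sym (adjacent d′ d r′ r)

foldr-∂≈∂^ : ∀ v {w} → Reduced v w → ∀ P → foldr ∂ P w ≈ ∂^ v P
foldr-∂≈∂^ v r P = matsumoto (ℓ v) refl r (reducedWord-reduced v) P

∂^-≋ : ∀ u v → u ≋ v → ∀ P → ∂^ u P ≈ ∂^ v P
∂^-≋ u v e P = foldr-∂≈∂^ v (reduced-cong u v e (reducedWord-reduced u)) P

∂^-cong : ∀ v {P Q} → P ≈ Q → ∂^ v P ≈ ∂^ v Q
∂^-cong v = foldr-∂-cong (word (reducedWord v))

∂^-ι : ∀ P → ∂^ ι P ≈ P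
∂^-ι P = ≈-sym (foldr-∂≈∂^ ι (nil {v = ι} λ _ → refl) P)

∂-∂^ : ∀ i v → LeftDescent i v → ∀ P → ∂ i (∂^ (s i · v) P) ≈ ∂^ v P
∂-∂^ i v d P = foldr-∂≈∂^ v (cons d (reducedWord-reduced (s i · v))) P

∂-∂^-0 : ∀ i v → LeftDescent i v → ∀ P → ∂ i (∂^ v P) ≈ 0ₚ
∂-∂^-0 i v d P = ≈-trans (∂-cong i (≈-sym (∂-∂^ i v d P))) (∂∂ i (∂^ (s i · v) P))

∂^-∂ : ∀ v i → v ⟨$⟩ suc i < v ⟨$⟩ i → ∀ P → ∂^ (v · s i) (∂ i P) ≈ ∂^ v P
∂^-∂ v i d P = begin
  foldr ∂ (∂ i P) w     ≡⟨ foldr-∷ʳ ∂ P i w ⟨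
  foldr ∂ P (w ∷ʳ i)    ≈⟨ foldr-∂≈∂^ v (word⇒reduced (w ∷ʳ i) v product′ length′) P ⟩
  ∂^ v P                ∎
  where
  w = word (reducedWord (v · s i))
  ∏-∷ʳ : ∀ is j → ∏ₛ (map s (is ∷ʳ i)) ⟨$⟩ j ≡ ∏ₛ (map s is) ⟨$⟩ (s i ⟨$⟩ j)
  ∏-∷ʳ [] j = refl
  ∏-∷ʳ (i′ ∷ is) j = cong (s i′ ⟨$⟩_) (∏-∷ʳ is j)
  product′ : ∏ₛ (map s (w ∷ʳ i)) ≋ v
  product′ j = trans (∏-∷ʳ w j) (trans (product (reducedWord (v · s i)) (s i ⟨$⟩ j)) (t-involutive v i (suc i) j))
  length′ : length (w ∷ʳ i) ≡ ℓ v
  length′ = trans (length-++ w) (trans (ℕₚ.+-comm (length w) 1) (trans (cong suc (minimal (reducedWord (v · s i)))) (sym (ℓ-descent v i d))))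

∂^-zero : ∀ v → ∂^ v 0ₚ ≈ 0ₚ
∂^-zero v = go (word (reducedWord v))
  where
  go : ∀ w → foldr ∂ 0ₚ w ≈ 0ₚ
  go [] = ≈-refl
  go (i ∷ w) = ≈-trans (∂-cong i (go w)) (∂-0 i {0ₚ} ≈-refl)

∂^-∂-0 : ∀ v i → v ⟨$⟩ suc i < v ⟨$⟩ i → ∀ P → ∂^ v (∂ i P) ≈ 0ₚ
∂^-∂-0 v i d P = ≈-trans (≈-sym (∂^-∂ v i d (∂ i P))) (≈-trans (∂^-cong (v · s i) (∂∂ i P)) (∂^-zero (v · s i)))

∂^-* : ∀ v {S} P → (∀ i → S [ s-act i ] ≈ S) → ∂^ v (S * P) ≈ S * ∂^ v P
∂^-* v {S} P inv = go (word (reducedWord v))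
  where
  go : ∀ w → foldr ∂ (S * P) w ≈ S * foldr ∂ P w
  go [] = ≈-refl
  go (i ∷ w) = ≈-trans (∂-cong i (go w)) (∂-*-invariant i (foldr ∂ P w) (inv i))

∂^-+ : ∀ v P Q → ∂^ v (P + Q) ≈ ∂^ v P + ∂^ v Q
∂^-+ v P Q = go (word (reducedWord v))
  where
  go : ∀ w → foldr ∂ (P + Q) w ≈ foldr ∂ P w + foldr ∂ Q w
  go [] = ≈-refl
  go (i ∷ w) = ∂-cong i (go w)

∂^-[] : ∀ v σ → (∀ i v → s-act i v [ σ ] ≈ σ v [ s-act i ]) → (∀ i → σ x[ i ] ≈ var x[ i ]) →
        ∀ P → ∂^ v P [ σ ] ≈ ∂^ v (P [ σ ])
∂^-[] v σ comm fix P = go (word (reducedWord v))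
  where
  go : ∀ w → foldr ∂ P w [ σ ] ≈ foldr ∂ (P [ σ ]) w
  go [] = ≈-refl
  go (i ∷ w) = ≈-trans (∂-[] i σ (comm i) (fix i) (fix (suc i)) (foldr ∂ P w)) (∂-cong i (go w))

-- The exchange of y variables

y-act : ℕ → Var → Poly
y-act i x[ j ] = var x[ j ]
y-act i y[ j ] = var y[ s i ⟨$⟩ j ]
y-act i z[ j ] = var z[ j ]

δʸ : ℕ → Poly
δʸ i = var y[ i ] - var y[ suc i ]

x↔y : Var → Poly
x↔y x[ j ] = var y[ j ]
x↔y y[ j ] = var x[ j ]
x↔y z[ j ] = var z[ j ]

x↔y-involutive : ∀ P → P [ x↔y ] [ x↔y ] ≡ P
x↔y-involutive P = trans ([]-∘ {ρ = var} (λ { x[ j ] → refl ; y[ j ] → refl ; z[ j ] → refl }) P) ([]-var P)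

-- Exchanging the alphabets x and y turns the factor into x_i - x_{i+1}.
*-cancelˡ-δʸ : ∀ i P Q → δʸ i * P ≈ δʸ i * Q → P ≈ Q
*-cancelˡ-δʸ i P Q eq = begin
  P                   ≡⟨ x↔y-involutive P ⟨
  P [ x↔y ] [ x↔y ]   ≈⟨ []-cong x↔y (*-cancelʳ-xᵢ-xᵢ₊₁ i _ _ (≈-trans (*-comm _ _) (≈-trans ([]-cong x↔y eq) (*-comm _ _)))) ⟩
  Q [ x↔y ] [ x↔y ]   ≡⟨ x↔y-involutive Q ⟩
  Q ∎

-- Products over diagrams of boxes

prod : (ℕ → Poly) → ℕ → Poly
prod f zero    = 1ₚ
prod f (suc n) = prod f n * f n

∏-upTo : ∀ f n → ∏ (map f (upTo n)) ≈ prod f n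
∏-upTo f zero    = ≈-refl
∏-upTo f (suc n) = begin
  ∏ (map f (upTo (suc n)))        ≡⟨ cong (∏ ∘ map f) (upTo-∷ʳ n) ⟨
  ∏ (map f (upTo n ∷ʳ n))         ≡⟨ cong ∏ (map-++ f (upTo n) (n ∷ [])) ⟩
  ∏ (map f (upTo n) ∷ʳ f n)       ≈⟨ snoc (map f (upTo n)) ⟩
  ∏ (map f (upTo n)) * f n        ≈⟨ *-cong (∏-upTo f n) ≈-refl ⟩
  prod f n * f n                  ∎
  where
  snoc : ∀ Ps {Q} → ∏ (Ps ∷ʳ Q) ≈ ∏ Ps * Q
  snoc []       {Q} = *-comm Q 1ₚ
  snoc (P ∷ Ps) {Q} = ≈-trans (*-cong ≈-refl (snoc Ps)) (≈-sym (*-assoc P (∏ Ps) Q))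

prod-cong : ∀ {f g} n → (∀ {r} → r < n → f r ≈ g r) → prod f n ≈ prod g n
prod-cong zero    _ = ≈-refl
prod-cong (suc n) e = *-cong (prod-cong n (e ∘ m<n⇒m<1+n)) (e (n<1+n n))

prod-[] : ∀ f σ n → prod f n [ σ ] ≡ prod (λ r → f r [ σ ]) n
prod-[] f σ zero    = refl
prod-[] f σ (suc n) = cong (_* (f n [ σ ])) (prod-[] f σ n)

prod-trim : ∀ f n d → (∀ {r} → n ≤ r → f r ≈ 1ₚ) → prod f (d ℕ.+ n) ≈ prod f n
prod-trim f n zero    e = ≈-refl
prod-trim f n (suc d) e = ≈-trans (*-cong (prod-trim f n d e) (e (m≤n+m n d))) (≈-trans (*-comm _ _) (*-identityˡ _))

prod-factor : ∀ {f g P i} n → i < n → f i ≈ g i * P → (∀ {r} → r < n → r ≢ i → f r ≈ g r) →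
              prod f n ≈ prod g n * P
prod-factor {f} {g} {P} {i} (suc n) (s≤s i≤n) fi e with m≤n⇒m<n∨m≡n i≤n
... | inj₁ i<n = begin
  prod f n * f n        ≈⟨ *-cong (prod-factor n i<n fi (e ∘ m<n⇒m<1+n)) (e (n<1+n n) (>⇒≢ i<n)) ⟩
  prod g n * P * g n    ≈⟨ solve 3 (λ a b d → a :* b :* d := a :* d :* b) ≈-refl (prod g n) P (g n) ⟩
  prod g n * g n * P    ∎
... | inj₂ refl = begin
  prod f n * f n        ≈⟨ *-cong (prod-cong n λ r<n → e (m<n⇒m<1+n r<n) (<⇒≢ r<n)) fi ⟩
  prod g n * (g n * P)  ≈⟨ *-assoc (prod g n) (g n) P ⟨
  prod g n * g n * P    ∎

prod-swap : ∀ {f g i} n → suc i < n → f i ≈ g (suc i) → f (suc i) ≈ g i →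
            (∀ {r} → r < n → r ≢ i → r ≢ suc i → f r ≈ g r) → prod f n ≈ prod g n
prod-swap {f} {g} {i} (suc n) (s≤s 1+i≤n) e₁ e₂ e with m≤n⇒m<n∨m≡n 1+i≤n
... | inj₁ 1+i<n = *-cong (prod-swap n 1+i<n e₁ e₂ (e ∘ m<n⇒m<1+n))
                          (e (n<1+n n) (>⇒≢ (<-trans (n<1+n i) 1+i<n)) (>⇒≢ 1+i<n))
... | inj₂ refl = begin
  prod f i * f i * f (suc i)  ≈⟨ *-cong (*-cong (prod-cong i λ r<i → e (m<n⇒m<1+n (m<n⇒m<1+n r<i)) (<⇒≢ r<i) (<⇒≢ (m<n⇒m<1+n r<i))) e₁) e₂ ⟩
  prod g i * g (suc i) * g i  ≈⟨ solve 3 (λ a b d → a :* b :* d := a :* d :* b) ≈-refl (prod g i) (g (suc i)) (g i) ⟩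
  prod g i * g i * g (suc i)  ∎

box : ℕ → ℕ → Poly
box r j = var x[ r ] - var y[ j ]

row : ℕ → ℕ → Poly
row r m = prod (box r) m

-- For a weakly decreasing μ that vanishes from N on, this is the double Schubert polynomial of the
-- dominant permutation with code μ.
diagram : (ℕ → ℕ) → ℕ → Poly
diagram μ N = prod (λ r → row r (μ r)) N

diagram-cong : ∀ {μ ν} N → (∀ {r} → r < N → μ r ≡ ν r) → diagram μ N ≈ diagram ν N
diagram-cong N e = prod-cong N λ {r} r<N → ≡⇒≈ (cong (row r) (e r<N))

row-x-act : ∀ i r m → row r m [ s-act i ] ≡ row (s i ⟨$⟩ r) m
row-x-act i r m = prod-[] (box r) (s-act i) m

diagram-box : ∀ {μ ν i m} N → i < N → μ i ≡ suc m → ν i ≡ m → (∀ {r} → r ≢ i → μ r ≡ ν r) →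
              diagram μ N ≈ diagram ν N * box i m
diagram-box {μ} {ν} {i} {m} N i<N μi νi e = prod-factor N i<N
  (≡⇒≈ (trans (cong (row i) μi) (cong (λ k → row i k * box i m) (sym νi))))
  (λ {r} _ r≢i → ≡⇒≈ (cong (row r) (e r≢i)))

diagram-symmetric : ∀ {ν i} N → suc i < N → ν i ≡ ν (suc i) → diagram ν N [ s-act i ] ≈ diagram ν N
diagram-symmetric {ν} {i} N 1+i<N e = ≈-trans (≡⇒≈ (prod-[] (λ r → row r (ν r)) (s-act i) N)) (prod-swap N 1+i<N
  (≡⇒≈ (trans (row-x-act i i (ν i)) (cong₂ row (swapˡ i (suc i)) e)))
  (≡⇒≈ (trans (row-x-act i (suc i) (ν (suc i))) (cong₂ row (swapʳ i (suc i)) (sym e))))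
  (λ {r} _ r≢i r≢1+i → ≡⇒≈ (trans (row-x-act i r (ν r)) (cong (λ r′ → row r′ (ν r)) (swap-other i (suc i) r≢i r≢1+i)))))

∂-box : ∀ i m {S} → S [ s-act i ] ≈ S → ∂ i (S * box i m) ≈ S
∂-box i m {S} inv = ≈-sym (∂-unique i (S * box i m) S (begin
  S * δ i
    ≈⟨ solve 4 (λ s a b y → s :* (a :- b) := s :* (a :- y) :- s :* (b :- y)) ≈-refl S (var x[ i ]) (var x[ suc i ]) (var y[ m ]) ⟩
  S * box i m - S * box (suc i) m
    ≈⟨ +-cong ≈-refl (-‿cong (*-cong (≈-sym inv) (≡⇒≈ (cong (λ r → box r m) (sym (swapˡ i (suc i))))))) ⟩
  S * box i m - S [ s-act i ] * box i m [ s-act i ] ∎))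

-- Row i has one box more than row i + 1. Without this box the product is symmetric in x_i and
-- x_{i+1}, and the divided difference sends the box itself to 1.
∂-diagram : ∀ {μ ν i m} N → suc i < N → μ i ≡ suc m → ν i ≡ m → ν (suc i) ≡ m →
            (∀ {r} → r ≢ i → μ r ≡ ν r) → ∂ i (diagram μ N) ≈ diagram ν N
∂-diagram {μ} {ν} {i} {m} N 1+i<N μi νi ν1+i e = ≈-trans
  (∂-cong i (diagram-box N (<-trans (n<1+n i) 1+i<N) μi νi e))
  (∂-box i m {diagram ν N} (diagram-symmetric N 1+i<N (trans νi (sym ν1+i))))

-- The row contains both of the columns i and i + 1, or neither.
row-y-symmetric : ∀ i r m → suc i < m ⊎ m ≤ i → row r m [ y-act i ] ≈ row r m
row-y-symmetric i r m (inj₁ 1+i<m) = ≈-trans (≡⇒≈ (prod-[] (box r) (y-act i) m)) (prod-swap m 1+i<m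
  (≡⇒≈ (cong (box r) (swapˡ i (suc i)))) (≡⇒≈ (cong (box r) (swapʳ i (suc i))))
  (λ _ j≢i j≢1+i → ≡⇒≈ (cong (box r) (swap-other i (suc i) j≢i j≢1+i))))
row-y-symmetric i r m (inj₂ m≤i) = ≈-trans (≡⇒≈ (prod-[] (box r) (y-act i) m)) (prod-cong m
  (λ j<m → ≡⇒≈ (cong (box r) (swap-other i (suc i) (<⇒≢ (<-≤-trans j<m m≤i)) (<⇒≢ (m<n⇒m<1+n (<-≤-trans j<m m≤i)))))))

-- The d further rows are empty; they supply the row i + 1 that the action of s_i on row i requires.
𝔖w₀-diagram : ∀ n d → 𝔖w₀ n ≈ diagram (n ∸_) (d ℕ.+ n)
𝔖w₀-diagram n d = begin
  𝔖w₀ n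
    ≈⟨ ∏-upTo _ n ⟩
  prod (λ r → ∏ (map (box r) (upTo (n ∸ r)))) n
    ≈⟨ prod-cong n (λ {r} _ → ∏-upTo (box r) (n ∸ r)) ⟩
  diagram (n ∸_) n
    ≈⟨ prod-trim (λ r → row r (n ∸ r)) n d (λ {r} n≤r → ≡⇒≈ (cong (row r) (m≤n⇒m∸n≡0 n≤r))) ⟨
  diagram (n ∸_) (d ℕ.+ n) ∎

reversal-≤ : ∀ {n i} → i ≤ n → reversal n i ≡ n ∸ i
reversal-≤ {n} {i} i≤n with i ℕ.≤? n
... | yes _   = refl
... | no i≰n  = contradiction i≤n i≰n

reversal-anti : ∀ {n i j} → i < j → j ≤ n → reversal n j < reversal n i
reversal-anti {n} i<j j≤n = subst₂ _<_ (sym (reversal-≤ j≤n)) (sym (reversal-≤ (≤-trans (<⇒≤ i<j) j≤n)))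
  (∸-monoʳ-< i<j j≤n)

swap-comm : ∀ a b e → swap a b e ≡ swap b a e
swap-comm a b e = go (e ℕ.≟ a) (e ℕ.≟ b)
  where
  go : Dec (e ≡ a) → Dec (e ≡ b) → swap a b e ≡ swap b a e
  go (yes refl) _         = trans (swapˡ a b) (sym (swapʳ b a))
  go (no _)  (yes refl)   = trans (swapʳ a b) (sym (swapˡ b a))
  go (no ≢a) (no ≢b)      = trans (swap-other a b ≢a ≢b) (sym (swap-other b a ≢b ≢a))

-- u belongs to S_{n+1}.
FixesAbove : ℕ → S∞ → Set
FixesAbove n u = ∀ {j} → n < j → u ⟨$⟩ j ≡ j

bound-fixes : ∀ u {n} → bound u ≤ n → FixesAbove n u
bound-fixes u b≤n n<j = fixed u _ (≤-trans b≤n (<⇒≤ n<j))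

fixes-mono : ∀ u {m n} → m ≤ n → FixesAbove m u → FixesAbove n u
fixes-mono u m≤n f n<j = f (≤-<-trans m≤n n<j)

fixes-⁻¹ : ∀ u {n} → FixesAbove n u → FixesAbove n (u ⁻¹)
fixes-⁻¹ u f n<j = ⁻¹-≡ u (f n<j)

fixes-≤ : ∀ u {n i} → FixesAbove n u → i ≤ n → u ⟨$⟩ i ≤ n
fixes-≤ u {n} {i} f i≤n = ≮⇒≥ λ n<ui → <⇒≱ n<ui (subst (_≤ n) (sym (⟨$⟩-injective u (f n<ui))) i≤n)

-- Double Schubert polynomials

𝔖ₙ : ℕ → S∞ → Poly
𝔖ₙ n u = ∂^ (u ⁻¹ · w₀ n) (𝔖w₀ n)

-- Row r of shape j has length n - r for r < j and n + 1 - r otherwise: the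
-- diagrams between those of 𝔖w₀ (n + 1) and 𝔖w₀ n.
module Staircase (n : ℕ) where

  shape : ℕ → ℕ → ℕ
  shape j r with r ℕ.<? j
  ... | yes _ = n ∸ r
  ... | no _  = suc n ∸ r

  shape-< : ∀ {j r} → r < j → shape j r ≡ n ∸ r
  shape-< {j} {r} r<j with r ℕ.<? j
  ... | yes _  = refl
  ... | no r≮j = contradiction r<j r≮j

  shape-≥ : ∀ {j r} → j ≤ r → shape j r ≡ suc n ∸ r
  shape-≥ {j} {r} j≤r with r ℕ.<? j
  ... | yes r<j = contradiction j≤r (<⇒≱ r<j)
  ... | no _    = refl

  shape-other : ∀ {j r} → r ≢ j → shape j r ≡ shape (suc j) r
  shape-other r≢j with ≢⇒<⊎> r≢j
  ... | inj₁ r<j = trans (shape-< r<j) (sym (shape-< (m<n⇒m<1+n r<j)))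
  ... | inj₂ j<r = trans (shape-≥ (<⇒≤ j<r)) (sym (shape-≥ j<r))

  -- The operator `∂ n` needs row n + 1 besides row n; all rows from n + 1 on are empty.
  N = suc (suc (suc n))

  shape-step : ∀ {j} → j ≤ n → ∂ j (diagram (shape j) N) ≈ diagram (shape (suc j)) N
  shape-step {j} j≤n = ∂-diagram N (s≤s (s≤s (m≤n⇒m≤1+n j≤n)))
    (trans (shape-≥ {j} ≤-refl) (+-∸-assoc 1 j≤n))
    (shape-< (n<1+n j)) (shape-≥ {suc j} ≤-refl) shape-other

  shape-start : 𝔖w₀ (suc n) ≈ diagram (shape 0) N
  shape-start = ≈-trans (𝔖w₀-diagram (suc n) 2) (diagram-cong N λ {r} _ → sym (shape-≥ {0} {r} z≤n))

  shape-end : diagram (shape (suc n)) N ≈ 𝔖w₀ n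
  shape-end = ≈-trans (diagram-cong N shapes) (≈-sym (𝔖w₀-diagram n 3))
    where
    shapes : ∀ {r} → r < N → shape (suc n) r ≡ n ∸ r
    shapes {r} _ with <-≤-connex r (suc n)
    ... | inj₁ r<1+n = shape-< r<1+n
    ... | inj₂ 1+n≤r = trans (shape-≥ 1+n≤r) (trans (m≤n⇒m∸n≡0 1+n≤r) (sym (m≤n⇒m∸n≡0 (<⇒≤ 1+n≤r))))

  -- The product of the d factors s_n, s_{n-1}, and so on downwards: it sends n + 1 - d to n + 1 and
  -- lowers the following positions up to n + 1 by one. All n + 1 factors lead from `w₀ n` to
  -- `w₀ (suc n)`, and cancelling the last factor will match the removal of a box by a divided
  -- difference.
  tail-cycle : ℕ → S∞
  tail-cycle zero    = ι
  tail-cycle (suc d) = tail-cycle d · s (n ∸ d)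

  tail-fix : ∀ d {r} → r ℕ.+ d ≤ n → tail-cycle d ⟨$⟩ r ≡ r
  tail-fix zero _ = refl
  tail-fix (suc d) {r} le = trans (cong (tail-cycle d ⟨$⟩_) (swap-other (n ∸ d) (suc (n ∸ d)) (<⇒≢ r<n∸d) (<⇒≢ (m<n⇒m<1+n r<n∸d))))
    (tail-fix d (<⇒≤ lt))
    where
    lt : r ℕ.+ d < n
    lt = subst (_≤ n) (+-suc r d) le
    r<n∸d : r < n ∸ d
    r<n∸d = m+n≤o⇒m≤o∸n (suc r) lt

  tail-top : ∀ d → d ≤ suc n → tail-cycle d ⟨$⟩ (suc n ∸ d) ≡ suc n
  tail-top zero _ = refl
  tail-top (suc d) (s≤s d≤n) = trans (cong (tail-cycle d ⟨$⟩_) (trans (swapˡ (n ∸ d) (suc (n ∸ d))) (sym (+-∸-assoc 1 d≤n))))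
    (tail-top d (m≤n⇒m≤1+n d≤n))

  tail-shift : ∀ d {r} → d ≤ suc n → suc n ≤ d ℕ.+ r → r ≤ n → tail-cycle d ⟨$⟩ suc r ≡ r
  tail-shift zero _ le r≤n = contradiction le (<⇒≱ (s≤s r≤n))
  tail-shift (suc d) {r} (s≤s d≤n) le r≤n with m≤n⇒m<n∨m≡n (ℕ.s≤s⁻¹ le)
  ... | inj₁ lt = trans (cong (tail-cycle d ⟨$⟩_) (swap-other (n ∸ d) (suc (n ∸ d)) (>⇒≢ (m<n⇒m<1+n n∸d<r)) (>⇒≢ (s≤s n∸d<r))))
                    (tail-shift d (m≤n⇒m≤1+n d≤n) lt r≤n)
    where
    n∸d<r : n ∸ d < r
    n∸d<r = subst (_≤ r) (+-∸-assoc 1 d≤n) (m≤n+o⇒m∸n≤o (suc n) d lt)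
  ... | inj₂ n≡d+r = trans (cong (tail-cycle d ⟨$⟩_) (trans (cong (λ m → swap m (suc m) (suc r)) n∸d≡r) (swapʳ r (suc r))))
                       (tail-fix d (≤-reflexive (trans (ℕₚ.+-comm r d) (sym n≡d+r))))
    where
    n∸d≡r : n ∸ d ≡ r
    n∸d≡r = trans (cong (_∸ d) n≡d+r) (m+n∸m≡n d r)

  tail-above : ∀ d {r} → suc n < r → tail-cycle d ⟨$⟩ r ≡ r
  tail-above zero _ = refl
  tail-above (suc d) {r} lt = trans (cong (tail-cycle d ⟨$⟩_) (swap-other (n ∸ d) (suc (n ∸ d))
    (>⇒≢ (≤-<-trans (m∸n≤m n d) (<⇒≤ lt))) (>⇒≢ (≤-<-trans (s≤s (m∸n≤m n d)) lt)))) (tail-above d lt)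

  tail-step : ∀ {i} → i ≤ n → ∀ e → tail-cycle (suc n ∸ i) ⟨$⟩ e ≡ tail-cycle (n ∸ i) ⟨$⟩ (s i ⟨$⟩ e)
  tail-step {i} i≤n e = trans (cong (λ d → tail-cycle d ⟨$⟩ e) (+-∸-assoc 1 i≤n))
    (cong (λ m → tail-cycle (n ∸ i) ⟨$⟩ (s m ⟨$⟩ e)) (m∸[m∸n]≡n i≤n))

  tail-at : ∀ {i} → i ≤ n → tail-cycle (n ∸ i) ⟨$⟩ i ≡ i
  tail-at {i} i≤n = tail-fix (n ∸ i) (≤-reflexive (m+[n∸m]≡n i≤n))

  tail-next : ∀ {i} → i ≤ n → tail-cycle (n ∸ i) ⟨$⟩ suc i ≡ suc n
  tail-next {i} i≤n = trans (cong (tail-cycle (n ∸ i) ⟨$⟩_) (sym (trans (+-∸-assoc 1 (m∸n≤m n i)) (cong suc (m∸[m∸n]≡n i≤n)))))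
    (tail-top (n ∸ i) (m≤n⇒m≤1+n (m∸n≤m n i)))

  w₀-tail : w₀ n · tail-cycle (suc n) ≋ w₀ (suc n)
  w₀-tail zero = trans (cong (w₀ n ⟨$⟩_) (trans (cong (tail-cycle (suc n) ⟨$⟩_) (sym (n∸n≡0 n))) (tail-top (suc n) ≤-refl)))
    (trans (reversal-fixed n (suc n) ≤-refl) (sym (reversal-≤ {suc n} {0} z≤n)))
  w₀-tail (suc r) with ≤-<-connex r n
  ... | inj₁ r≤n = trans (cong (w₀ n ⟨$⟩_) (tail-shift (suc n) ≤-refl (m≤m+n (suc n) r) r≤n))
                     (trans (reversal-≤ r≤n) (sym (reversal-≤ (s≤s r≤n))))
  ... | inj₂ n<r = trans (cong (w₀ n ⟨$⟩_) (tail-above (suc n) (s≤s n<r)))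
                     (trans (reversal-fixed n (suc r) (m<n⇒m<1+n n<r)) (sym (reversal-fixed (suc n) (suc r) (s≤s n<r))))

  tail-s : ∀ {i} → i ≤ n → ∀ e → tail-cycle (suc n ∸ i) ⟨$⟩ (s i ⟨$⟩ e) ≡ tail-cycle (n ∸ i) ⟨$⟩ e
  tail-s {i} i≤n e = trans (tail-step i≤n (s i ⟨$⟩ e)) (cong (tail-cycle (n ∸ i) ⟨$⟩_) (swap-involutive i (suc i) e))

  tail-high : ∀ {i} → i ≤ n → tail-cycle (suc n ∸ i) ⟨$⟩ i ≡ suc n
  tail-high {i} i≤n = trans (tail-step i≤n i) (trans (cong (tail-cycle (n ∸ i) ⟨$⟩_) (swapˡ i (suc i))) (tail-next i≤n))

  tail-low : ∀ {i} → i ≤ n → tail-cycle (suc n ∸ i) ⟨$⟩ suc i ≡ i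
  tail-low {i} i≤n = trans (tail-step i≤n (suc i)) (trans (cong (tail-cycle (n ∸ i) ⟨$⟩_) (swapʳ i (suc i))) (tail-at i≤n))

module Stability (n : ℕ) (u : S∞) (f : FixesAbove n u) where

  open Staircase n

  path : ℕ → S∞
  path j = u ⁻¹ · w₀ n · tail-cycle (suc n ∸ j)

  path-descent : ∀ {j} → j ≤ n → path j ⟨$⟩ suc j < path j ⟨$⟩ j
  path-descent {j} j≤n = subst₂ _<_
    (sym (cong (λ e → u ⁻¹ ⟨$⟩ reversal n e) (tail-low j≤n)))
    (sym (trans (cong (λ e → u ⁻¹ ⟨$⟩ reversal n e) (tail-high j≤n))
      (trans (cong (u ⁻¹ ⟨$⟩_) (reversal-fixed n (suc n) ≤-refl)) (fixes-⁻¹ u f (n<1+n n)))))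
    (s≤s (fixes-≤ (u ⁻¹) (fixes-⁻¹ u f) (subst (_≤ n) (sym (reversal-≤ j≤n)) (m∸n≤m n j))))

  -- Interpolates between the levels n + 1 and n. The permutation `path j` has a descent at j, so
  -- the divided difference at j can be applied first, where it removes one box from the diagram;
  -- what remains is the operator of `path (suc j)`.
  along : ∀ j → j ≤ suc n → 𝔖ₙ (suc n) u ≈ ∂^ (path j) (diagram (shape j) N)
  along zero _ = ≈-trans (∂^-≋ (u ⁻¹ · w₀ (suc n)) (path 0) (λ e → cong (u ⁻¹ ⟨$⟩_) (sym (w₀-tail e))) (𝔖w₀ (suc n)))
    (∂^-cong (path 0) shape-start)
  along (suc j) (s≤s j≤n) = begin
    𝔖ₙ (suc n) u                                        ≈⟨ along j (m≤n⇒m≤1+n j≤n) ⟩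
    ∂^ (path j) (diagram (shape j) N)                   ≈⟨ ∂^-∂ (path j) j (path-descent j≤n) (diagram (shape j) N) ⟨
    ∂^ (path j · s j) (∂ j (diagram (shape j) N))       ≈⟨ ∂^-cong (path j · s j) (shape-step j≤n) ⟩
    ∂^ (path j · s j) (diagram (shape (suc j)) N)
      ≈⟨ ∂^-≋ (path j · s j) (path (suc j)) (λ e → cong (λ e → u ⁻¹ ⟨$⟩ reversal n e) (tail-s j≤n e)) (diagram (shape (suc j)) N) ⟩
    ∂^ (path (suc j)) (diagram (shape (suc j)) N)       ∎

  stable : 𝔖ₙ (suc n) u ≈ 𝔖ₙ n u
  stable = begin
    𝔖ₙ (suc n) u                                        ≈⟨ along (suc n) ≤-refl ⟩
    ∂^ (path (suc n)) (diagram (shape (suc n)) N)       ≈⟨ ∂^-cong (path (suc n)) shape-end ⟩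
    ∂^ (path (suc n)) (𝔖w₀ n)
      ≈⟨ ∂^-≋ (path (suc n)) (u ⁻¹ · w₀ n) (λ e → cong (λ d → u ⁻¹ ⟨$⟩ (w₀ n ⟨$⟩ (tail-cycle d ⟨$⟩ e))) (n∸n≡0 n)) (𝔖w₀ n) ⟩
    𝔖ₙ n u                                              ∎

𝔖ₙ-stable : ∀ {n} d u → FixesAbove n u → 𝔖ₙ (d ℕ.+ n) u ≈ 𝔖ₙ n u
𝔖ₙ-stable zero u f = ≈-refl
𝔖ₙ-stable {n} (suc d) u f = ≈-trans (Stability.stable (d ℕ.+ n) u (fixes-mono u (m≤n+m n d) f)) (𝔖ₙ-stable d u f)

𝔖-level : ∀ n u → FixesAbove n u → 𝔖 u ≈ 𝔖ₙ n u
𝔖-level n u f = begin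
  𝔖 u                    ≈⟨ 𝔖ₙ-stable n u (bound-fixes u ≤-refl) ⟨
  𝔖ₙ (n ℕ.+ bound u) u   ≡⟨ cong (λ m → 𝔖ₙ m u) (ℕₚ.+-comm n (bound u)) ⟩
  𝔖ₙ (bound u ℕ.+ n) u   ≈⟨ 𝔖ₙ-stable (bound u) u f ⟩
  𝔖ₙ n u                 ∎

𝔖-≋ : ∀ u v → u ≋ v → 𝔖 u ≈ 𝔖 v
𝔖-≋ u v e = begin
  𝔖 u                ≈⟨ 𝔖-level n u (bound-fixes u (m≤m⊔n (bound u) (bound v))) ⟩
  𝔖ₙ n u             ≈⟨ ∂^-≋ (u ⁻¹ · w₀ n) (v ⁻¹ · w₀ n) (λ i → ⁻¹-cong u v e (w₀ n ⟨$⟩ i)) (𝔖w₀ n) ⟩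
  𝔖ₙ n v             ≈⟨ 𝔖-level n v (bound-fixes v (m≤n⊔m (bound u) (bound v))) ⟨
  𝔖 v                ∎
  where n = bound u ⊔ bound v

private
  level : ∀ u i → ∃[ n ] bound u ≤ n × suc i ≤ n
  level u i = bound u ⊔ suc i , m≤m⊔n (bound u) (suc i) , m≤n⊔m (bound u) (suc i)

∂-𝔖-descent : ∀ u i → u ⟨$⟩ suc i < u ⟨$⟩ i → ∂ i (𝔖 u) ≈ 𝔖 (u · s i)
∂-𝔖-descent u i d = begin
  ∂ i (𝔖 u)                     ≈⟨ ∂-cong i (𝔖-level n u fu) ⟩
  ∂ i (∂^ (u ⁻¹ · w₀ n) (𝔖w₀ n)) ≈⟨ ∂-cong i (∂^-≋ (u ⁻¹ · w₀ n) (s i · v) (λ j → sym (swap-involutive i (suc i) (u ⁻¹ ⟨$⟩ (w₀ n ⟨$⟩ j)))) (𝔖w₀ n)) ⟩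
  ∂ i (∂^ (s i · v) (𝔖w₀ n))    ≈⟨ ∂-∂^ i v ld (𝔖w₀ n) ⟩
  𝔖ₙ n (u · s i)                ≈⟨ 𝔖-level n (u · s i) fus ⟨
  𝔖 (u · s i)                   ∎
  where
  n = proj₁ (level u i)
  1+i≤n = proj₂ (proj₂ (level u i))
  fu : FixesAbove n u
  fu = bound-fixes u (proj₁ (proj₂ (level u i)))
  fus : FixesAbove n (u · s i)
  fus n<j = trans (cong (u ⟨$⟩_) (swap-other i (suc i) (>⇒≢ (<-trans 1+i≤n n<j)) (>⇒≢ (≤-<-trans 1+i≤n n<j)))) (fu n<j)
  v = (u · s i) ⁻¹ · w₀ n
  at : ∀ j → v ⁻¹ ⟨$⟩ j ≡ reversal n (u ⟨$⟩ (s i ⟨$⟩ j))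
  at j = refl
  ld : LeftDescent i v
  ld = subst₂ _<_ (sym (cong (λ j → reversal n (u ⟨$⟩ j)) (swapʳ i (suc i)))) (sym (cong (λ j → reversal n (u ⟨$⟩ j)) (swapˡ i (suc i))))
    (reversal-anti d (fixes-≤ u fu (<⇒≤ 1+i≤n)))

∂-𝔖-ascent : ∀ u i → u ⟨$⟩ i < u ⟨$⟩ suc i → ∂ i (𝔖 u) ≈ 0ₚ
∂-𝔖-ascent u i a = ≈-trans (∂-cong i (𝔖-level n u fu)) (∂-∂^-0 i (u ⁻¹ · w₀ n)
  (reversal-anti a (fixes-≤ u fu 1+i≤n)) (𝔖w₀ n))
  where
  n = proj₁ (level u i)
  1+i≤n = proj₂ (proj₂ (level u i))
  fu : FixesAbove n u
  fu = bound-fixes u (proj₁ (proj₂ (level u i)))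

-- The action of s_i on y is a left divided difference; on 𝔖_{w₀} it is
-- visible because column i has exactly one box more than column i + 1.
module _ (i n : ℕ) (i<n : i < n) where

  private
    -- The row whose last box lies in column i. Longer rows contain both of the columns i and i + 1,
    -- shorter ones neither, so the product becomes symmetric in y_i and y_{i+1} once this box is
    -- removed; ν is the shape without it.
    r = n ∸ suc i
    r+1+i≡n : r ℕ.+ suc i ≡ n
    r+1+i≡n = m∸n+n≡m i<n
    n∸r : n ∸ r ≡ suc i
    n∸r = m∸[m∸n]≡n i<n
    n∸1+r : n ∸ suc r ≡ i
    n∸1+r = trans (sym (pred[m∸n]≡m∸[1+n] n r)) (cong ℕ.pred n∸r)
    r<n : r < n
    r<n = subst (r <_) r+1+i≡n (m<m+n r (s≤s z≤n))
    ν : ℕ → ℕ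
    ν j with j ℕ.≟ r
    ... | yes _ = i
    ... | no _  = n ∸ j
    ν-r : ν r ≡ i
    ν-r with r ℕ.≟ r
    ... | yes _ = refl
    ... | no ne = contradiction refl ne
    ν-other : ∀ {j} → j ≢ r → ν j ≡ n ∸ j
    ν-other {j} ne with j ℕ.≟ r
    ... | yes e = contradiction e ne
    ... | no _  = refl
    S = diagram ν (suc n)
    S-box : 𝔖w₀ n ≈ S * box r i
    S-box = ≈-trans (𝔖w₀-diagram n 1) (diagram-box (suc n) (m<n⇒m<1+n r<n) n∸r ν-r (λ ne → sym (ν-other ne)))
    ∂-S : ∂ r (𝔖w₀ n) ≈ S
    ∂-S = ≈-trans (∂-cong r (𝔖w₀-diagram n 1)) (∂-diagram (suc n) (s≤s r<n) n∸r ν-r (trans (ν-other 1+n≢n) n∸1+r) (λ ne → sym (ν-other ne)))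
    row-case : ∀ j → suc i < ν j ⊎ ν j ≤ i
    row-case j with <-cmp j r
    ... | tri< j<r j≢r _ = inj₁ (subst₂ _<_ n∸r (sym (ν-other j≢r)) (∸-monoʳ-< j<r (<⇒≤ r<n)))
    ... | tri≈ _ refl _ = inj₂ (≤-reflexive ν-r)
    ... | tri> _ j≢r r<j = inj₂ (subst₂ _≤_ (sym (ν-other j≢r)) n∸1+r (∸-monoʳ-≤ n r<j))
    S-y : S [ y-act i ] ≈ S
    S-y = ≈-trans (≡⇒≈ (prod-[] (λ j → row j (ν j)) (y-act i) (suc n))) (prod-cong (suc n) λ {j} _ → row-y-symmetric i j (ν j) (row-case j))

  𝔖w₀-y-act : 𝔖w₀ n [ y-act i ] ≈ 𝔖w₀ n + δʸ i * ∂ (n ∸ suc i) (𝔖w₀ n)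
  𝔖w₀-y-act = begin
    𝔖w₀ n [ y-act i ]              ≈⟨ []-cong (y-act i) S-box ⟩
    S [ y-act i ] * box r (s i ⟨$⟩ i)  ≈⟨ *-cong S-y (≡⇒≈ (cong (box r) (swapˡ i (suc i)))) ⟩
    S * box r (suc i)              ≈⟨ solve 4 (λ s x y y′ → s :* (x :- y′) := s :* (x :- y) :+ (y :- y′) :* s) ≈-refl S (var x[ r ]) (var y[ i ]) (var y[ suc i ]) ⟩
    S * box r i + δʸ i * S         ≈⟨ +-cong (≈-sym S-box) (*-cong ≈-refl (≈-sym ∂-S)) ⟩
    𝔖w₀ n + δʸ i * ∂ r (𝔖w₀ n)     ∎

  w₀-at : w₀ n ⟨$⟩ r ≡ suc i
  w₀-at = trans (reversal-≤ (m∸n≤m n (suc i))) n∸r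

  w₀-next : w₀ n ⟨$⟩ suc r ≡ i
  w₀-next = trans (reversal-≤ r<n) n∸1+r

  w₀-s : ∀ j → w₀ n ⟨$⟩ (s r ⟨$⟩ j) ≡ s i ⟨$⟩ (w₀ n ⟨$⟩ j)
  w₀-s j = trans (⟨$⟩-swap (w₀ n) r (suc r) j) (trans (cong₂ (λ a b → swap a b (w₀ n ⟨$⟩ j)) w₀-at w₀-next) (swap-comm (suc i) i (w₀ n ⟨$⟩ j)))

module _ (i : ℕ) (w : S∞) where

  private
    n = proj₁ (level w i)
    i<n = proj₂ (proj₂ (level w i))
    fw : FixesAbove n w
    fw = bound-fixes w (proj₁ (proj₂ (level w i)))
    r = n ∸ suc i
    u = w ⁻¹ · w₀ n

    -- Divided differences in x commute with the exchange of y variables and are linear over the y.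
    -- What is left to evaluate is ∂^u ∂_r, which is the operator of u s_r or zero according to
    -- whether s_r lengthens u; and u s_r belongs to s_i w, as w₀ conjugates s_r to s_i.
    expand : 𝔖 w [ y-act i ] ≈ 𝔖 w + δʸ i * ∂^ u (∂ r (𝔖w₀ n))
    expand = begin
      𝔖 w [ y-act i ]                   ≈⟨ []-cong (y-act i) (𝔖-level n w fw) ⟩
      ∂^ u (𝔖w₀ n) [ y-act i ]          ≈⟨ ∂^-[] u (y-act i) (λ { i x[ j ] → ≈-refl ; i y[ j ] → ≈-refl ; i z[ j ] → ≈-refl }) (λ _ → ≈-refl) (𝔖w₀ n) ⟩
      ∂^ u (𝔖w₀ n [ y-act i ])          ≈⟨ ∂^-cong u (𝔖w₀-y-act i n i<n) ⟩
      ∂^ u (𝔖w₀ n + δʸ i * ∂ r (𝔖w₀ n)) ≈⟨ ∂^-+ u (𝔖w₀ n) (δʸ i * ∂ r (𝔖w₀ n)) ⟩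
      ∂^ u (𝔖w₀ n) + ∂^ u (δʸ i * ∂ r (𝔖w₀ n))
        ≈⟨ +-cong (≈-sym (𝔖-level n w fw)) (∂^-* u (∂ r (𝔖w₀ n)) (λ _ → ≈-refl)) ⟩
      𝔖 w + δʸ i * ∂^ u (∂ r (𝔖w₀ n))   ∎

  𝔖-y-act-descent : LeftDescent i w → 𝔖 w [ y-act i ] ≈ 𝔖 w + δʸ i * 𝔖 (s i · w)
  𝔖-y-act-descent d = ≈-trans expand (+-cong ≈-refl (*-cong ≈-refl (begin
    ∂^ u (∂ r (𝔖w₀ n))               ≈⟨ ∂^-≋ u (u · s r · s r) (λ j → sym (t-involutive u r (suc r) j)) (∂ r (𝔖w₀ n)) ⟩
    ∂^ (u · s r · s r) (∂ r (𝔖w₀ n)) ≈⟨ ∂^-∂ (u · s r) r desc (𝔖w₀ n) ⟩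
    ∂^ (u · s r) (𝔖w₀ n)             ≈⟨ ∂^-≋ (u · s r) ((s i · w) ⁻¹ · w₀ n) (λ j → cong (w ⁻¹ ⟨$⟩_) (w₀-s i n i<n j)) (𝔖w₀ n) ⟩
    𝔖ₙ n (s i · w)                   ≈⟨ 𝔖-level n (s i · w) (λ n<j → trans (cong (s i ⟨$⟩_) (fw n<j))
                                          (swap-other i (suc i) (>⇒≢ (<-trans i<n n<j)) (>⇒≢ (≤-<-trans i<n n<j)))) ⟨
    𝔖 (s i · w)                      ∎)))
    where
    desc : (u · s r) ⟨$⟩ suc r < (u · s r) ⟨$⟩ r
    desc = subst₂ _<_ (sym (trans (cong (u ⟨$⟩_) (swapʳ r (suc r))) (cong (w ⁻¹ ⟨$⟩_) (w₀-at i n i<n))))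
                      (sym (trans (cong (u ⟨$⟩_) (swapˡ r (suc r))) (cong (w ⁻¹ ⟨$⟩_) (w₀-next i n i<n)))) d

  𝔖-y-act-ascent : w ⁻¹ ⟨$⟩ i < w ⁻¹ ⟨$⟩ suc i → 𝔖 w [ y-act i ] ≈ 𝔖 w
  𝔖-y-act-ascent a = begin
    𝔖 w [ y-act i ]                   ≈⟨ expand ⟩
    𝔖 w + δʸ i * ∂^ u (∂ r (𝔖w₀ n))   ≈⟨ +-cong ≈-refl (*-cong ≈-refl (∂^-∂-0 u r desc (𝔖w₀ n))) ⟩
    𝔖 w + δʸ i * 0ₚ                   ≈⟨ solve 2 (λ p d → p :+ d :* :con (+ 0) := p) ≈-refl (𝔖 w) (δʸ i) ⟩
    𝔖 w                               ∎
    where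
    desc : u ⟨$⟩ suc r < u ⟨$⟩ r
    desc = subst₂ _<_ (sym (cong (w ⁻¹ ⟨$⟩_) (w₀-next i n i<n))) (sym (cong (w ⁻¹ ⟨$⟩_) (w₀-at i n i<n))) a

-- The permutations `c p k` as cycles

cycle : ℕ → ℕ → S∞
cycle q zero    = ι
cycle q (suc p) = cycle q p · s (q ℕ.+ p)

∏ₛ-∷ʳ : ∀ us v → ∏ₛ (us ∷ʳ v) ≋ ∏ₛ us · v
∏ₛ-∷ʳ []       v i = refl
∏ₛ-∷ʳ (u ∷ us) v i = cong (u ⟨$⟩_) (∏ₛ-∷ʳ us v i)

c≋cycle : ∀ p k → c p k ≋ cycle (k ∸ p) p
c≋cycle p k = go p
  where
  q = k ∸ p
  factor = λ j → s (q ℕ.+ j)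
  go : ∀ m → ∏ₛ (map factor (upTo m)) ≋ cycle q m
  go zero    i = refl
  go (suc m) i = trans (cong (λ l → ∏ₛ (map factor l) ⟨$⟩ i) (sym (upTo-∷ʳ m)))
    (trans (cong (λ l → ∏ₛ l ⟨$⟩ i) (map-++ factor (upTo m) (m ∷ [])))
    (trans (∏ₛ-∷ʳ (map factor (upTo m)) (factor m) i) (go m (factor m ⟨$⟩ i))))

module _ (q : ℕ) where

  cycle-below : ∀ p {r} → r < q → cycle q p ⟨$⟩ r ≡ r
  cycle-below zero _ = refl
  cycle-below (suc p) r<q = trans (cong (cycle q p ⟨$⟩_) (swap-other (q ℕ.+ p) (suc (q ℕ.+ p))
    (<⇒≢ r<q+p) (<⇒≢ (m<n⇒m<1+n r<q+p)))) (cycle-below p r<q)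
    where r<q+p = <-≤-trans r<q (m≤m+n q p)

  cycle-above : ∀ p {r} → q ℕ.+ p < r → cycle q p ⟨$⟩ r ≡ r
  cycle-above zero _ = refl
  cycle-above (suc p) {r} lt = trans (cong (cycle q p ⟨$⟩_) (swap-other (q ℕ.+ p) (suc (q ℕ.+ p)) (>⇒≢ (<⇒≤ 1+q+p<r)) (>⇒≢ 1+q+p<r)))
    (cycle-above p (<⇒≤ 1+q+p<r))
    where
    1+q+p<r : suc (q ℕ.+ p) < r
    1+q+p<r = subst (_< r) (+-suc q p) lt

  cycle-end : ∀ p → cycle q p ⟨$⟩ (q ℕ.+ p) ≡ q
  cycle-end zero = +-identityʳ q
  cycle-end (suc p) = trans (cong (λ r → cycle q (suc p) ⟨$⟩ r) (+-suc q p))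
    (trans (cong (cycle q p ⟨$⟩_) (swapʳ (q ℕ.+ p) (suc (q ℕ.+ p)))) (cycle-end p))

  cycle-inside : ∀ p {r} → q ≤ r → r < q ℕ.+ p → cycle q p ⟨$⟩ r ≡ suc r
  cycle-inside zero {r} q≤r lt = contradiction q≤r (<⇒≱ (subst (r <_) (+-identityʳ q) lt))
  cycle-inside (suc p) {r} q≤r lt with m≤n⇒m<n∨m≡n (ℕ.s≤s⁻¹ (subst (r <_) (+-suc q p) lt))
  ... | inj₁ r<q+p = trans (cong (cycle q p ⟨$⟩_) (swap-other (q ℕ.+ p) (suc (q ℕ.+ p)) (<⇒≢ r<q+p) (<⇒≢ (m<n⇒m<1+n r<q+p))))
                       (cycle-inside p q≤r r<q+p)
  ... | inj₂ refl  = trans (cong (cycle q p ⟨$⟩_) (swapˡ (q ℕ.+ p) (suc (q ℕ.+ p)))) (cycle-above p (n<1+n _))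

  -- The cycle takes the value q out of its place and puts it at position q + p; all other values
  -- keep their order.
  cycle-ascent : ∀ p {i} → suc i ≢ q ℕ.+ p → cycle q p ⟨$⟩ i < cycle q p ⟨$⟩ suc i
  cycle-ascent p {i} ne with <-cmp (suc i) (q ℕ.+ p) | <-cmp (suc i) q
  ... | tri≈ _ e _ | _ = contradiction e ne
  ... | tri< lt _ _ | tri< i<q _ _ = subst₂ _<_ (sym (cycle-below p (<⇒≤ i<q))) (sym (cycle-below p i<q)) (n<1+n i)
  ... | tri< lt _ _ | tri≈ _ refl _ = subst₂ _<_ (sym (cycle-below p (n<1+n i))) (sym (cycle-inside p ≤-refl lt)) (m<n⇒m<1+n (n<1+n i))
  ... | tri< lt _ _ | tri> _ _ q≤i = subst₂ _<_ (sym (cycle-inside p (ℕ.s≤s⁻¹ q≤i) (<⇒≤ lt))) (sym (cycle-inside p (<⇒≤ q≤i) lt)) (n<1+n _)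
  ... | tri> _ _ gt | _ = subst₂ _<_ refl (sym (cycle-above p gt)) (s≤s (at-i (m≤n⇒m<n∨m≡n (ℕ.s≤s⁻¹ gt))))
    where
    at-i : q ℕ.+ p < i ⊎ q ℕ.+ p ≡ i → cycle q p ⟨$⟩ i ≤ i
    at-i (inj₁ lt)   = ≤-reflexive (cycle-above p lt)
    at-i (inj₂ refl) = subst (_≤ q ℕ.+ p) (sym (cycle-end p)) (m≤m+n q p)

  cycle-descent : ∀ p → cycle q (suc p) ⟨$⟩ suc (q ℕ.+ p) < cycle q (suc p) ⟨$⟩ (q ℕ.+ p)
  cycle-descent p = subst₂ _<_ (sym (trans (cong (cycle q (suc p) ⟨$⟩_) (sym (+-suc q p))) (cycle-end (suc p))))
    (sym (cycle-inside (suc p) (m≤m+n q p) (+-monoʳ-< q (n<1+n p)))) (s≤s (m≤m+n q p))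

-- Factorial elementary symmetric polynomials of codegree j

elem : ℕ → ℕ → Poly
elem j m with j ℕ.≤? m
... | yes _ = 𝔖 (cycle j (m ∸ j)) [ y↦z ]
... | no _  = 0ₚ

elem-≤ : ∀ {j m} → j ≤ m → elem j m ≡ 𝔖 (cycle j (m ∸ j)) [ y↦z ]
elem-≤ {j} {m} j≤m with j ℕ.≤? m
... | yes _  = refl
... | no j≰m = contradiction j≤m j≰m

elem-> : ∀ {j m} → m < j → elem j m ≡ 0ₚ
elem-> {j} {m} m<j with j ℕ.≤? m
... | yes j≤m = contradiction m<j (≤⇒≯ j≤m)
... | no _    = refl

E≈elem : ∀ j m → E (+ m ℤ.- + j) (+ m) ≈ elem j m
E≈elem j m with ≤-<-connex j m
... | inj₁ j≤m = begin
  E (+ m ℤ.- + j) (+ m)                ≡⟨ cong (λ a → E a (+ m)) (trans (ℤₚ.m-n≡m⊖n m j) (ℤₚ.⊖-≥ j≤m)) ⟩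
  E (+ (m ∸ j)) (+ m)                  ≡⟨ cong (if_then 𝔖 (c (m ∸ j) m) [ y↦z ] else con (+ 0)) (dec-true (m ∸ j ℕ.≤? m) (m∸n≤m m j)) ⟩
  𝔖 (c (m ∸ j) m) [ y↦z ]              ≈⟨ []-cong y↦z (𝔖-≋ (c (m ∸ j) m) (cycle j (m ∸ j)) (λ i → trans (c≋cycle (m ∸ j) m i) (cong (λ q → cycle q (m ∸ j) ⟨$⟩ i) (m∸[m∸n]≡n j≤m)))) ⟩
  𝔖 (cycle j (m ∸ j)) [ y↦z ]          ≡⟨ elem-≤ j≤m ⟨
  elem j m                             ∎
... | inj₂ m<j = ≡⇒≈ (trans (trans (cong (λ a → E a (+ m)) (trans (ℤₚ.m-n≡m⊖n m j) (ℤₚ.⊖-< m<j))) (negative (m<n⇒0<n∸m m<j))) (sym (elem-> m<j)))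
  where
  negative : ∀ {n} → 0 < n → E (ℤ.- + n) (+ m) ≡ con (+ 0)
  negative {suc n} _ = refl

∂-y↦z : ∀ i P → ∂ i P [ y↦z ] ≈ ∂ i (P [ y↦z ])
∂-y↦z i P = ∂-[] i y↦z (λ { x[ j ] → ≈-refl ; y[ j ] → ≈-refl ; z[ j ] → ≈-refl }) ≈-refl ≈-refl P

-- The only possible descent of the cycle pairs the last variable with the first absent one; every
-- other divided difference vanishes.
elem-symmetric : ∀ j m {i} → suc i ≢ m → elem j m [ s-act i ] ≈ elem j m
elem-symmetric j m {i} ne with j ℕ.≤? m
... | no _    = ≈-refl
... | yes j≤m = ∂-0⁻ i {𝔖 (cycle j (m ∸ j)) [ y↦z ]} (≈-trans (≈-sym (∂-y↦z i (𝔖 (cycle j (m ∸ j)))))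
        ([]-cong y↦z (∂-𝔖-ascent (cycle j (m ∸ j)) i (cycle-ascent j (m ∸ j) (λ e → ne (trans e (m+[n∸m]≡n j≤m)))))))

-- Cancelling the last factor of the cycle leaves its first factor at j, so the divided difference
-- lowers degree and number of variables together and preserves the codegree. For j = m + 1 the
-- cycle is trivial and has no descent.
∂-elem : ∀ j m → ∂ m (elem j (suc m)) ≈ elem j m
∂-elem j m with <-cmp j (suc m)
... | tri> _ _ gt = ≈-trans (∂-cong m (≡⇒≈ (elem-> gt))) (≈-trans (∂-0 m {0ₚ} ≈-refl) (≡⇒≈ (sym (elem-> (<⇒≤ gt)))))
... | tri≈ _ refl _ = begin
  ∂ m (elem (suc m) (suc m))        ≡⟨ cong (∂ m) (elem-≤ {suc m} ≤-refl) ⟩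
  ∂ m (𝔖 (cycle (suc m) (m ∸ m)) [ y↦z ]) ≈⟨ ∂-y↦z m (𝔖 (cycle (suc m) (m ∸ m))) ⟨
  ∂ m (𝔖 (cycle (suc m) (m ∸ m))) [ y↦z ] ≡⟨ cong (λ d → ∂ m (𝔖 (cycle (suc m) d)) [ y↦z ]) (n∸n≡0 m) ⟩
  ∂ m (𝔖 ι) [ y↦z ]                 ≈⟨ []-cong y↦z (∂-𝔖-ascent ι m (n<1+n m)) ⟩
  0ₚ                                ≡⟨ elem-> (n<1+n m) ⟨
  elem (suc m) m                    ∎
... | tri< (s≤s j≤m) _ _ = begin
  ∂ m (elem j (suc m))              ≡⟨ cong (∂ m) (trans (elem-≤ (m≤n⇒m≤1+n j≤m)) (cong (λ p → 𝔖 (cycle j p) [ y↦z ]) (+-∸-assoc 1 j≤m))) ⟩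
  ∂ m (𝔖 v [ y↦z ])                 ≈⟨ ∂-y↦z m (𝔖 v) ⟨
  ∂ m (𝔖 v) [ y↦z ]                 ≈⟨ []-cong y↦z (∂-𝔖-descent v m desc) ⟩
  𝔖 (v · s m) [ y↦z ]               ≈⟨ []-cong y↦z (𝔖-≋ (v · s m) (cycle j (m ∸ j)) back) ⟩
  𝔖 (cycle j (m ∸ j)) [ y↦z ]       ≡⟨ elem-≤ j≤m ⟨
  elem j m                          ∎
  where
  v = cycle j (suc (m ∸ j))
  m≡ : j ℕ.+ (m ∸ j) ≡ m
  m≡ = m+[n∸m]≡n j≤m
  desc : v ⟨$⟩ suc m < v ⟨$⟩ m
  desc = subst (λ n → v ⟨$⟩ suc n < v ⟨$⟩ n) m≡ (cycle-descent j (m ∸ j))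
  back : v · s m ≋ cycle j (m ∸ j)
  back i = trans (cong (λ n → v ⟨$⟩ (s n ⟨$⟩ i)) (sym m≡)) (t-involutive (cycle j (m ∸ j)) (j ℕ.+ (m ∸ j)) (suc (j ℕ.+ (m ∸ j))) i)

-- Occurrence of variables is expressed through the effect of substitutions: an expression may
-- contain variables that cancel, so syntactic occurrence is not invariant under `_≈_`.
DependsBelow : ℕ → Poly → Set
DependsBelow N P = ∀ τ τ′ → (∀ {r} → r < N → τ x[ r ] ≈ τ′ x[ r ]) → (∀ j → τ z[ j ] ≈ τ′ z[ j ]) → P [ τ ] ≈ P [ τ′ ]

depends-mono : ∀ {M N} P → M ≤ N → DependsBelow M P → DependsBelow N P
depends-mono P M≤N d τ τ′ e = d τ τ′ (λ r<M → e (<-≤-trans r<M M≤N))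

depends-y↦z : ∀ P → ∃[ N ] DependsBelow N (P [ y↦z ])
depends-y↦z (con a)    = 0 , λ _ _ _ _ → ≈-refl
depends-y↦z (var x[ r ]) = suc r , λ τ τ′ e _ → e (n<1+n r)
depends-y↦z (var y[ j ]) = 0 , λ τ τ′ _ e → e j
depends-y↦z (var z[ j ]) = 0 , λ τ τ′ _ e → e j
depends-y↦z (P + Q) with depends-y↦z P | depends-y↦z Q
... | M , d | N , d′ = M ⊔ N , λ τ τ′ e e′ → +-cong (depends-mono (P [ y↦z ]) (m≤m⊔n M N) d τ τ′ e e′) (depends-mono (Q [ y↦z ]) (m≤n⊔m M N) d′ τ τ′ e e′)
depends-y↦z (P * Q) with depends-y↦z P | depends-y↦z Q
... | M , d | N , d′ = M ⊔ N , λ τ τ′ e e′ → *-cong (depends-mono (P [ y↦z ]) (m≤m⊔n M N) d τ τ′ e e′) (depends-mono (Q [ y↦z ]) (m≤n⊔m M N) d′ τ τ′ e e′)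
depends-y↦z (- P) with depends-y↦z P
... | N , d = N , λ τ τ′ e e′ → -‿cong (d τ τ′ e e′)

-- If P is symmetric in x_N and x_{N+1} and does not involve x_{N+1}, then it
-- does not involve x_N: route the new value of x_N through x_{N+1}.
depends-lower : ∀ N P → P [ s-act N ] ≈ P → DependsBelow (suc N) P → DependsBelow N P
depends-lower N P inv d τ τ′ e e′ = begin
  P [ τ ]                 ≈⟨ d τ ρ (λ r<1+N → ≡⇒≈ (sym (ρ-other (<⇒≢ r<1+N)))) (λ _ → ≈-refl) ⟩
  P [ ρ ]                 ≈⟨ []-cong ρ inv ⟨
  P [ s-act N ] [ ρ ]     ≡⟨ []-∘ {ρ = λ v → s-act N v [ ρ ]} (λ _ → refl) P ⟩
  P [ (λ v → s-act N v [ ρ ]) ] ≈⟨ d (λ v → s-act N v [ ρ ]) τ′ agree e′ ⟩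
  P [ τ′ ]                ∎
  where
  ρ : Var → Poly
  ρ x[ r ] with r ℕ.≟ suc N
  ... | yes _ = τ′ x[ N ]
  ... | no _  = τ x[ r ]
  ρ y[ j ] = τ y[ j ]
  ρ z[ j ] = τ z[ j ]
  ρ-other : ∀ {r} → r ≢ suc N → ρ x[ r ] ≡ τ x[ r ]
  ρ-other {r} ne with r ℕ.≟ suc N
  ... | yes e = contradiction e ne
  ... | no _  = refl
  ρ-1+N : ρ x[ suc N ] ≡ τ′ x[ N ]
  ρ-1+N with suc N ℕ.≟ suc N
  ... | yes _ = refl
  ... | no ne = contradiction refl ne
  agree : ∀ {r} → r < suc N → ρ x[ s N ⟨$⟩ r ] ≈ τ′ x[ r ]
  agree {r} (s≤s r≤N) with m≤n⇒m<n∨m≡n r≤N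
  ... | inj₁ r<N  = ≈-trans (≡⇒≈ (trans (cong (ρ ∘ x[_]) (swap-other N (suc N) (<⇒≢ r<N) (<⇒≢ (m<n⇒m<1+n r<N)))) (ρ-other (<⇒≢ (m<n⇒m<1+n r<N))))) (e r<N)
  ... | inj₂ refl = ≡⇒≈ (trans (cong (ρ ∘ x[_]) (swapˡ N (suc N))) ρ-1+N)

-- Some bound on the variables exists because the polynomial is a finite expression. For N ≥ m it is
-- symmetric in x_N and x_{N+1}, so the bound descends step by step to m.
elem-depends : ∀ j m → DependsBelow m (elem j m)
elem-depends j m with raw
  where
  raw : ∃[ N ] DependsBelow N (elem j m)
  raw with j ℕ.≤? m
  ... | yes _ = depends-y↦z (𝔖 (cycle j (m ∸ j)))
  ... | no _  = 0 , λ _ _ _ _ → ≈-refl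
... | N , d = go N (depends-mono (elem j m) (m≤m+n N m) d)
  where
  go : ∀ N → DependsBelow (N ℕ.+ m) (elem j m) → DependsBelow m (elem j m)
  go zero d    = d
  go (suc N) d = go N (depends-lower (N ℕ.+ m) (elem j m) (elem-symmetric j m (>⇒≢ (s≤s (m≤n+m m N)))) d)

-- Evaluation at lists of polynomials

at : List Poly → ℕ → Poly → Poly
at []       _       d = d
at (P ∷ Ps) zero    d = P
at (P ∷ Ps) (suc r) d = at Ps r d

x↦ : List Poly → Var → Poly
x↦ Ps x[ r ] = at Ps r (var x[ r ])
x↦ Ps y[ j ] = var y[ j ]
x↦ Ps z[ j ] = var z[ j ]

at-++ : ∀ Ps Qs r d → at (Ps ++ Qs) (length Ps ℕ.+ r) d ≡ at Qs r d
at-++ []       Qs r d = refl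
at-++ (P ∷ Ps) Qs r d = at-++ Ps Qs r d

at-++-< : ∀ Ps Qs {r} d d′ → r < length Ps → at (Ps ++ Qs) r d ≡ at Ps r d′
at-++-< (P ∷ Ps) Qs {zero}  d d′ _        = refl
at-++-< (P ∷ Ps) Qs {suc r} d d′ (s≤s lt) = at-++-< Ps Qs d d′ lt

module _ (j : ℕ) where

  eval : List Poly → Poly
  eval Ps = elem j (length Ps) [ x↦ Ps ]

  eval-[] : ∀ σ Ps → (∀ j → σ z[ j ] ≈ var z[ j ]) → eval Ps [ σ ] ≈ eval (map (_[ σ ]) Ps)
  eval-[] σ Ps fix = begin
    elem j (length Ps) [ x↦ Ps ] [ σ ]               ≡⟨ []-∘ {ρ = λ v → x↦ Ps v [ σ ]} (λ _ → refl) (elem j (length Ps)) ⟩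
    elem j (length Ps) [ (λ v → x↦ Ps v [ σ ]) ]     ≈⟨ elem-depends j (length Ps) _ (x↦ (map (_[ σ ]) Ps)) (λ r< → ≡⇒≈ (at-map Ps r<)) fix ⟩
    elem j (length Ps) [ x↦ (map (_[ σ ]) Ps) ]      ≡⟨ cong (λ m → elem j m [ x↦ (map (_[ σ ]) Ps) ]) (length-map (_[ σ ]) Ps) ⟨
    eval (map (_[ σ ]) Ps)                             ∎
    where
    at-map : ∀ Ps {r d d′} → r < length Ps → at Ps r d [ σ ] ≡ at (map (_[ σ ]) Ps) r d′
    at-map (P ∷ Ps) {zero}  _        = refl
    at-map (P ∷ Ps) {suc r} (s≤s lt) = at-map Ps lt

  -- The defining identity of the divided difference `∂ m` of `elem j (suc m)`, which equals
  -- `elem j m`, is evaluated with A for x_m and B for x_{m+1}.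
  eval-last : ∀ Ps A B → eval (Ps ∷ʳ A) ≈ eval (Ps ∷ʳ B) + (A - B) * eval Ps
  eval-last Ps A B = begin
    eval (Ps ∷ʳ A)
      ≈⟨ to-τ A τ (λ r< → at-++-< Ps (A ∷ B ∷ []) _ _ r<) τm (λ _ → ≈-refl) ⟩
    elem j (suc m) [ τ ]
      ≈⟨ []-cong τ (≈-trans (solve 2 (λ p q → p := q :+ (p :- q)) ≈-refl (elem j (suc m)) (elem j (suc m) [ s-act m ]))
                     (+-cong ≈-refl (≈-trans (≈-sym (∂-spec m (elem j (suc m)))) (*-cong (∂-elem j m) ≈-refl)))) ⟩
    elem j (suc m) [ s-act m ] [ τ ] + elem j m [ τ ] * (τ x[ m ] - τ x[ suc m ])
      ≈⟨ +-cong (≈-trans (≡⇒≈ ([]-∘ {ρ = τ′} (λ _ → refl) (elem j (suc m)))) (≈-sym (to-τ B τ′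
           (λ {r} r< → trans (cong (λ r → at (Ps ++ A ∷ B ∷ []) r (var x[ r ])) (swap-other m (suc m) (<⇒≢ r<) (<⇒≢ (m<n⇒m<1+n r<)))) (at-++-< Ps (A ∷ B ∷ []) _ _ r<))
           (trans (cong (λ r → at (Ps ++ A ∷ B ∷ []) r (var x[ r ])) (swapˡ m (suc m))) τ1+m) (λ _ → ≈-refl))))
         (*-cong (≈-sym (elem-depends j m (x↦ Ps) τ (λ r< → ≡⇒≈ (sym (at-++-< Ps (A ∷ B ∷ []) _ _ r<))) (λ _ → ≈-refl)))
                 (≡⇒≈ (cong₂ _-_ τm τ1+m))) ⟩
    eval (Ps ∷ʳ B) + eval Ps * (A - B)
      ≈⟨ +-cong ≈-refl (*-comm _ _) ⟩
    eval (Ps ∷ʳ B) + (A - B) * eval Ps ∎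
    where
    m = length Ps
    τ = x↦ (Ps ++ A ∷ B ∷ [])
    τ′ = λ v → s-act m v [ τ ]
    τm : τ x[ m ] ≡ A
    τm = trans (cong (λ r → at (Ps ++ A ∷ B ∷ []) r (var x[ m ])) (sym (+-identityʳ m))) (at-++ Ps (A ∷ B ∷ []) 0 _)
    τ1+m : τ x[ suc m ] ≡ B
    τ1+m = trans (cong (λ r → at (Ps ++ A ∷ B ∷ []) r (var x[ suc m ])) (ℕₚ.+-comm 1 m)) (at-++ Ps (A ∷ B ∷ []) 1 _)
    to-τ : ∀ Q ρ → (∀ {r} → r < m → ρ x[ r ] ≡ at Ps r (var x[ r ])) → ρ x[ m ] ≡ Q → (∀ j → var z[ j ] ≈ ρ z[ j ]) →
           eval (Ps ∷ʳ Q) ≈ elem j (suc m) [ ρ ]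
    to-τ Q ρ e e′ ez = ≈-trans
      (≡⇒≈ (cong (λ m → elem j m [ x↦ (Ps ∷ʳ Q) ]) (trans (length-++ Ps) (ℕₚ.+-comm m 1))))
      (elem-depends j (suc m) (x↦ (Ps ∷ʳ Q)) ρ agree ez)
      where
      agree : ∀ {r} → r < suc m → at (Ps ∷ʳ Q) r (var x[ r ]) ≈ ρ x[ r ]
      agree {r} (s≤s r≤m) with m≤n⇒m<n∨m≡n r≤m
      ... | inj₁ r<m  = ≡⇒≈ (trans (at-++-< Ps (Q ∷ []) _ _ r<m) (sym (e r<m)))
      ... | inj₂ refl = ≡⇒≈ (trans (cong (λ r → at (Ps ∷ʳ Q) r (var x[ m ])) (sym (+-identityʳ m))) (trans (at-++ Ps (Q ∷ []) 0 _) (sym e′)))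

  eval-swap : ∀ Ps A B Qs → eval (Ps ++ A ∷ B ∷ Qs) ≈ eval (Ps ++ B ∷ A ∷ Qs)
  eval-swap Ps A B Qs = begin
    elem j m [ x↦ L ]                   ≈⟨ []-cong (x↦ L) (elem-symmetric j m 1+i≢m) ⟨
    elem j m [ s-act i ] [ x↦ L ]       ≡⟨ []-∘ {ρ = λ v → s-act i v [ x↦ L ]} (λ _ → refl) (elem j m) ⟩
    elem j m [ (λ v → s-act i v [ x↦ L ]) ] ≈⟨ elem-depends j m _ (x↦ L′) (λ {r} _ → ≡⇒≈ (agree r)) (λ _ → ≈-refl) ⟩
    elem j m [ x↦ L′ ]                  ≡⟨ cong (λ m → elem j m [ x↦ L′ ]) (trans (length-++ Ps) (sym (length-++ Ps))) ⟩
    eval L′                               ∎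
    where
    i = length Ps
    L = Ps ++ A ∷ B ∷ Qs
    L′ = Ps ++ B ∷ A ∷ Qs
    m = length L
    1+i≢m : suc i ≢ m
    1+i≢m e = <⇒≢ (subst₂ _≤_ (ℕₚ.+-comm i 2) (sym (length-++ Ps)) (+-monoʳ-≤ i {2} {suc (suc (length Qs))} (s≤s (s≤s z≤n)))) e
    rest : ∀ Ps r d d′ → r ≢ length Ps → r ≢ suc (length Ps) → (r < length Ps ⊎ d ≡ d′) → at (Ps ++ A ∷ B ∷ Qs) r d ≡ at (Ps ++ B ∷ A ∷ Qs) r d′
    rest [] zero          d d′ ne _  _ = contradiction refl ne
    rest [] (suc zero)    d d′ _ ne  _ = contradiction refl ne
    rest [] (suc (suc r)) d d′ _ _   (inj₂ refl) = refl
    rest (P ∷ Ps) zero    d d′ _ _   _ = refl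
    rest (P ∷ Ps) (suc r) d d′ ne ne′ (inj₁ (s≤s lt)) = rest Ps r d d′ (ne ∘ cong suc) (ne′ ∘ cong suc) (inj₁ lt)
    rest (P ∷ Ps) (suc r) d d′ ne ne′ (inj₂ e) = rest Ps r d d′ (ne ∘ cong suc) (ne′ ∘ cong suc) (inj₂ e)
    second : ∀ P P′ d → at (Ps ++ P ∷ P′ ∷ Qs) (suc i) d ≡ P′
    second P P′ d = trans (cong (λ r → at (Ps ++ P ∷ P′ ∷ Qs) r d) (ℕₚ.+-comm 1 i)) (at-++ Ps (P ∷ P′ ∷ Qs) 1 d)
    first : ∀ P P′ d → at (Ps ++ P ∷ P′ ∷ Qs) i d ≡ P
    first P P′ d = trans (cong (λ r → at (Ps ++ P ∷ P′ ∷ Qs) r d) (sym (+-identityʳ i))) (at-++ Ps (P ∷ P′ ∷ Qs) 0 d)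
    agree : ∀ r → x↦ L x[ s i ⟨$⟩ r ] ≡ x↦ L′ x[ r ]
    agree r = go (r ℕ.≟ i) (r ℕ.≟ suc i)
      where
      go : Dec (r ≡ i) → Dec (r ≡ suc i) → x↦ L x[ s i ⟨$⟩ r ] ≡ x↦ L′ x[ r ]
      go (yes refl) _ = trans (cong (λ r → x↦ L x[ r ]) (swapˡ i (suc i))) (trans (second A B _) (sym (first B A _)))
      go (no _) (yes refl) = trans (cong (λ r → x↦ L x[ r ]) (swapʳ i (suc i))) (trans (first A B _) (sym (second B A _)))
      go (no ne) (no ne′) = trans (cong (λ r → x↦ L x[ r ]) (swap-other i (suc i) ne ne′)) (rest Ps r _ _ ne ne′ (inj₂ refl))

  eval-↭ : ∀ {Ps Qs} → Ps ↭ Qs → eval Ps ≈ eval Qs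
  eval-↭ = go []
    where
    snoc : ∀ (Rs : List Poly) P Ps → eval ((Rs ∷ʳ P) ++ Ps) ≈ eval (Rs ++ P ∷ Ps)
    snoc Rs P Ps = ≡⇒≈ (cong eval (++-assoc Rs (P ∷ []) Ps))
    go : ∀ Rs {Ps Qs} → Ps ↭ Qs → eval (Rs ++ Ps) ≈ eval (Rs ++ Qs)
    go Rs ↭.refl = ≈-refl
    go Rs {P ∷ Ps} {_ ∷ Qs} (↭.prep _ p) = ≈-trans (≈-sym (snoc Rs P Ps)) (≈-trans (go (Rs ∷ʳ P) p) (snoc Rs P Qs))
    go Rs {P ∷ Q ∷ Ps} {_ ∷ _ ∷ Qs} (↭.swap _ _ p) = ≈-trans (eval-swap Rs P Q Ps)
      (≈-trans (≈-sym (snoc Rs Q (P ∷ Ps))) (≈-trans (≈-sym (snoc (Rs ∷ʳ Q) P Ps))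
      (≈-trans (go ((Rs ∷ʳ Q) ∷ʳ P) p) (≈-trans (snoc (Rs ∷ʳ Q) P Qs) (snoc Rs Q (P ∷ Qs))))))
    go Rs (↭.trans p q) = ≈-trans (go Rs p) (go Rs q)

  eval-head : ∀ A B Ps → eval (A ∷ Ps) ≈ eval (B ∷ Ps) + (A - B) * eval Ps
  eval-head A B Ps = begin
    eval (A ∷ Ps)                          ≈⟨ eval-↭ (∷↭∷ʳ A Ps) ⟩
    eval (Ps ∷ʳ A)                         ≈⟨ eval-last Ps A B ⟩
    eval (Ps ∷ʳ B) + (A - B) * eval Ps       ≈⟨ +-cong (eval-↭ (↭-sym (∷↭∷ʳ B Ps))) ≈-refl ⟩
    eval (B ∷ Ps) + (A - B) * eval Ps        ∎

  E-x↦y-eval : ∀ L → E (+ length L ℤ.- + j) (+ length L) [ x↦y L ] ≈ eval (map (λ a → var y[ a ]) L)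
  E-x↦y-eval L = begin
    E (+ length L ℤ.- + j) (+ length L) [ x↦y L ]   ≈⟨ []-cong (x↦y L) (E≈elem j (length L)) ⟩
    elem j (length L) [ x↦y L ]                     ≈⟨ elem-depends j (length L) (x↦y L) (x↦ Ps) (λ {r} _ → ≡⇒≈ (same L r)) (λ _ → ≈-refl) ⟩
    elem j (length L) [ x↦ Ps ]                     ≡⟨ cong (λ m → elem j m [ x↦ Ps ]) (length-map (λ a → var y[ a ]) L) ⟨
    eval Ps                                           ∎
    where
    Ps = map (λ a → var y[ a ]) L
    same : ∀ L r {d} → maybe′ (λ a → var y[ a ]) d (head (drop r L)) ≡ at (map (λ a → var y[ a ]) L) r d
    same []      zero    = refl
    same []      (suc r) = refl
    same (a ∷ L) zero    = refl
    same (a ∷ L) (suc r) = same L r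

  E-x-eval : ∀ k → E (+ k ℤ.- + j) (+ k) ≈ eval (map (λ r → var x[ r ]) (upTo k))
  E-x-eval k = begin
    E (+ k ℤ.- + j) (+ k)      ≈⟨ E≈elem j k ⟩
    elem j k                   ≡⟨ []-var (elem j k) ⟨
    elem j k [ var ]           ≈⟨ elem-depends j k var (x↦ Ps) (λ r<k → ≡⇒≈ (sym (at-upTo _ (λ r → r) r<k))) (λ _ → ≈-refl) ⟩
    elem j k [ x↦ Ps ]         ≡⟨ cong (λ m → elem j m [ x↦ Ps ]) (trans (length-map (λ r → var x[ r ]) (upTo k)) (length-upTo k)) ⟨
    eval Ps                      ∎
    where
    Ps = map (λ r → var x[ r ]) (upTo k)
    at-upTo : ∀ k (f : ℕ → ℕ) {r d} → r < k → at (map (λ r → var x[ r ]) (applyUpTo f k)) r d ≡ var x[ f r ]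
    at-upTo (suc k) f {zero}  _        = refl
    at-upTo (suc k) f {suc r} (s≤s lt) = at-upTo k (f ∘ suc) lt

  -- From here on the factorial elementary symmetric polynomials are known only through these laws;
  -- nothing else about their construction enters the rest of the proof.
  opaque

    ev : List Poly → Poly
    ev = eval

    ev-[] : ∀ σ Ps → (∀ j → σ z[ j ] ≈ var z[ j ]) → ev Ps [ σ ] ≈ ev (map (_[ σ ]) Ps)
    ev-[] = eval-[]

    ev-↭ : ∀ {Ps Qs} → Ps ↭ Qs → ev Ps ≈ ev Qs
    ev-↭ = eval-↭

    ev-head : ∀ A B Ps → ev (A ∷ Ps) ≈ ev (B ∷ Ps) + (A - B) * ev Ps
    ev-head = eval-head

    E-x↦y : ∀ L → E (+ length L ℤ.- + j) (+ length L) [ x↦y L ] ≈ ev (map (λ a → var y[ a ]) L)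
    E-x↦y = E-x↦y-eval

    E-x : ∀ k → E (+ k ℤ.- + j) (+ k) ≈ ev (map (λ r → var x[ r ]) (upTo k))
    E-x = E-x-eval

-- Sums over finite sets of permutations

Distinct : List S∞ → Set
Distinct = AllPairs λ u v → ¬ u ≋ v

_∈≋_ : S∞ → List S∞ → Set
w ∈≋ ws = ∃[ v ] v ∈ ws × w ≋ v

∑-↭ : ∀ {Ps Qs} → Ps ↭ Qs → ∑ Ps ≈ ∑ Qs
∑-↭ ↭.refl = ≈-refl
∑-↭ (↭.prep P p) = +-cong ≈-refl (∑-↭ p)
∑-↭ {_ ∷ _ ∷ Ps} {_ ∷ _ ∷ Qs} (↭.swap P Q p) = ≈-trans (+-cong ≈-refl (+-cong ≈-refl (∑-↭ p)))
  (solve 3 (λ a b r → a :+ (b :+ r) := b :+ (a :+ r)) ≈-refl P Q (∑ Qs))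
∑-↭ (↭.trans p q) = ≈-trans (∑-↭ p) (∑-↭ q)

∑-cong : ∀ {X : Set} {F G : X → Poly} ws → (∀ w → w ∈ ws → F w ≈ G w) → ∑ (map F ws) ≈ ∑ (map G ws)
∑-cong []       _ = ≈-refl
∑-cong (w ∷ ws) e = +-cong (e w (here refl)) (∑-cong ws λ v → e v ∘ there)

∑-zero : ∀ {X : Set} {F : X → Poly} ws → (∀ w → w ∈ ws → F w ≈ 0ₚ) → ∑ (map F ws) ≈ 0ₚ
∑-zero []       _ = ≈-refl
∑-zero (w ∷ ws) e = ≈-trans (+-cong (e w (here refl)) (∑-zero ws λ v → e v ∘ there)) (+-identityˡ _)

∑-+ : ∀ {X : Set} (F G : X → Poly) ws → ∑ (map (λ w → F w + G w) ws) ≈ ∑ (map F ws) + ∑ (map G ws)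
∑-+ F G []       = ≈-sym (+-identityˡ _)
∑-+ F G (w ∷ ws) = ≈-trans (+-cong ≈-refl (∑-+ F G ws))
  (solve 4 (λ a b d e → a :+ b :+ (d :+ e) := a :+ d :+ (b :+ e)) ≈-refl (F w) (G w) (∑ (map F ws)) (∑ (map G ws)))

∑-* : ∀ {X : Set} A (F : X → Poly) ws → ∑ (map (λ w → A * F w) ws) ≈ A * ∑ (map F ws)
∑-* A F []       = ≈-sym (zeroʳ A)
∑-* A F (w ∷ ws) = ≈-trans (+-cong ≈-refl (∑-* A F ws)) (≈-sym (distribˡ A _ _))

∑-++ : ∀ Ps Qs → ∑ (Ps ++ Qs) ≈ ∑ Ps + ∑ Qs
∑-++ []       Qs = ≈-sym (+-identityˡ _)
∑-++ (P ∷ Ps) Qs = ≈-trans (+-cong ≈-refl (∑-++ Ps Qs)) (≈-sym (+-assoc P _ _))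

∑-[] : ∀ σ (F : S∞ → Poly) ws → ∑ (map F ws) [ σ ] ≡ ∑ (map (λ w → F w [ σ ]) ws)
∑-[] σ F []       = refl
∑-[] σ F (w ∷ ws) = cong (F w [ σ ] +_) (∑-[] σ F ws)

distinct-remove : ∀ xs {y ys} → Distinct (xs ++ y ∷ ys) → Distinct (xs ++ ys) × All (λ v → ¬ y ≋ v) (xs ++ ys)
distinct-remove []       (y∉ ∷ d) = d , y∉
distinct-remove (x ∷ xs) (x∉ ∷ d) with distinct-remove xs d | Allₚ.++⁻ʳ xs x∉
... | d′ , y∉ | x≁y ∷ x∉ys = Allₚ.++⁺ (Allₚ.++⁻ˡ xs x∉) x∉ys ∷ d′ , (λ e → x≁y λ i → sym (e i)) ∷ y∉

∑-agree : ∀ (F : S∞ → Poly) → (∀ u v → u ≋ v → F u ≈ F v) → ∀ xs ys → Distinct xs → Distinct ys →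
  (∀ w → w ∈ xs → w ∈≋ ys ⊎ F w ≈ 0ₚ) → (∀ w → w ∈ ys → w ∈≋ xs ⊎ F w ≈ 0ₚ) →
  ∑ (map F xs) ≈ ∑ (map F ys)
∑-agree F F-cong [] ys _ _ _ back = ≈-sym (∑-zero ys λ w w∈ → none w (back w w∈))
  where
  none : ∀ w → w ∈≋ [] ⊎ F w ≈ 0ₚ → F w ≈ 0ₚ
  none w (inj₂ z) = z
∑-agree F F-cong (x ∷ xs) ys (x∉ ∷ dx) dy to back with to x (here refl)
... | inj₂ z = ≈-trans (+-cong z (∑-agree F F-cong xs ys dx dy (λ w → to w ∘ there) (λ w w∈ → drop-x w (back w w∈)))) (+-identityˡ _)
  where
  drop-x : ∀ w → w ∈≋ (x ∷ xs) ⊎ F w ≈ 0ₚ → w ∈≋ xs ⊎ F w ≈ 0ₚ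
  drop-x w (inj₂ z)                    = inj₂ z
  drop-x w (inj₁ (_ , here refl , e))  = inj₂ (≈-trans (F-cong w x e) z)
  drop-x w (inj₁ (v , there v∈ , e))   = inj₁ (v , v∈ , e)
... | inj₁ (y , y∈ , x≋y) with ∈-∃++ y∈
...   | ys₁ , ys₂ , refl = ≈-trans
  (+-cong (F-cong x y x≋y) (∑-agree F F-cong xs ys′ dx (proj₁ dy′) to′ back′))
  (∑-↭ (↭-map⁺ F (↭-sym perm)))
  where
  ys′ = ys₁ ++ ys₂
  perm : ys ↭ y ∷ ys′
  perm = shift y ys₁ ys₂
  dy′ = distinct-remove ys₁ dy
  to′ : ∀ w → w ∈ xs → w ∈≋ ys′ ⊎ F w ≈ 0ₚ
  to′ w w∈ with to w (there w∈)
  ... | inj₂ z = inj₂ z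
  ... | inj₁ (v , v∈ , w≋v) with ∈-resp-↭ perm v∈
  ...   | here refl = contradiction (λ i → trans (x≋y i) (sym (w≋v i))) (All.lookup x∉ w∈)
  ...   | there v∈′ = inj₁ (v , v∈′ , w≋v)
  back′ : ∀ w → w ∈ ys′ → w ∈≋ xs ⊎ F w ≈ 0ₚ
  back′ w w∈ with back w (∈-resp-↭ (↭-sym perm) (there w∈))
  ... | inj₂ z = inj₂ z
  ... | inj₁ (v , there v∈ , w≋v) = inj₁ (v , v∈ , w≋v)
  ... | inj₁ (_ , here refl , w≋x) = contradiction (λ i → trans (sym (x≋y i)) (sym (w≋x i))) (All.lookup (proj₂ dy′) w∈)

_≋?_ : ∀ u v → Dec (u ≋ v)
u ≋? v = map′ extend (λ e {i} _ → e i) (allUpTo? (λ i → u ⟨$⟩ i ℕ.≟ v ⟨$⟩ i) N)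
  where
  N = bound u ⊔ bound v
  extend : (∀ {i} → i < N → u ⟨$⟩ i ≡ v ⟨$⟩ i) → u ≋ v
  extend e i with <-≤-connex i N
  ... | inj₁ i<N = e i<N
  ... | inj₂ N≤i = trans (fixed u i (≤-trans (m≤m⊔n (bound u) (bound v)) N≤i))
                         (sym (fixed v i (≤-trans (m≤n⊔m (bound u) (bound v)) N≤i)))

dedup : List S∞ → List S∞
dedup = deduplicate _≋?_

dedup-distinct : ∀ ws → Distinct (dedup ws)
dedup-distinct ws = UniqueDec.deduplicate-! (record
  { Carrier = S∞ ; _≈_ = _≋_ ; isDecEquivalence = record
    { isEquivalence = record { refl = λ _ → refl ; sym = λ p i → sym (p i) ; trans = λ p q i → trans (p i) (q i) }
    ; _≟_ = _≋?_ } }) ws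

∈-dedup⁻ : ∀ ws {w} → w ∈ dedup ws → w ∈ ws
∈-dedup⁻ ws w∈ = ∈-deduplicate⁻ (≡.setoid S∞) _≋?_ ws w∈

∈-dedup⁺ : ∀ ws w → w ∈≋ ws → w ∈≋ dedup ws
∈-dedup⁺ ws w (v , v∈ , w≋v) with find (Anyₚ.deduplicate⁺ _≋?_ {P = w ≋_} (λ e p i → trans (p i) (sym (e i))) (Any.map (λ { refl → w≋v }) v∈))
... | v′ , v′∈ , e = v′ , v′∈ , e

-- Coefficients

module _ (k : ℕ) where

  sameSide? : ∀ a b → Dec (SameSide k a b)
  sameSide? a b = ((a ℕ.<? k) ×-dec (b ℕ.<? k)) ⊎-dec ((k ℕ.≤? a) ×-dec (k ℕ.≤? b))

  ≤ₖ? : ∀ u w → Dec (_≤ₖ_ k u w)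
  ≤ₖ? u w = map′ to from
    (allUpTo? (λ a → u ⟨$⟩ a ℕ.≤? w ⟨$⟩ a) k
     ×-dec allUpTo? (λ b → (k ℕ.≤? b) →-dec (w ⟨$⟩ b ℕ.≤? u ⟨$⟩ b)) N
     ×-dec allUpTo? (λ b → allUpTo? (λ a → sameSide? a b →-dec ((a ℕ.<? b) →-dec ((u ⟨$⟩ a ℕ.<? u ⟨$⟩ b) →-dec (w ⟨$⟩ a ℕ.<? w ⟨$⟩ b)))) N) N)
    where
    N = bound u ⊔ bound w
    u-fix : ∀ {b} → N ≤ b → u ⟨$⟩ b ≡ b
    u-fix N≤b = fixed u _ (≤-trans (m≤m⊔n (bound u) (bound w)) N≤b)
    w-fix : ∀ {b} → N ≤ b → w ⟨$⟩ b ≡ b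
    w-fix N≤b = fixed w _ (≤-trans (m≤n⊔m (bound u) (bound w)) N≤b)
    to : (∀ {a} → a < k → u ⟨$⟩ a ≤ w ⟨$⟩ a) × (∀ {b} → b < N → k ≤ b → w ⟨$⟩ b ≤ u ⟨$⟩ b) ×
         (∀ {b} → b < N → ∀ {a} → a < N → SameSide k a b → a < b → u ⟨$⟩ a < u ⟨$⟩ b → w ⟨$⟩ a < w ⟨$⟩ b) → _≤ₖ_ k u w
    to (l , h , o) = record { low = l ; high = high′ ; order = order′ }
      where
      high′ : ∀ {b} → k ≤ b → w ⟨$⟩ b ≤ u ⟨$⟩ b
      high′ {b} k≤b with <-≤-connex b N
      ... | inj₁ b<N = h b<N k≤b
      ... | inj₂ N≤b = ≤-reflexive (trans (w-fix N≤b) (sym (u-fix N≤b)))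
      order′ : ∀ {a b} → SameSide k a b → a < b → u ⟨$⟩ a < u ⟨$⟩ b → w ⟨$⟩ a < w ⟨$⟩ b
      order′ {a} {b} ss a<b lt with <-≤-connex b N
      ... | inj₁ b<N = o b<N (<-trans a<b b<N) ss a<b lt
      ... | inj₂ N≤b = subst (w ⟨$⟩ a <_) (sym (w-fix N≤b)) (⟨$⟩-below w (≤-trans (m≤n⊔m (bound u) (bound w)) N≤b) a<b)
    from : _≤ₖ_ k u w → (∀ {a} → a < k → u ⟨$⟩ a ≤ w ⟨$⟩ a) × (∀ {b} → b < N → k ≤ b → w ⟨$⟩ b ≤ u ⟨$⟩ b) ×
         (∀ {b} → b < N → ∀ {a} → a < N → SameSide k a b → a < b → u ⟨$⟩ a < u ⟨$⟩ b → w ⟨$⟩ a < w ⟨$⟩ b)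
    from p = low p , (λ _ → high p) , λ _ _ → order p

  opaque

    _⇢?_ : ∀ u w → Dec (_⇢_ k u w)
    u ⇢? w = map′ (λ (p , e) → p , e) (λ p → below p , tight p) (≤ₖ? u w ×-dec (ℓ w ℕ.+ #fixed k u w ℕ.≟ ℓ u ℕ.+ k))

  fixedPositions-≋ : ∀ u w u′ w′ → u ≋ u′ → w ≋ w′ → fixedPositions k u w ≡ fixedPositions k u′ w′
  fixedPositions-≋ u w u′ w′ p q = fixedPositions-ext k u w u′ w′
    (λ {a} _ e → trans (sym (p a)) (trans e (q a))) (λ {a} _ e → trans (p a) (trans e (sym (q a))))

  ⇢-≋ : ∀ u w u′ w′ → u ≋ u′ → w ≋ w′ → _⇢_ k u w → _⇢_ k u′ w′
  ⇢-≋ u w u′ w′ p q r = ≤ₖ-trans k (≋⇒≤ₖ k u′ u (λ i → sym (p i))) (≤ₖ-trans k (below r) (≋⇒≤ₖ k w w′ q))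
    , trans (cong₂ ℕ._+_ (sym (ℓ-cong w w′ q)) (cong length (sym (fixedPositions-≋ u w u′ w′ p q))))
            (trans (tight r) (cong (ℕ._+ k) (ℓ-cong u u′ p)))

  module _ (j : ℕ) where

    at-values : S∞ → List ℕ → Poly
    at-values u as = ev j (map (λ a → var y[ u ⟨$⟩ a ]) as)

    weight : S∞ → S∞ → Poly
    weight u w = at-values u (fixedPositions k u w)

    opaque

      -- Extended by zero to all pairs, so that sums may run over any list that contains the
      -- permutations reachable from u.
      coeff : S∞ → S∞ → Poly
      coeff u w with u ⇢? w
      ... | yes _ = weight u w
      ... | no _  = 0ₚ

      coeff-yes : ∀ {u w} → _⇢_ k u w → coeff u w ≡ weight u w
      coeff-yes {u} {w} p with u ⇢? w
      ... | yes _ = refl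
      ... | no ¬p = contradiction p ¬p

      coeff-no : ∀ {u w} → ¬ _⇢_ k u w → coeff u w ≡ 0ₚ
      coeff-no {u} {w} ¬p with u ⇢? w
      ... | yes p = contradiction p ¬p
      ... | no _  = refl

    weight-≋ : ∀ u w u′ w′ → u ≋ u′ → w ≋ w′ → weight u w ≡ weight u′ w′
    weight-≋ u w u′ w′ p q = trans (cong (at-values u) (fixedPositions-≋ u w u′ w′ p q))
      (cong (ev j) (map-cong (λ a → cong (λ v → var y[ v ]) (p a)) (fixedPositions k u′ w′)))

    coeff-≋ : ∀ u w u′ w′ → u ≋ u′ → w ≋ w′ → coeff u w ≡ coeff u′ w′
    coeff-≋ u w u′ w′ p q = go (u ⇢? w)
      where
      go : Dec (_⇢_ k u w) → coeff u w ≡ coeff u′ w′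
      go (yes r) = trans (coeff-yes r) (trans (weight-≋ u w u′ w′ p q) (sym (coeff-yes (⇢-≋ u w u′ w′ p q r))))
      go (no ¬r) = trans (coeff-no ¬r) (sym (coeff-no (λ r → ¬r (⇢-≋ u′ w′ u w (λ i → sym (p i)) (λ i → sym (q i)) r))))

    at-values-↭ : ∀ u {as bs} → as ↭ bs → at-values u as ≈ at-values u bs
    at-values-↭ u p = ev-↭ j (↭-map⁺ (λ a → var y[ u ⟨$⟩ a ]) p)

    at-values-[] : ∀ i u as → at-values u as [ y-act i ] ≈ at-values (s i · u) as
    at-values-[] i u as = ≈-trans (ev-[] j (y-act i) _ (λ _ → ≈-refl)) (≡⇒≈ (cong (ev j) (sym (map-∘ as))))

    values-cong : ∀ u v as → (∀ {a} → a ∈ as → u ⟨$⟩ a ≡ v ⟨$⟩ a) → map (λ a → var y[ u ⟨$⟩ a ]) as ≡ map (λ a → var y[ v ⟨$⟩ a ]) as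
    values-cong u v []       _ = refl
    values-cong u v (a ∷ as) e = cong₂ (λ v vs → var y[ v ] ∷ vs) (e (here refl)) (values-cong u v as (e ∘ there))

    ∈-fixed : ∀ u w {a} → a ∈ fixedPositions k u w → a < k × u ⟨$⟩ a ≡ w ⟨$⟩ a
    ∈-fixed u w a∈ with ∈-filter⁻ (λ a → u ⟨$⟩ a ℕ.≟ w ⟨$⟩ a) {xs = upTo k} a∈
    ... | a∈upTo , e = ∈-upTo⁻ a∈upTo , e

    -- f is covered by s i · f, and g by s i · g, in the left weak order.
    module _ (i : ℕ) (f g : S∞) (f-asc : f ⁻¹ ⟨$⟩ i < f ⁻¹ ⟨$⟩ suc i) (g-asc : g ⁻¹ ⟨$⟩ i < g ⁻¹ ⟨$⟩ suc i) where

      open Exchange i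

      private
        f₊ = s i · f
        g₊ = s i · g
        α = f ⁻¹ ⟨$⟩ i
        β = f ⁻¹ ⟨$⟩ suc i
        fα = invʳ f i
        fβ = invʳ f (suc i)
        f₊-α : f₊ ⟨$⟩ α ≡ suc i
        f₊-α = sw-i fα
        f₊-β : f₊ ⟨$⟩ β ≡ i
        f₊-β = sw-1+i fβ
        asc : ∀ h → h ⁻¹ ⟨$⟩ i < h ⁻¹ ⟨$⟩ suc i → Ascending k i h
        asc h lt hx hy = subst₂ _<_ (⁻¹-≡ h hx) (⁻¹-≡ h hy) lt
        σ = y-act i
        d = δʸ i
        both : fixedPositions k f₊ g₊ ≡ fixedPositions k f g
        both = fixed-both k i f g α β fα fβ (asc f f-asc) (asc g g-asc) (ℓ-left-ascent i f f-asc) (ℓ-left-ascent i g g-asc)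
        one : fixedPositions k f g₊ ≡ fixedPositions k f₊ g
        one = fixed-one k i f g α β fα fβ (asc f f-asc) (asc g g-asc) (ℓ-left-ascent i f f-asc) (ℓ-left-ascent i g g-asc)

      related : Outcome k i f g α β fα fβ (asc f f-asc) (asc g g-asc) (ℓ-left-ascent i f f-asc) (ℓ-left-ascent i g g-asc)
      related = outcome k i f g α β fα fβ (asc f f-asc) (asc g g-asc) (ℓ-left-ascent i f f-asc) (ℓ-left-ascent i g g-asc)

      private
        weight₊₊ : weight f₊ g₊ ≡ at-values f₊ (fixedPositions k f g)
        weight₊₊ = cong (at-values f₊) both
        weight₋₊ : weight f g₊ ≡ at-values f (fixedPositions k f₊ g)
        weight₋₊ = cong (at-values f) one
        σ-involution : ∀ as → at-values f₊ as [ σ ] ≈ at-values f as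
        σ-involution as = ≈-trans (at-values-[] i f₊ as) (≡⇒≈ (cong (ev j) (values-cong (s i · f₊) f as (λ {a} _ → s-involutiveˡ i f a))))
        weight₊₊-σ : weight f₊ g₊ [ σ ] ≈ weight f g
        weight₊₊-σ = ≈-trans (≡⇒≈ (cong (_[ σ ]) weight₊₊)) (σ-involution _)
        values-avoiding : ∀ {as} → (∀ {a} → a ∈ as → a ≢ α × a ≢ β) → map (λ a → var y[ f₊ ⟨$⟩ a ]) as ≡ map (λ a → var y[ f ⟨$⟩ a ]) as
        values-avoiding av = values-cong f₊ f _ λ {a} a∈ → sw-other
          (λ e → proj₁ (av a∈) (sym (⁻¹-≡ f e))) (λ e → proj₂ (av a∈) (sym (⁻¹-≡ f e)))

        Avoids : List ℕ → Set
        Avoids as = ∀ {a} → a ∈ as → a ≢ α × a ≢ β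

        -- At α the permutation f₊ has i + 1 where f has i. The correction term of `ev-head` for
        -- these two values is cancelled by the added multiple of d.
        exchange-α : ∀ {as} → Avoids as → at-values f₊ (α ∷ as) + d * at-values f as ≈ at-values f (α ∷ as)
        exchange-α {as} av = begin
          ev j (var y[ f₊ ⟨$⟩ α ] ∷ Vs₊) + d * ev j Vs
            ≡⟨ cong₂ (λ v vs → ev j (var y[ v ] ∷ vs) + d * ev j Vs) f₊-α (values-avoiding av) ⟩
          ev j (var y[ suc i ] ∷ Vs) + d * ev j Vs
            ≈⟨ +-cong (ev-head j (var y[ suc i ]) (var y[ i ]) Vs) ≈-refl ⟩
          ev j (var y[ i ] ∷ Vs) + (var y[ suc i ] - var y[ i ]) * ev j Vs + d * ev j Vs
            ≈⟨ solve 4 (λ e a b r → e :+ (b :- a) :* r :+ (a :- b) :* r := e) ≈-refl _ (var y[ i ]) (var y[ suc i ]) (ev j Vs) ⟩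
          ev j (var y[ i ] ∷ Vs)          ≡⟨ cong (λ v → ev j (var y[ v ] ∷ Vs)) fα ⟨
          ev j (var y[ f ⟨$⟩ α ] ∷ Vs)    ∎
          where
          Vs₊ = map (λ a → var y[ f₊ ⟨$⟩ a ]) as
          Vs = map (λ a → var y[ f ⟨$⟩ a ]) as

        exchange-β : ∀ {as} → Avoids as → at-values f₊ (β ∷ as) ≈ at-values f (β ∷ as) + d * at-values f as
        exchange-β {as} av = begin
          ev j (var y[ f₊ ⟨$⟩ β ] ∷ Vs₊)  ≡⟨ cong₂ (λ v vs → ev j (var y[ v ] ∷ vs)) f₊-β (values-avoiding av) ⟩
          ev j (var y[ i ] ∷ Vs)          ≈⟨ ev-head j (var y[ i ]) (var y[ suc i ]) Vs ⟩
          ev j (var y[ suc i ] ∷ Vs) + d * ev j Vs ≡⟨ cong (λ v → ev j (var y[ v ] ∷ Vs) + d * ev j Vs) fβ ⟨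
          ev j (var y[ f ⟨$⟩ β ] ∷ Vs) + d * ev j Vs ∎
          where
          Vs₊ = map (λ a → var y[ f₊ ⟨$⟩ a ]) as
          Vs = map (λ a → var y[ f ⟨$⟩ a ]) as

        zeros : ∀ {A B D} → A ≡ 0ₚ → B ≡ 0ₚ → D ≡ 0ₚ → A + d * B ≈ D [ σ ]
        zeros refl refl refl = solve 1 (λ d → :con (+ 0) :+ d :* :con (+ 0) := :con (+ 0)) ≈-refl d

        matched : ∀ {u w} → Dec (_⇢_ k u w) → ∀ {u′ w′} → (_⇢_ k u w → _⇢_ k u′ w′) → (_⇢_ k u′ w′ → _⇢_ k u w) →
                  weight u′ w′ ≈ weight u w [ σ ] → coeff u′ w′ ≈ coeff u w [ σ ]
        matched (yes p) to _ e = ≈-trans (≡⇒≈ (coeff-yes (to p))) (≈-trans e (≡⇒≈ (cong (_[ σ ]) (sym (coeff-yes p)))))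
        matched (no ¬p) _ back _ = ≡⇒≈ (trans (coeff-no (¬p ∘ back)) (cong (_[ σ ]) (sym (coeff-no ¬p))))

        plus-0 : ∀ {A B} → B ≡ 0ₚ → A + d * B ≈ A
        plus-0 {A} refl = solve 2 (λ a d → a :+ d :* :con (+ 0) := a) ≈-refl A d

        plus-0-σ : ∀ {A B} → B ≡ 0ₚ → A + d * B [ σ ] ≈ A
        plus-0-σ {A} refl = plus-0 {A} refl

        0-plus : ∀ {A D B G} → A ≡ 0ₚ → D ≡ 0ₚ → B ≈ G [ σ ] → A + d * B ≈ D [ σ ] + d * G [ σ ]
        0-plus refl refl e = +-cong ≈-refl (*-cong ≈-refl e)

      -- The three-term recursion for the coefficients, at s i · g and at g.
      Coupled : Set
      Coupled = (coeff f₊ g₊ + d * coeff f g₊ ≈ coeff f₊ g₊ [ σ ]) ×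
                (coeff f₊ g + d * coeff f g ≈ coeff f₊ g [ σ ] + d * coeff f₊ g₊ [ σ ])

      -- In each outcome the two identities reduce to trivial ones and to three facts: σ carries the
      -- weight of f₊ and g₊ to that of f and g; a weight in which y_i and y_{i+1} both occur or
      -- both are absent is fixed by σ; and `ev-head` applies when exactly one of them occurs.
      couple : Outcome k i f g α β fα fβ (asc f f-asc) (asc g g-asc) (ℓ-left-ascent i f f-asc) (ℓ-left-ascent i g g-asc) → Coupled
      couple (only-lower ¬b ¬c ¬e hα hβ) = zeros (coeff-no ¬b) (coeff-no ¬e) (coeff-no ¬b) , (begin
        coeff f₊ g + d * coeff f g                 ≈⟨ plus-0 (coeff-no ¬c) ⟩
        coeff f₊ g                                 ≈⟨ matched (f₊ ⇢? g) (λ p → p) (λ p → p) (≈-trans (≡⇒≈ (cong (ev j) (values-avoiding av))) (≈-sym (σ-involution _))) ⟩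
        coeff f₊ g [ σ ]                           ≈⟨ plus-0-σ (coeff-no ¬b) ⟨
        coeff f₊ g [ σ ] + d * coeff f₊ g₊ [ σ ]   ∎)
        where
        av : Avoids (fixedPositions k f₊ g)
        av a∈ with ∈-fixed f₊ g a∈
        ... | a<k , e = (λ { refl → hα a<k (trans (sym e) f₊-α) }) , (λ { refl → hβ a<k (trans (sym e) f₊-β) })
      couple (all-but-lower ¬a b→c c→e e→b gα perm) = first (f₊ ⇢? g₊)
          , 0-plus {D = coeff f₊ g} {G = coeff f₊ g₊} (coeff-no ¬a) (coeff-no ¬a) (matched (f₊ ⇢? g₊) b→c (e→b ∘ c→e) (≈-sym weight₊₊-σ))
        where
        av : Avoids (fixedPositions k f₊ g)
        av a∈ with ∈-fixed f₊ g a∈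
        ... | _ , e = (λ { refl → i≢1+i (trans (sym gα) (trans (sym e) f₊-α)) })
                    , (λ { refl → >⇒≢ f-asc (⟨$⟩-injective g (trans (trans (sym e) f₊-β) (sym gα))) })
        first : Dec (_⇢_ k f₊ g₊) → coeff f₊ g₊ + d * coeff f g₊ ≈ coeff f₊ g₊ [ σ ]
        first (no ¬b) = zeros (coeff-no ¬b) (coeff-no (¬b ∘ e→b)) (coeff-no ¬b)
        first (yes b) = begin
          coeff f₊ g₊ + d * coeff f g₊
            ≡⟨ cong₂ (λ P Q → P + d * Q) (trans (coeff-yes b) weight₊₊) (trans (coeff-yes (c→e (b→c b))) weight₋₊) ⟩
          at-values f₊ (fixedPositions k f g) + d * at-values f (fixedPositions k f₊ g)
            ≈⟨ +-cong (at-values-↭ f₊ perm) ≈-refl ⟩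
          at-values f₊ (α ∷ fixedPositions k f₊ g) + d * at-values f (fixedPositions k f₊ g)
            ≈⟨ exchange-α av ⟩
          at-values f (α ∷ fixedPositions k f₊ g)     ≈⟨ at-values-↭ f (↭-sym perm) ⟩
          weight f g                                  ≈⟨ weight₊₊-σ ⟨
          weight f₊ g₊ [ σ ]                          ≡⟨ cong (_[ σ ]) (coeff-yes b) ⟨
          coeff f₊ g₊ [ σ ]                           ∎
      couple (to-lower ¬b ¬e a→c c→a gα perm) = zeros (coeff-no ¬b) (coeff-no ¬e) (coeff-no ¬b)
          , ≈-trans (second (f₊ ⇢? g)) (≈-sym (plus-0-σ (coeff-no ¬b)))
        where
        av : Avoids (fixedPositions k f g)
        av a∈ with ∈-fixed f g a∈
        ... | _ , e = (λ { refl → i≢1+i (trans (sym fα) (trans e gα)) })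
                    , (λ { refl → >⇒≢ f-asc (⟨$⟩-injective g (trans (trans (sym e) fβ) (sym gα))) })
        second : Dec (_⇢_ k f₊ g) → coeff f₊ g + d * coeff f g ≈ coeff f₊ g [ σ ]
        second (no ¬a) = zeros (coeff-no ¬a) (coeff-no (¬a ∘ c→a)) (coeff-no ¬a)
        second (yes a) = begin
          coeff f₊ g + d * coeff f g                  ≡⟨ cong₂ (λ P Q → P + d * Q) (coeff-yes a) (coeff-yes (a→c a)) ⟩
          weight f₊ g + d * weight f g                ≈⟨ +-cong (at-values-↭ f₊ perm) ≈-refl ⟩
          at-values f₊ (α ∷ fixedPositions k f g) + d * weight f g ≈⟨ exchange-α av ⟩
          at-values f (α ∷ fixedPositions k f g)      ≈⟨ at-values-↭ f (↭-sym perm) ⟩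
          at-values f (fixedPositions k f₊ g)         ≈⟨ σ-involution _ ⟨
          weight f₊ g [ σ ]                           ≡⟨ cong (_[ σ ]) (coeff-yes a) ⟨
          coeff f₊ g [ σ ]                            ∎
      couple (from-upper ¬c ¬e a→b b→a gβ perm) = (begin
        coeff f₊ g₊ + d * coeff f g₊                  ≈⟨ plus-0 (coeff-no ¬e) ⟩
        coeff f₊ g₊                                   ≈⟨ matched (f₊ ⇢? g₊) (λ p → p) (λ p → p) (≈-trans (≡⇒≈ (trans weight₊₊ (cong (ev j) (values-avoiding av)))) (≈-sym weight₊₊-σ)) ⟩
        coeff f₊ g₊ [ σ ]                             ∎)
          , ≈-trans (plus-0 (coeff-no ¬c)) (second (f₊ ⇢? g))
        where
        av : Avoids (fixedPositions k f g)
        av a∈ with ∈-fixed f g a∈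
        ... | _ , e = (λ { refl → <⇒≢ f-asc (⟨$⟩-injective g (trans (trans (sym e) fα) (sym gβ))) })
                    , (λ { refl → i≢1+i (trans (sym gβ) (trans (sym e) fβ)) })
        second : Dec (_⇢_ k f₊ g) → coeff f₊ g ≈ coeff f₊ g [ σ ] + d * coeff f₊ g₊ [ σ ]
        second (no ¬a) = begin
          coeff f₊ g                                  ≡⟨ trans (coeff-no ¬a) (cong (_[ σ ]) (sym (coeff-no ¬a))) ⟩
          coeff f₊ g [ σ ]                            ≈⟨ plus-0-σ (coeff-no (¬a ∘ b→a)) ⟨
          coeff f₊ g [ σ ] + d * coeff f₊ g₊ [ σ ]    ∎
        second (yes a) = begin
          coeff f₊ g                                  ≡⟨ coeff-yes a ⟩
          weight f₊ g                                 ≈⟨ at-values-↭ f₊ perm ⟩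
          at-values f₊ (β ∷ fixedPositions k f g)     ≈⟨ exchange-β av ⟩
          at-values f (β ∷ fixedPositions k f g) + d * weight f g
            ≈⟨ +-cong (≈-trans (at-values-↭ f (↭-sym perm)) (≈-sym (σ-involution _))) (*-cong ≈-refl (≈-sym weight₊₊-σ)) ⟩
          weight f₊ g [ σ ] + d * weight f₊ g₊ [ σ ]  ≡⟨ cong₂ (λ P Q → P [ σ ] + d * Q [ σ ]) (coeff-yes a) (coeff-yes (a→b a)) ⟨
          coeff f₊ g [ σ ] + d * coeff f₊ g₊ [ σ ]    ∎
      couple (parallel ¬a ¬e b→c c→b side) = (begin
        coeff f₊ g₊ + d * coeff f g₊                  ≈⟨ plus-0 (coeff-no ¬e) ⟩
        coeff f₊ g₊                                   ≈⟨ matched (f₊ ⇢? g₊) (λ p → p) (λ p → p) (≈-trans (≡⇒≈ weight₊₊) (≈-trans (same side) (≈-sym weight₊₊-σ))) ⟩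
        coeff f₊ g₊ [ σ ]                             ∎)
          , 0-plus {D = coeff f₊ g} {G = coeff f₊ g₊} (coeff-no ¬a) (coeff-no ¬a) (matched (f₊ ⇢? g₊) b→c c→b (≈-sym weight₊₊-σ))
        where
        X = fixedPositions k f g
        same : ((α < k → g ⟨$⟩ α ≢ i) × (β < k → g ⟨$⟩ β ≢ suc i)) ⊎ (α < k × β < k × g ⟨$⟩ α ≡ i × g ⟨$⟩ β ≡ suc i) →
               at-values f₊ X ≈ at-values f X
        same (inj₁ (hα , hβ)) = ≡⇒≈ (cong (ev j) (values-avoiding av))
          where
          av : Avoids X
          av a∈ with ∈-fixed f g a∈
          ... | a<k , e = (λ { refl → hα a<k (trans (sym e) fα) }) , (λ { refl → hβ a<k (trans (sym e) fβ) })
        same (inj₂ (α<k , β<k , gα , gβ)) = begin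
          at-values f₊ X             ≈⟨ at-values-↭ f₊ perm ⟩
          at-values f₊ (β ∷ α ∷ Y)   ≡⟨ cong₂ (λ v v′ → ev j (var y[ v ] ∷ var y[ v′ ] ∷ map (λ a → var y[ f₊ ⟨$⟩ a ]) Y)) (trans f₊-β (sym fα)) (trans f₊-α (sym fβ)) ⟩
          ev j (var y[ f ⟨$⟩ α ] ∷ var y[ f ⟨$⟩ β ] ∷ map (λ a → var y[ f₊ ⟨$⟩ a ]) Y)
            ≡⟨ cong (λ vs → ev j (var y[ f ⟨$⟩ α ] ∷ var y[ f ⟨$⟩ β ] ∷ vs)) (values-avoiding av) ⟩
          at-values f (α ∷ β ∷ Y)    ≈⟨ at-values-↭ f (↭-trans (↭.swap α β ↭-refl) (↭-sym perm)) ⟩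
          at-values f X              ∎
          where
          P? = λ a → f ⟨$⟩ a ℕ.≟ g ⟨$⟩ a
          Q? = λ a → P? a ×-dec ¬? (a ℕ.≟ β)
          R? = λ a → Q? a ×-dec ¬? (a ℕ.≟ α)
          Y = filter R? (upTo k)
          perm : X ↭ β ∷ α ∷ Y
          perm = ↭-trans
            (filter-insert P? Q? (upTo k) (upTo⁺ k) (∈-upTo⁺ β<k) (trans fβ (sym gβ)) (λ q → proj₂ q refl) (λ _ ne p → p , ne) (λ _ _ → proj₁))
            (prep β (filter-insert Q? R? (upTo k) (upTo⁺ k) (∈-upTo⁺ α<k) (trans fα (sym gα) , <⇒≢ f-asc) (λ r → proj₂ r refl) (λ _ ne q → q , ne) (λ _ _ → proj₁)))
          av : Avoids Y
          av a∈ with ∈-filter⁻ R? {xs = upTo k} a∈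
          ... | _ , (_ , a≢β) , a≢α = a≢α , a≢β

      coupled : Coupled
      coupled = couple related

      -- This and the next fact provide the support for f: whatever f reaches is, up to left
      -- multiplication by s_i, reached by f₊.
      lower-reachable : _⇢_ k f g → _⇢_ k f₊ g ⊎ _⇢_ k f₊ g₊
      lower-reachable = go related
        where
        go : Outcome k i f g α β fα fβ (asc f f-asc) (asc g g-asc) (ℓ-left-ascent i f f-asc) (ℓ-left-ascent i g g-asc) →
             _⇢_ k f g → _⇢_ k f₊ g ⊎ _⇢_ k f₊ g₊
        go (only-lower _ ¬c _ _ _) c          = contradiction c ¬c
        go (all-but-lower _ _ c→e e→b _ _) c  = inj₂ (e→b (c→e c))
        go (to-lower _ _ _ c→a _ _) c         = inj₁ (c→a c)
        go (from-upper ¬c _ _ _ _ _) c        = contradiction c ¬c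
        go (parallel _ _ _ c→b _) c           = inj₂ (c→b c)

      upper-reachable : _⇢_ k f g₊ → _⇢_ k f₊ g₊
      upper-reachable = go related
        where
        go : Outcome k i f g α β fα fβ (asc f f-asc) (asc g g-asc) (ℓ-left-ascent i f f-asc) (ℓ-left-ascent i g g-asc) →
             _⇢_ k f g₊ → _⇢_ k f₊ g₊
        go (only-lower _ _ ¬e _ _) e       = contradiction e ¬e
        go (all-but-lower _ _ _ e→b _ _) e = e→b e
        go (to-lower _ ¬e _ _ _ _) e       = contradiction e ¬e
        go (from-upper _ ¬e _ _ _ _) e     = contradiction e ¬e
        go (parallel _ ¬e _ _ _) e         = contradiction e ¬e

-- The inductive step

module _ (k j : ℕ) where

  term : S∞ → S∞ → Poly
  term u w = coeff k j u w * 𝔖 w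

  term-≋ : ∀ u u′ w w′ → u ≋ u′ → w ≋ w′ → term u w ≈ term u′ w′
  term-≋ u u′ w w′ p q = *-cong (≡⇒≈ (coeff-≋ k j u w u′ w′ p q)) (𝔖-≋ w w′ q)

  elementary-x : Poly
  elementary-x = ev j (map (λ r → var x[ r ]) (upTo k))

  elementary-x-y-act : ∀ i → elementary-x [ y-act i ] ≈ elementary-x
  elementary-x-y-act i = ≈-trans (ev-[] j (y-act i) (map (λ r → var x[ r ]) (upTo k)) (λ _ → ≈-refl))
    (≡⇒≈ (cong (ev j) (sym (map-∘ (upTo k)))))

  -- The support need only contain what is reachable; further permutations have coefficient zero.
  -- This leaves room for closing it under s_i.
  record PieriExpansion (u : S∞) : Set where
    field
      support   : List S∞
      distinct  : Distinct support
      complete  : ∀ w → _⇢_ k u w → w ∈≋ support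
      expansion : 𝔖 u * elementary-x ≈ ∑ (map (term u) support)

  open PieriExpansion

  outside-support : ∀ {u} (e : PieriExpansion u) w → w ∈≋ support e ⊎ term u w ≈ 0ₚ
  outside-support {u} e w = go (_⇢?_ k u w)
    where
    go : Dec (_⇢_ k u w) → w ∈≋ support e ⊎ term u w ≈ 0ₚ
    go (yes p) = inj₁ (complete e w p)
    go (no ¬p) = inj₂ (≈-trans (*-cong (≡⇒≈ (coeff-no k j ¬p)) ≈-refl) (zeroˡ _))

  expansion-≋ : ∀ u v → u ≋ v → PieriExpansion u → PieriExpansion v
  expansion-≋ u v p e = record
    { support   = support e
    ; distinct  = distinct e
    ; complete  = λ w r → complete e w (⇢-≋ k v w u w (λ i → sym (p i)) (λ _ → refl) r)
    ; expansion = ≈-trans (*-cong (𝔖-≋ v u (λ i → sym (p i))) ≈-refl) (≈-trans (expansion e)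
                    (∑-cong (support e) λ w _ → term-≋ u v w w p (λ _ → refl)))
    }

  module Descend (i : ℕ) (f : S∞) (f-asc : f ⁻¹ ⟨$⟩ i < f ⁻¹ ⟨$⟩ suc i) (e : PieriExpansion (s i · f)) where

    private
      f₊ = s i · f
      σ = y-act i
      d = δʸ i
      ws = support e
      -- Closed under s_i, so that the sum of the `H (s i · w)` can be reindexed.
      vs = dedup (ws ++ map (s i ·_) ws)

    s-ascending : ∀ w → LeftDescent i w → (s i · w) ⁻¹ ⟨$⟩ i < (s i · w) ⁻¹ ⟨$⟩ suc i
    s-ascending w = subst₂ _<_ (sym (s·-⁻¹-i i w)) (sym (s·-⁻¹-suc i w))

    s-descending : ∀ w → w ⁻¹ ⟨$⟩ i < w ⁻¹ ⟨$⟩ suc i → LeftDescent i (s i · w)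
    s-descending w = subst₂ _<_ (sym (s·-⁻¹-suc i w)) (sym (s·-⁻¹-i i w))

    ∈-vs : ∀ w → w ∈≋ ws → w ∈≋ vs
    ∈-vs w (v , v∈ , p) = ∈-dedup⁺ _ w (v , ∈-++⁺ˡ v∈ , p)

    vs-closed : ∀ w → w ∈≋ vs → (s i · w) ∈≋ vs
    vs-closed w (v , v∈ , p) with ∈-++⁻ ws (∈-dedup⁻ _ v∈)
    ... | inj₁ v∈ws = ∈-dedup⁺ _ (s i · w) (s i · v , ∈-++⁺ʳ ws (∈-map⁺ (s i ·_) v∈ws) , λ a → cong (s i ⟨$⟩_) (p a))
    ... | inj₂ v∈map with ∈-map⁻ (s i ·_) v∈map
    ...   | v′ , v′∈ , refl = ∈-dedup⁺ _ (s i · w) (v′ , ∈-++⁺ˡ v′∈ , λ a → trans (cong (s i ⟨$⟩_) (p a)) (s-involutiveˡ i v′ a))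

    ∑-vs : ∑ (map (term f₊) ws) ≈ ∑ (map (term f₊) vs)
    ∑-vs = ∑-agree (term f₊) (λ u v → term-≋ f₊ f₊ u v (λ _ → refl)) ws vs (distinct e) (dedup-distinct _)
      (λ w w∈ → inj₁ (∈-vs w (w , w∈ , λ _ → refl))) (λ w _ → outside-support e w)

    coeff-ss : ∀ u w → coeff k j u (s i · (s i · w)) ≡ coeff k j u w
    coeff-ss u w = coeff-≋ k j u (s i · (s i · w)) u w (λ _ → refl) (s-involutiveˡ i w)

    -- The multiple of 𝔖 w that comes from the term of s_i w when σ is applied; there is one only if
    -- s_i w is longer than w. The decision is an argument, so that either value is reached by
    -- distinguishing its two forms.
    H′ : ∀ w → Dec (w ⁻¹ ⟨$⟩ i < w ⁻¹ ⟨$⟩ suc i) → Poly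
    H′ w (yes _) = d * coeff k j f₊ (s i · w) [ σ ] * 𝔖 w
    H′ w (no _)  = 0ₚ

    H : S∞ → Poly
    H w = H′ w (w ⁻¹ ⟨$⟩ i ℕ.<? w ⁻¹ ⟨$⟩ suc i)

    H-ascending : ∀ w → w ⁻¹ ⟨$⟩ i < w ⁻¹ ⟨$⟩ suc i → H w ≡ d * coeff k j f₊ (s i · w) [ σ ] * 𝔖 w
    H-ascending w lt = go (w ⁻¹ ⟨$⟩ i ℕ.<? w ⁻¹ ⟨$⟩ suc i)
      where
      go : ∀ D → H′ w D ≡ d * coeff k j f₊ (s i · w) [ σ ] * 𝔖 w
      go (yes _) = refl
      go (no ¬p) = contradiction lt ¬p

    H-descending : ∀ w → LeftDescent i w → H w ≡ 0ₚ
    H-descending w gt = go (w ⁻¹ ⟨$⟩ i ℕ.<? w ⁻¹ ⟨$⟩ suc i)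
      where
      go : ∀ D → H′ w D ≡ 0ₚ
      go (yes p) = contradiction p (<-asym gt)
      go (no _)  = refl

    asc-or-desc : ∀ w → w ⁻¹ ⟨$⟩ i < w ⁻¹ ⟨$⟩ suc i ⊎ LeftDescent i w
    asc-or-desc w = ≢⇒<⊎> (⁻¹-≢ w (1+n≢n ∘ sym))

    H-≋ : ∀ u v → u ≋ v → H u ≈ H v
    H-≋ u v p = go (asc-or-desc u)
      where
      go : u ⁻¹ ⟨$⟩ i < u ⁻¹ ⟨$⟩ suc i ⊎ LeftDescent i u → H u ≈ H v
      go (inj₁ lt) = ≈-trans (≡⇒≈ (H-ascending u lt)) (≈-trans
        (*-cong (*-cong ≈-refl (≡⇒≈ (cong (_[ σ ]) (coeff-≋ k j f₊ (s i · u) f₊ (s i · v) (λ _ → refl) λ a → cong (s i ⟨$⟩_) (p a))))) (𝔖-≋ u v p))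
        (≡⇒≈ (sym (H-ascending v (subst₂ _<_ (⁻¹-cong u v p i) (⁻¹-cong u v p (suc i)) lt)))))
      go (inj₂ gt) = ≡⇒≈ (trans (H-descending u gt) (sym (H-descending v (left-descent-cong i u v p gt))))

    A : S∞ → Poly
    A w = coeff k j f₊ w [ σ ] * 𝔖 w

    apply-σ : ∀ w → term f₊ w [ σ ] ≈ A w + H (s i · w)
    apply-σ w = go (asc-or-desc w)
      where
      Cσ = coeff k j f₊ w [ σ ]
      go : w ⁻¹ ⟨$⟩ i < w ⁻¹ ⟨$⟩ suc i ⊎ LeftDescent i w → Cσ * 𝔖 w [ σ ] ≈ Cσ * 𝔖 w + H (s i · w)
      go (inj₁ lt) = begin
        Cσ * 𝔖 w [ σ ]            ≈⟨ *-cong ≈-refl (𝔖-y-act-ascent i w lt) ⟩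
        Cσ * 𝔖 w                  ≈⟨ solve 1 (λ a → a := a :+ :con (+ 0)) ≈-refl (Cσ * 𝔖 w) ⟩
        Cσ * 𝔖 w + 0ₚ             ≡⟨ cong (λ P → Cσ * 𝔖 w + P) (H-descending (s i · w) (s-descending w lt)) ⟨
        Cσ * 𝔖 w + H (s i · w)    ∎
      go (inj₂ gt) = begin
        Cσ * 𝔖 w [ σ ]                            ≈⟨ *-cong ≈-refl (𝔖-y-act-descent i w gt) ⟩
        Cσ * (𝔖 w + d * 𝔖 (s i · w))              ≈⟨ solve 4 (λ a b d e → a :* (b :+ d :* e) := a :* b :+ d :* a :* e) ≈-refl Cσ (𝔖 w) d (𝔖 (s i · w)) ⟩
        Cσ * 𝔖 w + d * Cσ * 𝔖 (s i · w)           ≡⟨ cong (λ P → Cσ * 𝔖 w + d * P [ σ ] * 𝔖 (s i · w)) (coeff-ss f₊ w) ⟨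
        Cσ * 𝔖 w + d * coeff k j f₊ (s i · (s i · w)) [ σ ] * 𝔖 (s i · w) ≡⟨ cong (λ P → Cσ * 𝔖 w + P) (H-ascending (s i · w) (s-ascending w gt)) ⟨
        Cσ * 𝔖 w + H (s i · w)                    ∎

    -- The recursion enters here: at an ascending w through its second identity, otherwise through
    -- the first one with s_i w in the place of g.
    collect : ∀ w → A w + H w ≈ term f₊ w + d * term f w
    collect w = go (asc-or-desc w)
      where
      Cσ = coeff k j f₊ w [ σ ]
      go : w ⁻¹ ⟨$⟩ i < w ⁻¹ ⟨$⟩ suc i ⊎ LeftDescent i w → Cσ * 𝔖 w + H w ≈ term f₊ w + d * term f w
      go (inj₁ lt) = begin
        Cσ * 𝔖 w + H w                                            ≡⟨ cong (λ P → Cσ * 𝔖 w + P) (H-ascending w lt) ⟩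
        Cσ * 𝔖 w + d * coeff k j f₊ (s i · w) [ σ ] * 𝔖 w         ≈⟨ solve 4 (λ a b d e → a :* b :+ d :* e :* b := (a :+ d :* e) :* b) ≈-refl Cσ (𝔖 w) d _ ⟩
        (Cσ + d * coeff k j f₊ (s i · w) [ σ ]) * 𝔖 w             ≈⟨ *-cong (≈-sym (proj₂ (coupled k j i f w f-asc lt))) ≈-refl ⟩
        (coeff k j f₊ w + d * coeff k j f w) * 𝔖 w                ≈⟨ solve 4 (λ a b d e → (a :+ d :* e) :* b := a :* b :+ d :* (e :* b)) ≈-refl (coeff k j f₊ w) (𝔖 w) d (coeff k j f w) ⟩
        term f₊ w + d * term f w                                  ∎
      go (inj₂ gt) = begin
        Cσ * 𝔖 w + H w                                            ≡⟨ cong₂ (λ P Q → P [ σ ] * 𝔖 w + Q) (sym (coeff-ss f₊ w)) (H-descending w gt) ⟩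
        coeff k j f₊ (s i · (s i · w)) [ σ ] * 𝔖 w + 0ₚ           ≈⟨ +-cong (*-cong (≈-sym (proj₁ (coupled k j i f (s i · w) f-asc (s-ascending w gt)))) ≈-refl) ≈-refl ⟩
        (coeff k j f₊ (s i · (s i · w)) + d * coeff k j f (s i · (s i · w))) * 𝔖 w + 0ₚ
          ≡⟨ cong₂ (λ P Q → (P + d * Q) * 𝔖 w + 0ₚ) (coeff-ss f₊ w) (coeff-ss f w) ⟩
        (coeff k j f₊ w + d * coeff k j f w) * 𝔖 w + 0ₚ           ≈⟨ solve 4 (λ a b d e → (a :+ d :* e) :* b :+ :con (+ 0) := a :* b :+ d :* (e :* b)) ≈-refl (coeff k j f₊ w) (𝔖 w) d (coeff k j f w) ⟩
        term f₊ w + d * term f w                                  ∎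

    reindex : ∑ (map (λ w → H (s i · w)) vs) ≈ ∑ (map H vs)
    reindex = ≈-trans (≡⇒≈ (cong ∑ (map-∘ vs))) (∑-agree H H-≋ (map (s i ·_) vs) vs
      (map-distinct (dedup-distinct _)) (dedup-distinct _) to back)
      where
      map-distinct : ∀ {ws} → Distinct ws → Distinct (map (s i ·_) ws)
      map-distinct [] = []
      map-distinct (_∷_ {x = w} {xs = ws} w∉ dis) = Allₚ.map⁺ (All.map (λ ne p → ne (λ a → ⟨$⟩-injective (s i) (p a))) w∉) ∷ map-distinct dis
      to : ∀ w → w ∈ map (s i ·_) vs → w ∈≋ vs ⊎ H w ≈ 0ₚ
      to w w∈ with ∈-map⁻ (s i ·_) w∈
      ... | v , v∈ , refl = inj₁ (vs-closed v (v , v∈ , λ _ → refl))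
      back : ∀ w → w ∈ vs → w ∈≋ map (s i ·_) vs ⊎ H w ≈ 0ₚ
      back w w∈ with vs-closed w (w , w∈ , λ _ → refl)
      ... | v , v∈ , p = inj₁ (s i · v , ∈-map⁺ (s i ·_) v∈ , λ a → trans (sym (s-involutiveˡ i w a)) (cong (s i ⟨$⟩_) (p a)))

    f₊-descends : LeftDescent i f₊
    f₊-descends = s-descending f f-asc

    -- The left side is σ applied to the product 𝔖 f₊ times E, the right side is σ applied to its
    -- known expansion. The product for f₊ stays on both sides, to be subtracted before d is
    -- cancelled.
    scaled : 𝔖 f₊ * elementary-x + d * (𝔖 f * elementary-x) ≈ 𝔖 f₊ * elementary-x + d * ∑ (map (term f) vs)
    scaled = begin
      𝔖 f₊ * X + d * (𝔖 f * X)                  ≈⟨ solve 4 (λ a b d x → a :* x :+ d :* (b :* x) := (a :+ d :* b) :* x) ≈-refl (𝔖 f₊) (𝔖 f) d X ⟩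
      (𝔖 f₊ + d * 𝔖 f) * X                      ≈⟨ *-cong (+-cong ≈-refl (*-cong ≈-refl (𝔖-≋ f (s i · f₊) (λ a → sym (s-involutiveˡ i f a))))) ≈-refl ⟩
      (𝔖 f₊ + d * 𝔖 (s i · f₊)) * X             ≈⟨ *-cong (≈-sym (𝔖-y-act-descent i f₊ f₊-descends)) (≈-sym (elementary-x-y-act i)) ⟩
      (𝔖 f₊ * X) [ σ ]                          ≈⟨ []-cong σ (≈-trans (expansion e) ∑-vs) ⟩
      ∑ (map (term f₊) vs) [ σ ]                ≡⟨ ∑-[] σ (term f₊) vs ⟩
      ∑ (map (λ w → term f₊ w [ σ ]) vs)        ≈⟨ ∑-cong vs (λ w _ → apply-σ w) ⟩
      ∑ (map (λ w → A w + H (s i · w)) vs)      ≈⟨ ∑-+ A (λ w → H (s i · w)) vs ⟩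
      ∑ (map A vs) + ∑ (map (λ w → H (s i · w)) vs) ≈⟨ +-cong ≈-refl reindex ⟩
      ∑ (map A vs) + ∑ (map H vs)               ≈⟨ ∑-+ A H vs ⟨
      ∑ (map (λ w → A w + H w) vs)              ≈⟨ ∑-cong vs (λ w _ → collect w) ⟩
      ∑ (map (λ w → term f₊ w + d * term f w) vs) ≈⟨ ∑-+ (term f₊) (λ w → d * term f w) vs ⟩
      ∑ (map (term f₊) vs) + ∑ (map (λ w → d * term f w) vs) ≈⟨ +-cong (≈-sym (≈-trans (expansion e) ∑-vs)) (∑-* d (term f) vs) ⟩
      𝔖 f₊ * X + d * ∑ (map (term f) vs)        ∎
      where X = elementary-x

    descended : PieriExpansion f
    descended = record
      { support   = vs
      ; distinct  = dedup-distinct _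
      ; complete  = complete′
      ; expansion = *-cancelˡ-δʸ i _ _ (begin
          d * (𝔖 f * X)                          ≈⟨ solve 2 (λ a b → b := a :+ b :- a) ≈-refl (𝔖 f₊ * X) _ ⟩
          𝔖 f₊ * X + d * (𝔖 f * X) - 𝔖 f₊ * X    ≈⟨ +-cong scaled ≈-refl ⟩
          𝔖 f₊ * X + d * ∑ (map (term f) vs) - 𝔖 f₊ * X ≈⟨ solve 2 (λ a b → a :+ b :- a := b) ≈-refl (𝔖 f₊ * X) _ ⟩
          d * ∑ (map (term f) vs)                ∎)
      }
      where
      X = elementary-x
      back : ∀ w → (s i · w) ∈≋ vs → w ∈≋ vs
      back w (v , v∈ , p) with vs-closed v (v , v∈ , λ _ → refl)
      ... | v′ , v′∈ , q = v′ , v′∈ , λ a → trans (sym (s-involutiveˡ i w a)) (trans (cong (s i ⟨$⟩_) (p a)) (q a))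
      complete′ : ∀ w → _⇢_ k f w → w ∈≋ vs
      complete′ w r = go (asc-or-desc w)
        where
        go : w ⁻¹ ⟨$⟩ i < w ⁻¹ ⟨$⟩ suc i ⊎ LeftDescent i w → w ∈≋ vs
        go (inj₁ lt) = at-lower (lower-reachable k j i f w f-asc lt r)
          where
          at-lower : _⇢_ k f₊ w ⊎ _⇢_ k f₊ (s i · w) → w ∈≋ vs
          at-lower (inj₁ a) = ∈-vs w (complete e w a)
          at-lower (inj₂ b) = back w (∈-vs (s i · w) (complete e (s i · w) b))
        go (inj₂ gt) = ∈-vs w (complete e w (⇢-≋ k f₊ (s i · (s i · w)) f₊ w (λ _ → refl) (s-involutiveˡ i w)
          (upper-reachable k j i f (s i · w) f-asc (s-ascending w gt)
            (⇢-≋ k f w f (s i · (s i · w)) (λ _ → refl) (λ a → sym (s-involutiveˡ i w a)) r))))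

-- The starting point `w₀ n`

module Base (n k : ℕ) (k≤n : k ≤ n) where

  open Staircase n

  -- A records, in decreasing order, the positions below i that were exchanged
  -- with position n + 1, and B the others.
  data Sub : ℕ → List ℕ → List ℕ → Set where
    empty : Sub 0 [] []
    leave : ∀ {i A B} → Sub i A B → Sub (suc i) A (i ∷ B)
    use   : ∀ {i A B} → Sub i A B → Sub (suc i) (i ∷ A) B

  -- The exchanges are made in increasing order of positions. Each puts n - a at position n + 1,
  -- after which only a position beyond a still has a smaller value to exchange.
  raise : List ℕ → S∞
  raise []      = w₀ n
  raise (a ∷ A) = raise A · t a (suc n)

  sub-A< : ∀ {i A B} → Sub i A B → All (_< i) A
  sub-A< empty     = []
  sub-A< (leave p) = All.map m<n⇒m<1+n (sub-A< p)
  sub-A< (use p)   = n<1+n _ ∷ All.map m<n⇒m<1+n (sub-A< p)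

  sub-B< : ∀ {i A B} → Sub i A B → All (_< i) B
  sub-B< empty     = []
  sub-B< (use p)   = All.map m<n⇒m<1+n (sub-B< p)
  sub-B< (leave p) = n<1+n _ ∷ All.map m<n⇒m<1+n (sub-B< p)

  extend : ∀ {i A B m} → Sub i A B → i ≤ m → ∃[ B′ ] Sub m A B′
  extend {i} {A} p i≤m = subst (λ m → ∃[ B′ ] Sub m A B′) (m∸n+n≡m i≤m) (go _)
    where
    go : ∀ d → ∃[ B′ ] Sub (d ℕ.+ i) A B′
    go zero    = _ , p
    go (suc d) = _ , leave (proj₂ (go d))

  shrink : ∀ {i A B a} → Sub i A B → All (_< a) A → ∃[ B′ ] Sub a A B′
  shrink empty     _          = extend empty z≤n
  shrink (leave p) all        = shrink p all
  shrink (use p)   (i<a ∷ _)  = extend (use p) i<a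

  raise-other : ∀ {a A e} → e ≢ a → e ≢ suc n → raise (a ∷ A) ⟨$⟩ e ≡ raise A ⟨$⟩ e
  raise-other {a} {A} e≢a e≢1+n = cong (raise A ⟨$⟩_) (swap-other a (suc n) e≢a e≢1+n)

  raise-at : ∀ a A → raise (a ∷ A) ⟨$⟩ a ≡ raise A ⟨$⟩ suc n
  raise-at a A = cong (raise A ⟨$⟩_) (swapˡ a (suc n))

  raise-end : ∀ a A → raise (a ∷ A) ⟨$⟩ suc n ≡ raise A ⟨$⟩ a
  raise-end a A = cong (raise A ⟨$⟩_) (swapʳ a (suc n))

  raise-≥ : ∀ {i A B e} → Sub i A B → i ≤ e → e ≤ n → raise A ⟨$⟩ e ≡ n ∸ e
  raise-≥ empty     _   e≤n = reversal-≤ e≤n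
  raise-≥ (leave p) i<e e≤n = raise-≥ p (<⇒≤ i<e) e≤n
  raise-≥ {A = a ∷ A} (use p) i<e e≤n = trans (raise-other {a} {A} (>⇒≢ i<e) (<⇒≢ (s≤s e≤n))) (raise-≥ p (<⇒≤ i<e) e≤n)

  raise-above : ∀ {i A B e} → Sub i A B → i ≤ suc n → suc n < e → raise A ⟨$⟩ e ≡ e
  raise-above empty     _     lt = reversal-fixed n _ (<⇒≤ lt)
  raise-above (leave p) i≤ lt = raise-above p (<⇒≤ i≤) lt
  raise-above {A = a ∷ A} (use p) i≤ lt = trans (raise-other {a} {A} (>⇒≢ (≤-<-trans (<⇒≤ i≤) lt)) (>⇒≢ lt)) (raise-above p (<⇒≤ i≤) lt)

  raise-unused : ∀ {i A B a} → Sub i A B → a ∉ A → a ≤ n → raise A ⟨$⟩ a ≡ n ∸ a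
  raise-unused empty     _   a≤n = reversal-≤ a≤n
  raise-unused (leave p) a∉ a≤n = raise-unused p a∉ a≤n
  raise-unused {A = a′ ∷ A} (use p) a∉ a≤n = trans (raise-other {a′} {A} (a∉ ∘ here) (<⇒≢ (s≤s a≤n))) (raise-unused p (a∉ ∘ there) a≤n)

  raise-top : ∀ {i A B a} → Sub i A B → All (_< a) A → a ≤ n → n ∸ a < raise A ⟨$⟩ suc n × raise A ⟨$⟩ suc n ≤ suc n
  raise-top {a = a} empty _ a≤n = subst (n ∸ a <_) (sym top) (s≤s (m∸n≤m n a)) , ≤-reflexive top
    where
    top : w₀ n ⟨$⟩ suc n ≡ suc n
    top = reversal-fixed n (suc n) ≤-refl
  raise-top (leave p) all a≤n = raise-top p all a≤n
  raise-top {A = i ∷ A} {a = a} (use p) (i<a ∷ _) a≤n = subst (n ∸ a <_) (sym top) (∸-monoʳ-< i<a a≤n)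
    , ≤-trans (≤-reflexive top) (m≤n⇒m≤1+n (m∸n≤m n i))
    where
    top : raise (i ∷ A) ⟨$⟩ suc n ≡ n ∸ i
    top = trans (raise-end i A) (raise-≥ p ≤-refl (≤-trans (<⇒≤ i<a) a≤n))

  -- From i to n the values are still those of `w₀ n` and decrease, so none of them exceeds the
  -- value at i, whereas the value at n + 1 does.
  raise-cover : ∀ {i A B} → Sub i A B → i ≤ n → Cover (raise A) i (suc n)
  raise-cover {i} {A} p i≤n = record
    { less    = subst (_< raise A ⟨$⟩ suc n) (sym at-i) (proj₁ (raise-top p (sub-A< p) i≤n))
    ; nothing = λ (e , i<e , e<1+n , q , _) → <-asym (∸-monoʳ-< i<e (ℕ.s≤s⁻¹ e<1+n))
        (subst₂ _<_ at-i (raise-≥ p (<⇒≤ i<e) (ℕ.s≤s⁻¹ e<1+n)) q) }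
    where
    at-i : raise A ⟨$⟩ i ≡ n ∸ i
    at-i = raise-≥ p ≤-refl i≤n

  raise-≤ₖ : ∀ {i A B} → Sub i A B → i ≤ k → _≤ₖ_ k (w₀ n) (raise A)
  raise-≤ₖ empty     _   = ≋⇒≤ₖ k (w₀ n) (w₀ n) λ _ → refl
  raise-≤ₖ (leave p) i<k = raise-≤ₖ p (<⇒≤ i<k)
  raise-≤ₖ {A = i ∷ A} (use p) i<k = ≤ₖ-trans k (raise-≤ₖ p (<⇒≤ i<k))
    (cover⇒≤ₖ k (raise A) i<k (m≤n⇒m≤1+n k≤n) (raise-cover p (≤-trans (<⇒≤ i<k) k≤n)))

  raise-ℓ : ∀ {i A B} → Sub i A B → i ≤ k → ℓ (raise A) ℕ.+ length B ≡ ℓ (w₀ n) ℕ.+ i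
  raise-ℓ empty     _   = refl
  raise-ℓ (leave p) i<k = trans (+-suc _ _) (trans (cong suc (raise-ℓ p (<⇒≤ i<k))) (sym (+-suc _ _)))
  raise-ℓ {A = i ∷ A} {B} (use p) i<k = trans (cong (ℕ._+ length B) (cover⇒ℓ (raise A) (<-≤-trans i<k (m≤n⇒m≤1+n k≤n)) (raise-cover p (≤-trans (<⇒≤ i<k) k≤n))))
    (trans (cong suc (raise-ℓ p (<⇒≤ i<k))) (sym (+-suc _ _)))

  fixedPositions-suc : ∀ i u w → fixedPositions (suc i) u w ≡ fixedPositions i u w ++ filter (λ a → u ⟨$⟩ a ℕ.≟ w ⟨$⟩ a) (i ∷ [])
  fixedPositions-suc i u w = trans (cong (filter _) (sym (upTo-∷ʳ i))) (filter-++ _ (upTo i) (i ∷ []))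

  raise-fixed : ∀ {i A B} → Sub i A B → i ≤ suc n → fixedPositions i (w₀ n) (raise A) ↭ B
  raise-fixed empty _ = ↭-refl
  raise-fixed {A = A} {B = i ∷ B} (leave p) (s≤s i≤n) = ↭-trans
    (↭-reflexive (trans (fixedPositions-suc i (w₀ n) (raise A)) (cong (fixedPositions i (w₀ n) (raise A) ++_)
      (filter-accept (λ a → w₀ n ⟨$⟩ a ℕ.≟ raise A ⟨$⟩ a) {x = i} {xs = []} (trans (reversal-≤ i≤n) (sym (raise-≥ p ≤-refl i≤n)))))))
    (↭-trans (↭-sym (∷↭∷ʳ i _)) (prep i (raise-fixed p (m≤n⇒m≤1+n i≤n))))
  raise-fixed {A = i ∷ A} {B = B} (use p) (s≤s i≤n) = ↭-trans
    (↭-reflexive (trans (fixedPositions-suc i (w₀ n) (raise (i ∷ A))) (trans (cong₂ _++_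
      (fixedPositions-ext i (w₀ n) (raise (i ∷ A)) (w₀ n) (raise A)
        (λ {a} a<i e → trans e (same a<i)) (λ {a} a<i e → trans e (sym (same a<i))))
      (filter-reject (λ a → w₀ n ⟨$⟩ a ℕ.≟ raise (i ∷ A) ⟨$⟩ a) {x = i} {xs = []} moved)) (++-identityʳ _))))
    (raise-fixed p (m≤n⇒m≤1+n i≤n))
    where
    same : ∀ {a} → a < i → raise (i ∷ A) ⟨$⟩ a ≡ raise A ⟨$⟩ a
    same a<i = raise-other {i} {A} (<⇒≢ a<i) (<⇒≢ (m<n⇒m<1+n (<-≤-trans a<i i≤n)))
    moved : w₀ n ⟨$⟩ i ≢ raise (i ∷ A) ⟨$⟩ i
    moved e = <⇒≢ (s≤s i≤n) (⟨$⟩-injective (raise A) (trans (raise-≥ p ≤-refl i≤n)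
      (trans (sym (reversal-≤ i≤n)) (trans e (raise-at i A)))))

  raise-⇢ : ∀ {A B} → Sub k A B → _⇢_ k (w₀ n) (raise A)
  raise-⇢ {A} p = raise-≤ₖ p ≤-refl
    , trans (cong (ℓ (raise A) ℕ.+_) (↭-length (raise-fixed p (m≤n⇒m≤1+n k≤n)))) (raise-ℓ p ≤-refl)

  blocked : ∀ {i A B a} → Sub i A B → i ≤ suc n → a ∉ A → a < i → All (_< a) A ⊎
    (raise A ⟨$⟩ suc n < n ∸ a × ∃[ e ] a < e × e < i × n ∸ a < raise A ⟨$⟩ e × raise A ⟨$⟩ e ≤ suc n)
  blocked {A = A} {a = a} (leave p) (s≤s i≤n) a∉ (s≤s a≤i) with m≤n⇒m<n∨m≡n a≤i
  ... | inj₂ refl = inj₁ (sub-A< p)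
  ... | inj₁ a<i with blocked p (m≤n⇒m≤1+n i≤n) a∉ a<i
  ...   | inj₁ all = inj₁ all
  ...   | inj₂ (top , e , a<e , e<i , q , r) = inj₂ (top , e , a<e , m<n⇒m<1+n e<i , q , r)
  blocked {A = i ∷ A} {a = a} (use p) (s≤s i≤n) a∉ (s≤s a≤i) = inj₂ (top , witness (blocked p (m≤n⇒m≤1+n i≤n) (a∉ ∘ there) a<i))
    where
    a<i : a < i
    a<i = ≤∧≢⇒< a≤i (a∉ ∘ here)
    top : raise (i ∷ A) ⟨$⟩ suc n < n ∸ a
    top = subst (_< n ∸ a) (sym (trans (raise-end i A) (raise-≥ p ≤-refl i≤n))) (∸-monoʳ-< a<i i≤n)
    witness : All (_< a) A ⊎ (raise A ⟨$⟩ suc n < n ∸ a × ∃[ e ] a < e × e < i × n ∸ a < raise A ⟨$⟩ e × raise A ⟨$⟩ e ≤ suc n) →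
              ∃[ e ] a < e × e < suc i × n ∸ a < raise (i ∷ A) ⟨$⟩ e × raise (i ∷ A) ⟨$⟩ e ≤ suc n
    witness (inj₁ all) = i , a<i , n<1+n i , subst (n ∸ a <_) (sym (raise-at i A)) (proj₁ tops) , subst (_≤ suc n) (sym (raise-at i A)) (proj₂ tops)
      where tops = raise-top p all (≤-trans a≤i i≤n)
    witness (inj₂ (_ , e , a<e , e<i , q , r)) = e , a<e , m<n⇒m<1+n e<i , subst (n ∸ a <_) (sym same) q , subst (_≤ suc n) (sym same) r
      where
      same : raise (i ∷ A) ⟨$⟩ e ≡ raise A ⟨$⟩ e
      same = raise-other {i} {A} (<⇒≢ e<i) (<⇒≢ (m<n⇒m<1+n (<-≤-trans e<i i≤n)))

  -- A position b from k to n holds a smaller value than a. At n + 1 the value is larger only while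
  -- no position beyond a has been used. For b beyond n + 1 a value in between stands at n + 1 or at
  -- the witness from `blocked`.
  cover-raise : ∀ {i A B a b} → Sub i A B → i ≤ k → a ∉ A → a < k → k ≤ b → Cover (raise A) a b → b ≡ suc n × All (_< a) A
  cover-raise {A = A} {a = a} {b} p i≤k a∉ a<k k≤b cov with <-cmp b (suc n) | extend p i≤k
  ... | tri< (s≤s b≤n) _ _ | _ , q = contradiction
        (subst₂ _<_ (raise-unused p a∉ (≤-trans (<⇒≤ a<k) k≤n)) (raise-≥ q k≤b b≤n) (less cov))
        (<-asym (∸-monoʳ-< (<-≤-trans a<k k≤b) b≤n))
  ... | tri≈ _ refl _ | _ , q with blocked q (m≤n⇒m≤1+n k≤n) a∉ a<k
  ...   | inj₁ all       = refl , all
  ...   | inj₂ (top , _) = contradiction (subst (_< raise A ⟨$⟩ suc n) (raise-unused p a∉ (≤-trans (<⇒≤ a<k) k≤n)) (less cov)) (<-asym top)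
  cover-raise {A = A} {a = a} {b} p i≤k a∉ a<k k≤b cov | tri> _ _ 1+n<b | _ , q = contradiction between (nothing cov)
    where
    at-a : raise A ⟨$⟩ a ≡ n ∸ a
    at-a = raise-unused p a∉ (≤-trans (<⇒≤ a<k) k≤n)
    at-b : raise A ⟨$⟩ b ≡ b
    at-b = raise-above p (≤-trans i≤k (m≤n⇒m≤1+n k≤n)) 1+n<b
    within : ∀ {v} → n ∸ a < v → v ≤ suc n → raise A ⟨$⟩ a < v × v < raise A ⟨$⟩ b
    within lt le = subst (_< _) (sym at-a) lt , subst (_ <_) (sym at-b) (≤-<-trans le 1+n<b)
    between : Between (raise A) a b
    between with blocked q (m≤n⇒m≤1+n k≤n) a∉ a<k
    ... | inj₁ all = suc n , m<n⇒m<1+n (<-≤-trans a<k k≤n) , 1+n<b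
                   , within (proj₁ tops) (proj₂ tops)
      where tops = raise-top q all (≤-trans (<⇒≤ a<k) k≤n)
    ... | inj₂ (_ , e , a<e , e<k , lt , le) = e , a<e , <-≤-trans e<k k≤b , within lt le

  -- By distinctness the chain never returns to a position in A, so `cover-raise` applies at each
  -- step and forces the positions to increase.
  chain-raise : ∀ {w v ts i A B} → Chain k w v ts → v ≋ raise A → Sub i A B → i ≤ k →
    Unique (map proj₁ ts) → All (_∉ A) (map proj₁ ts) → ∃[ A′ ] ∃[ B′ ] Sub k A′ B′ × w ≋ raise A′
  chain-raise {A = A} (done v≋w) e p i≤k _ _ with extend p i≤k
  ... | B′ , q = A , B′ , q , λ i → trans (sym (v≋w i)) (e i)
  chain-raise {w} {v} {A = A} (step {a = a} {b} {ts} a<k k≤b cov ch) e p i≤k (a∉ts ∷ un) (a∉ ∷ ts∉)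
    with cover-raise p i≤k a∉ a<k k≤b (record
      { less = subst₂ _<_ (e a) (e b) (less cov)
      ; nothing = λ (x , a<x , x<b , q , r) → nothing cov (x , a<x , x<b , subst₂ _<_ (sym (e a)) (sym (e x)) q , subst₂ _<_ (sym (e x)) (sym (e b)) r) })
  ... | refl , all with shrink p all
  ...   | _ , q = chain-raise ch (λ x → e (t a (suc n) ⟨$⟩ x)) (use q) a<k un
          (All.zipWith (λ { (a≢ , ∉A) (here refl) → a≢ refl ; (a≢ , ∉A) (there x∈) → ∉A x∈ }) (a∉ts , ts∉))

  ⇢-raise : ∀ w → _⇢_ k (w₀ n) w → ∃[ A ] ∃[ B ] Sub k A B × w ≋ raise A
  ⇢-raise w r with ≤ₖ⇒chain k (below r)
  ... | ts , ch = chain-raise ch (λ _ → refl) empty z≤n (proj₁ (chain-distinct k ch r)) (All.universal (λ _ ()) _)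

  boxes : List ℕ → Poly
  boxes []      = 1ₚ
  boxes (a ∷ A) = boxes A * box a (n ∸ a)

  boxes-invariant : ∀ {i} A → All (_< i) A → boxes A [ s-act i ] ≈ boxes A
  boxes-invariant []      _           = ≈-refl
  boxes-invariant {i} (a ∷ A) (a<i ∷ all) = *-cong (boxes-invariant A all)
    (≡⇒≈ (cong (λ r → box r (n ∸ a)) (swap-other i (suc i) (<⇒≢ a<i) (<⇒≢ (m<n⇒m<1+n a<i)))))

  𝔖-w₀ : ∀ m → 𝔖 (w₀ m) ≈ 𝔖w₀ m
  𝔖-w₀ m = ≈-trans (𝔖-level m (w₀ m) (λ {i} m<i → reversal-fixed m i m<i))
    (≈-trans (∂^-≋ (w₀ m ⁻¹ · w₀ m) ι (reversal-involutive m) (𝔖w₀ m)) (∂^-ι (𝔖w₀ m)))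

  𝔖-raise-tail : ∀ {i A B} → Sub i A B → i ≤ suc n → 𝔖 (raise A · tail-cycle (suc n ∸ i)) ≈ boxes A * diagram (shape i) N
  𝔖-raise-tail empty _ = begin
    𝔖 (w₀ n · tail-cycle (suc n))   ≈⟨ 𝔖-≋ (w₀ n · tail-cycle (suc n)) (w₀ (suc n)) w₀-tail ⟩
    𝔖 (w₀ (suc n))                  ≈⟨ 𝔖-w₀ (suc n) ⟩
    𝔖w₀ (suc n)                     ≈⟨ shape-start ⟩
    diagram (shape 0) N             ≈⟨ *-identityˡ _ ⟨
    1ₚ * diagram (shape 0) N        ∎
  𝔖-raise-tail {A = A} (leave {i} p) (s≤s i≤n) = begin
    𝔖 (raise A · tail-cycle (n ∸ i))
      ≈⟨ 𝔖-≋ (raise A · tail-cycle (n ∸ i)) (v · s i) (λ e → cong (raise A ⟨$⟩_) (sym (tail-s i≤n e))) ⟩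
    𝔖 (v · s i)                                ≈⟨ ∂-𝔖-descent v i desc ⟨
    ∂ i (𝔖 v)                                  ≈⟨ ∂-cong i (𝔖-raise-tail p (m≤n⇒m≤1+n i≤n)) ⟩
    ∂ i (boxes A * diagram (shape i) N)        ≈⟨ ∂-*-invariant i (diagram (shape i) N) (boxes-invariant A (sub-A< p)) ⟩
    boxes A * ∂ i (diagram (shape i) N)        ≈⟨ *-cong ≈-refl (shape-step i≤n) ⟩
    boxes A * diagram (shape (suc i)) N        ∎
    where
    v = raise A · tail-cycle (suc n ∸ i)
    desc : v ⟨$⟩ suc i < v ⟨$⟩ i
    desc = subst₂ _<_ (sym (trans (cong (raise A ⟨$⟩_) (tail-low i≤n)) (raise-≥ p ≤-refl i≤n))) (sym (cong (raise A ⟨$⟩_) (tail-high i≤n)))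
      (proj₁ (raise-top p (sub-A< p) i≤n))
  𝔖-raise-tail {A = i ∷ A} (use p) (s≤s i≤n) = begin
    𝔖 (raise (i ∷ A) · tail-cycle (n ∸ i))
      ≈⟨ 𝔖-≋ (raise (i ∷ A) · tail-cycle (n ∸ i)) (raise A · tail-cycle (suc n ∸ i)) (λ e → cong (raise A ⟨$⟩_) (sym (trans (tail-step i≤n e)
           (trans (⟨$⟩-swap (tail-cycle (n ∸ i)) i (suc i) e) (cong₂ (λ a b → swap a b (tail-cycle (n ∸ i) ⟨$⟩ e)) (tail-at i≤n) (tail-next i≤n)))))) ⟩
    𝔖 (raise A · tail-cycle (suc n ∸ i))       ≈⟨ 𝔖-raise-tail p (m≤n⇒m≤1+n i≤n) ⟩
    boxes A * diagram (shape i) N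
      ≈⟨ *-cong ≈-refl (diagram-box N (s≤s (≤-trans i≤n (m≤n+m n 2))) (trans (shape-≥ {i} ≤-refl) (+-∸-assoc 1 i≤n)) (shape-< (n<1+n i)) shape-other) ⟩
    boxes A * (diagram (shape (suc i)) N * box i (n ∸ i))
      ≈⟨ solve 3 (λ a b d → a :* (b :* d) := a :* d :* b) ≈-refl (boxes A) (diagram (shape (suc i)) N) (box i (n ∸ i)) ⟩
    boxes A * box i (n ∸ i) * diagram (shape (suc i)) N ∎

  𝔖-raise : ∀ {i A B} → Sub i A B → i ≤ suc n → 𝔖 (raise A) ≈ boxes A * 𝔖w₀ n
  𝔖-raise {A = A} p i≤1+n = begin
    𝔖 (raise A)                              ≈⟨ 𝔖-≋ (raise A) (raise A · tail-cycle (n ∸ n)) (λ e → cong (λ d → raise A ⟨$⟩ (tail-cycle d ⟨$⟩ e)) (sym (n∸n≡0 n))) ⟩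
    𝔖 (raise A · tail-cycle (suc n ∸ suc n)) ≈⟨ 𝔖-raise-tail (proj₂ (extend p i≤1+n)) ≤-refl ⟩
    boxes A * diagram (shape (suc n)) N      ≈⟨ *-cong ≈-refl shape-end ⟩
    boxes A * 𝔖w₀ n                          ∎

  -- The subsets of {0, …, i - 1}, with their complements

  subs : ℕ → List (List ℕ × List ℕ)
  subs zero    = ([] , []) ∷ []
  subs (suc i) = map (λ (A , B) → A , i ∷ B) (subs i) ++ map (λ (A , B) → i ∷ A , B) (subs i)

  subs-sound : ∀ i {A B} → (A , B) ∈ subs i → Sub i A B
  subs-sound zero (here refl) = empty
  subs-sound (suc i) m with ∈-++⁻ (map (λ (A , B) → A , i ∷ B) (subs i)) m
  ... | inj₁ m′ with ∈-map⁻ (λ (A , B) → A , i ∷ B) m′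
  ...   | _ , m″ , refl = leave (subs-sound i m″)
  subs-sound (suc i) m | inj₂ m′ with ∈-map⁻ (λ (A , B) → i ∷ A , B) m′
  ...   | _ , m″ , refl = use (subs-sound i m″)

  subs-complete : ∀ {i A B} → Sub i A B → (A , B) ∈ subs i
  subs-complete empty             = here refl
  subs-complete (leave {i} p)     = ∈-++⁺ˡ (∈-map⁺ (λ (A , B) → A , i ∷ B) (subs-complete p))
  subs-complete (use {i} p)       = ∈-++⁺ʳ (map (λ (A , B) → A , i ∷ B) (subs i)) (∈-map⁺ (λ (A , B) → i ∷ A , B) (subs-complete p))

  Apart : List ℕ × List ℕ → List ℕ × List ℕ → Set
  Apart (A , _) (A′ , _) = ¬ raise A ≋ raise A′

  subs-apart : ∀ i → i ≤ suc n → AllPairs Apart (subs i)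
  subs-apart zero    _ = [] ∷ []
  subs-apart (suc i) (s≤s i≤n) = AllPairsₚ.++⁺ (AllPairsₚ.map⁺ IH)
    (AllPairsₚ.map⁺ (AllPairs.map (λ {(A , _)} {(A′ , _)} ne e → ne (λ x → cancel A A′ e x)) IH))
    (All.tabulate λ {q} m → All.tabulate λ {q′} m′ → cross q q′ m m′)
    where
    IH = subs-apart i (m≤n⇒m≤1+n i≤n)
    cancel : ∀ A A′ → raise (i ∷ A) ≋ raise (i ∷ A′) → raise A ≋ raise A′
    cancel A A′ e x = trans (cong (raise A ⟨$⟩_) (sym (swap-involutive i (suc n) x))) (trans (e (t i (suc n) ⟨$⟩ x)) (cong (raise A′ ⟨$⟩_) (swap-involutive i (suc n) x)))
    cross : ∀ q q′ → q ∈ map (λ (A , B) → A , i ∷ B) (subs i) → q′ ∈ map (λ (A , B) → i ∷ A , B) (subs i) → Apart q q′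
    cross q q′ m m′ e with ∈-map⁻ (λ (A , B) → A , i ∷ B) m | ∈-map⁻ (λ (A , B) → i ∷ A , B) m′
    ... | (A , B) , m″ , refl | (A′ , B′) , m‴ , refl = <⇒≢ (proj₁ (raise-top q₂ (sub-A< q₂) i≤n))
          (trans (sym (raise-≥ (subs-sound i m″) ≤-refl i≤n)) (trans (e i) (raise-at i A′)))
      where q₂ = subs-sound i m‴

  module _ (j : ℕ) where

    private
      yv : ℕ → Poly
      yv b = var y[ n ∸ b ]
      xv : ℕ → Poly
      xv r = var x[ r ]

    -- The state of the expansion when the variables in rs are still to be treated: positions in A
    -- have contributed the factor x_a - y_{n-a}, and positions in B have had x_b replaced by
    -- y_{n-b}.
    partial : List ℕ → List ℕ × List ℕ → Poly
    partial rs (A , B) = boxes A * ev j (map yv B ++ map xv rs)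

    split : ∀ i rs → ∑ (map (partial (i ∷ rs)) (subs i)) ≈ ∑ (map (partial rs) (subs (suc i)))
    split i rs = begin
      ∑ (map (partial (i ∷ rs)) (subs i))
        ≈⟨ ∑-cong (subs i) (λ q _ → one-step q) ⟩
      ∑ (map (λ (A , B) → partial rs (A , i ∷ B) + partial rs (i ∷ A , B)) (subs i))
        ≈⟨ ∑-+ (λ (A , B) → partial rs (A , i ∷ B)) (λ (A , B) → partial rs (i ∷ A , B)) (subs i) ⟩
      ∑ (map (λ (A , B) → partial rs (A , i ∷ B)) (subs i)) + ∑ (map (λ (A , B) → partial rs (i ∷ A , B)) (subs i))
        ≡⟨ cong₂ (λ Ps Qs → ∑ Ps + ∑ Qs) (map-∘ (subs i)) (map-∘ (subs i)) ⟩
      ∑ (map (partial rs) (map (λ (A , B) → A , i ∷ B) (subs i))) + ∑ (map (partial rs) (map (λ (A , B) → i ∷ A , B) (subs i)))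
        ≈⟨ ∑-++ (map (partial rs) (map (λ (A , B) → A , i ∷ B) (subs i))) _ ⟨
      ∑ (map (partial rs) (map (λ (A , B) → A , i ∷ B) (subs i)) ++ map (partial rs) (map (λ (A , B) → i ∷ A , B) (subs i)))
        ≡⟨ cong ∑ (map-++ (partial rs) (map (λ (A , B) → A , i ∷ B) (subs i)) _) ⟨
      ∑ (map (partial rs) (subs (suc i))) ∎
      where
      one-step : ∀ q → partial (i ∷ rs) q ≈ partial rs (proj₁ q , i ∷ proj₂ q) + partial rs (i ∷ proj₁ q , proj₂ q)
      one-step (A , B) = begin
        boxes A * ev j (map yv B ++ xv i ∷ map xv rs)
          ≈⟨ *-cong ≈-refl (≈-trans (ev-↭ j (shift (xv i) (map yv B) (map xv rs))) (ev-head j (xv i) (yv i) (map yv B ++ map xv rs))) ⟩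
        boxes A * (ev j (yv i ∷ map yv B ++ map xv rs) + box i (n ∸ i) * ev j (map yv B ++ map xv rs))
          ≈⟨ solve 4 (λ a e b f → a :* (e :+ b :* f) := a :* e :+ a :* b :* f) ≈-refl (boxes A) _ (box i (n ∸ i)) (ev j (map yv B ++ map xv rs)) ⟩
        boxes A * ev j (yv i ∷ map yv B ++ map xv rs) + boxes A * box i (n ∸ i) * ev j (map yv B ++ map xv rs) ∎

    split-all : ∀ d i f → (∀ r → f r ≡ i ℕ.+ r) → ∑ (map (partial (applyUpTo f d)) (subs i)) ≈ ∑ (map (partial []) (subs (d ℕ.+ i)))
    split-all zero    i f e = ≈-refl
    split-all (suc d) i f e = begin
      ∑ (map (partial (f 0 ∷ applyUpTo (f ∘ suc) d)) (subs i))
        ≡⟨ cong (λ r → ∑ (map (partial (r ∷ applyUpTo (f ∘ suc) d)) (subs i))) (trans (e 0) (+-identityʳ i)) ⟩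
      ∑ (map (partial (i ∷ applyUpTo (f ∘ suc) d)) (subs i))   ≈⟨ split i (applyUpTo (f ∘ suc) d) ⟩
      ∑ (map (partial (applyUpTo (f ∘ suc) d)) (subs (suc i))) ≈⟨ split-all d (suc i) (f ∘ suc) (λ r → trans (e (suc r)) (+-suc i r)) ⟩
      ∑ (map (partial []) (subs (d ℕ.+ suc i)))                ≡⟨ cong (λ m → ∑ (map (partial []) (subs m))) (+-suc d i) ⟩
      ∑ (map (partial []) (subs (suc d ℕ.+ i)))                ∎

    base : PieriExpansion k j (w₀ n)
    base = record
      { support   = map (raise ∘ proj₁) (subs k)
      ; distinct  = AllPairsₚ.map⁺ (subs-apart k (m≤n⇒m≤1+n k≤n))
      ; complete  = complete′
      ; expansion = begin
          𝔖 (w₀ n) * elementary-x k j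
            ≈⟨ *-cong (𝔖-w₀ n) (solve 1 (λ e → e := :con (+ 1) :* e :+ :con (+ 0)) ≈-refl (elementary-x k j)) ⟩
          𝔖w₀ n * ∑ (map (partial (upTo k)) (subs 0))
            ≈⟨ *-cong ≈-refl (split-all k 0 (λ r → r) (λ _ → refl)) ⟩
          𝔖w₀ n * ∑ (map (partial []) (subs (k ℕ.+ 0)))
            ≡⟨ cong (λ m → 𝔖w₀ n * ∑ (map (partial []) (subs m))) (+-identityʳ k) ⟩
          𝔖w₀ n * ∑ (map (partial []) (subs k))
            ≈⟨ ∑-* (𝔖w₀ n) (partial []) (subs k) ⟨
          ∑ (map (λ q → 𝔖w₀ n * partial [] q) (subs k))
            ≈⟨ ∑-cong (subs k) (λ (A , B) m → one-term (subs-sound k m)) ⟩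
          ∑ (map (term k j (w₀ n) ∘ raise ∘ proj₁) (subs k))
            ≡⟨ cong ∑ (map-∘ (subs k)) ⟩
          ∑ (map (term k j (w₀ n)) (map (raise ∘ proj₁) (subs k))) ∎
      }
      where
      complete′ : ∀ w → _⇢_ k (w₀ n) w → w ∈≋ map (raise ∘ proj₁) (subs k)
      complete′ w r with ⇢-raise w r
      ... | A , B , p , e = raise A , ∈-map⁺ (raise ∘ proj₁) (subs-complete p) , e
      one-term : ∀ {A B} → Sub k A B → 𝔖w₀ n * (boxes A * ev j (map yv B ++ [])) ≈ term k j (w₀ n) (raise A)
      one-term {A} {B} p = begin
        𝔖w₀ n * (boxes A * ev j (map yv B ++ []))
          ≈⟨ solve 3 (λ a b e → a :* (b :* e) := e :* (b :* a)) ≈-refl (𝔖w₀ n) (boxes A) (ev j (map yv B ++ [])) ⟩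
        ev j (map yv B ++ []) * (boxes A * 𝔖w₀ n)
          ≈⟨ *-cong (≡⇒≈ (cong (ev j) (trans (++-identityʳ (map yv B)) (values B (sub-B< p))))) (≈-sym (𝔖-raise p (m≤n⇒m≤1+n k≤n))) ⟩
        at-values k j (w₀ n) B * 𝔖 (raise A)
          ≈⟨ *-cong (at-values-↭ k j (w₀ n) (↭-sym (raise-fixed p (m≤n⇒m≤1+n k≤n)))) ≈-refl ⟩
        weight k j (w₀ n) (raise A) * 𝔖 (raise A)
          ≡⟨ cong (_* 𝔖 (raise A)) (coeff-yes k j (raise-⇢ p)) ⟨
        term k j (w₀ n) (raise A) ∎
        where
        values : ∀ B → All (_< k) B → map yv B ≡ map (λ b → var y[ w₀ n ⟨$⟩ b ]) B
        values []      _           = refl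
        values (b ∷ B) (b<k ∷ all) = cong₂ (λ v vs → var y[ v ] ∷ vs) (sym (reversal-≤ (≤-trans (<⇒≤ b<k) k≤n))) (values B all)

-- The formula for arbitrary permutations

module _ (k j n : ℕ) (k≤n : k ≤ n) where

  -- Downward induction in the left weak order from w₀ n.
  pieri-below : ∀ m u → FixesAbove n u → ℓ (u ⁻¹ · w₀ n) ≤ m → PieriExpansion k j u
  pieri-below m u fu ℓ≤m = go m ℓ≤m (reducedWord-reduced (x ⁻¹)) (λ _ → refl)
    where
    x = u ⁻¹ · w₀ n
    -- The reduced word of x⁻¹ is inspected for its first letter only. If there is none, x is the
    -- identity and u = `w₀ n`. Otherwise the letter r is a descent of x, and reversal turns it into
    -- an i such that s_i u is longer than u and still fixes everything above n.
    go : ∀ {v w} m → ℓ x ≤ m → Reduced v w → v ≋ x ⁻¹ → PieriExpansion k j u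
    go m _ (nil v≋ι) v≋x⁻¹ = expansion-≋ k j (w₀ n) u
      (λ i → trans (sym (cong (w₀ n ⟨$⟩_) (trans (sym (v≋x⁻¹ i)) (v≋ι i)))) (reversal-involutive n (u ⟨$⟩ i)))
      (Base.base n k k≤n j)
    go {v} m ℓx≤m (cons {i = r} d _) v≋x⁻¹ = descend m ℓx≤m
      where
      x-descent : x ⟨$⟩ suc r < x ⟨$⟩ r
      x-descent = left-descent-cong r v (x ⁻¹) v≋x⁻¹ d
      x-fixes : FixesAbove n x
      x-fixes {e} n<e = trans (cong (u ⁻¹ ⟨$⟩_) (reversal-fixed n e n<e)) (fixes-⁻¹ u fu n<e)
      r<n : r < n
      r<n with <-cmp r n
      ... | tri< lt _ _ = lt
      ... | tri≈ _ e _ = contradiction (<-≤-trans (subst (_< x ⟨$⟩ r) (x-fixes (s≤s (≤-reflexive (sym e)))) x-descent) (fixes-≤ x x-fixes (≤-reflexive e)))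
                           (≤⇒≯ (m≤n⇒m≤1+n (≤-reflexive (sym e))))
      ... | tri> _ _ gt = contradiction (subst₂ _<_ (x-fixes (m<n⇒m<1+n gt)) (x-fixes gt) x-descent) (<-asym (n<1+n r))
      i = n ∸ suc r
      i<n : i < n
      i<n = ∸-monoʳ-< {o = 0} (s≤s z≤n) r<n
      1+i : suc i ≡ n ∸ r
      1+i = sym (+-∸-assoc 1 r<n)
      f-asc : u ⁻¹ ⟨$⟩ i < u ⁻¹ ⟨$⟩ suc i
      f-asc = subst₂ _<_ (cong (u ⁻¹ ⟨$⟩_) (reversal-≤ r<n)) (cong (u ⁻¹ ⟨$⟩_) (trans (reversal-≤ (<⇒≤ r<n)) (sym 1+i))) x-descent
      r≡ : n ∸ suc i ≡ r
      r≡ = trans (cong (n ∸_) 1+i) (m∸[m∸n]≡n (<⇒≤ r<n))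
      s-fixes : FixesAbove n (s i · u)
      s-fixes n<e = trans (cong (s i ⟨$⟩_) (fu n<e)) (swap-other i (suc i) (>⇒≢ (<-trans i<n n<e)) (>⇒≢ (≤-<-trans i<n n<e)))
      shorter : ℓ x ≡ suc (ℓ ((s i · u) ⁻¹ · w₀ n))
      shorter = trans (ℓ-descent x r x-descent) (cong suc (ℓ-cong (x · s r) ((s i · u) ⁻¹ · w₀ n) λ e →
        cong (u ⁻¹ ⟨$⟩_) (trans (cong (λ r → w₀ n ⟨$⟩ (s r ⟨$⟩ e)) (sym r≡)) (w₀-s i n i<n e))))
      descend : ∀ m → ℓ x ≤ m → PieriExpansion k j u
      descend zero    ℓx≤ = contradiction (≤-trans (≤-reflexive (sym shorter)) ℓx≤) λ ()
      descend (suc m) ℓx≤ = Descend.descended k j i u f-asc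
        (pieri-below m (s i · u) s-fixes (ℕ.s≤s⁻¹ (≤-trans (≤-reflexive (sym shorter)) ℓx≤)))

pieri : ∀ k j u → PieriExpansion k j u
pieri k j u = pieri-below k j (bound u ⊔ k) (m≤n⊔m (bound u) k) _ u (bound-fixes u (m≤m⊔n (bound u) k)) ≤-refl

-- The bound p ≤ k makes k - p a natural number. A negative p gives a j above k, where both
-- descriptions of E are zero.
codegree : ∀ k p → p ≤ℤ + k → ∃[ j ] p ≡ + k -ℤ + j
codegree k p p≤k with + k -ℤ p in eq | ℤₚ.i≤j⇒0≤j-i p≤k
... | + j | _ = j , trans (solveℤ 2 (λ k p → p :=ℤ k :-ℤ (k :-ℤ p)) refl (+ k) p) (cong (+ k -ℤ_) eq)
  where open ℤSolver.+-*-Solver using () renaming (solve to solveℤ; _:=_ to _:=ℤ_; _:-_ to _:-ℤ_)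

-- Tightness gives P_k(u,w) exactly k - ℓ(u,w) elements, and lowering k and p by ℓ(u,w) leaves j
-- unchanged. Sorting the values does no harm, as evaluation is symmetric.
term≈E : ∀ k j u w → _⇢_ k u w →
  term k j u w ≈ E (+ k -ℤ + j -ℤ ℓ[ u , w ]) (+ k -ℤ ℓ[ u , w ]) [ x↦y (𝒫 k u w) ] * 𝔖 w
term≈E k j u w r = *-cong (begin
  coeff k j u w                           ≡⟨ coeff-yes k j r ⟩
  weight k j u w                          ≡⟨ cong (ev j) (map-∘ (fixedPositions k u w)) ⟩
  ev j (map (λ a → var y[ a ]) values)    ≈⟨ ev-↭ j (↭-map⁺ (λ a → var y[ a ]) (↭-sym (sort-↭ values))) ⟩
  ev j (map (λ a → var y[ a ]) P)         ≈⟨ E-x↦y j P ⟨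
  E (+ length P -ℤ + j) (+ length P) [ x↦y P ]
    ≡⟨ cong₂ (λ a b → E a b [ x↦y P ]) (trans (cong (_-ℤ + j) length-P) (solveℤ 3 (λ k l j → k :-ℤ l :-ℤ j :=ℤ k :-ℤ j :-ℤ l) refl (+ k) ℓ[ u , w ] (+ j))) length-P ⟩
  E (+ k -ℤ + j -ℤ ℓ[ u , w ]) (+ k -ℤ ℓ[ u , w ]) [ x↦y P ] ∎) ≈-refl
  where
  open ℤSolver.+-*-Solver using () renaming (solve to solveℤ; _:=_ to _:=ℤ_; _:-_ to _:-ℤ_; _:+_ to _:+ℤ_)
  open Sort ℕₚ.≤-decTotalOrder using (sort-↭)
  values = map (u ⟨$⟩_) (fixedPositions k u w)
  P = 𝒫 k u w
  m = #fixed k u w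
  m≡ : length P ≡ m
  m≡ = trans (↭-length (sort-↭ values)) (length-map (u ⟨$⟩_) (fixedPositions k u w))
  length-P : + length P ≡ + k -ℤ ℓ[ u , w ]
  length-P = trans (cong +_ m≡) (trans (solveℤ 2 (λ a b → b :=ℤ a :+ℤ b :-ℤ a) refl (+ ℓ w) (+ m))
    (trans (cong (λ e → + e -ℤ + ℓ w) (tight r)) (solveℤ 3 (λ a k b → a :+ℤ k :-ℤ b :=ℤ k :-ℤ (b :-ℤ a)) refl (+ ℓ u) (+ k) (+ ℓ w))))

theorem7p1 : (u : S∞) (k : ℕ) → 1 ≤ k → (p : ℤ) → p ≤ℤ + k →
    ∃[ ws ] ws Enumerates (λ w → u ⟶[ k ] w) ×
    𝔖 u * E p (+ k) ≈
    ∑ (map (λ w → E (p -ℤ ℓ[ u , w ]) (+ k -ℤ ℓ[ u , w ]) [ x↦y (𝒫 k u w) ] * 𝔖 w) ws)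
theorem7p1 u k _ p p≤k with codegree k p p≤k
... | j , refl = ws , record
    { sound    = All.map (⇢⇒⟶ k) (Allₚ.all-filter (_⇢?_ k u) support)
    ; complete = λ w r → member w (⟶⇒⇢ k r)
    ; distinct = AllPairsₚ.filter⁺ (_⇢?_ k u) distinct
    } , (begin
    𝔖 u * E (+ k -ℤ + j) (+ k)        ≈⟨ *-cong ≈-refl (E-x j k) ⟩
    𝔖 u * elementary-x k j            ≈⟨ expansion ⟩
    ∑ (map (term k j u) support)      ≈⟨ restrict support ⟩
    ∑ (map (term k j u) ws)           ≈⟨ ∑-cong ws (λ w w∈ → term≈E k j u w (proj₂ (∈-filter⁻ (_⇢?_ k u) {xs = support} w∈))) ⟩
    ∑ (map (λ w → E (+ k -ℤ + j -ℤ ℓ[ u , w ]) (+ k -ℤ ℓ[ u , w ]) [ x↦y (𝒫 k u w) ] * 𝔖 w) ws) ∎)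
  where
  open PieriExpansion (pieri k j u)
  -- The support may contain unreachable permutations; dropping them, whose terms are zero, leaves
  -- an exact enumeration.
  ws = filter (_⇢?_ k u) support
  member : ∀ w → _⇢_ k u w → Any (w ≋_) ws
  member w r with complete w r
  ... | v , v∈ , e = lose (∈-filter⁺ (_⇢?_ k u) v∈ (⇢-≋ k u w u v (λ _ → refl) e r)) e
  restrict : ∀ vs → ∑ (map (term k j u) vs) ≈ ∑ (map (term k j u) (filter (_⇢?_ k u) vs))
  restrict [] = ≈-refl
  restrict (v ∷ vs) = go (_⇢?_ k u v)
    where
    go : Dec (_⇢_ k u v) → term k j u v + ∑ (map (term k j u) vs) ≈ ∑ (map (term k j u) (filter (_⇢?_ k u) (v ∷ vs)))
    go (yes r) = ≈-trans (+-cong ≈-refl (restrict vs)) (≡⇒≈ (cong (∑ ∘ map (term k j u)) (sym (filter-accept (_⇢?_ k u) r))))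
    go (no ¬r) = ≈-trans (+-cong (≈-trans (*-cong (≡⇒≈ (coeff-no k j ¬r)) ≈-refl) (zeroˡ _)) (restrict vs))
      (≈-trans (+-identityˡ _) (≡⇒≈ (cong (∑ ∘ map (term k j u)) (sym (filter-reject (_⇢?_ k u) ¬r)))))
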